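{- Let $F(X,Y)$ be a relational specification with inputs $X=\{X_1,\dots,X_n\}$ and outputs $Y=\{Y_1,\dots,Y_m\}$. If there exists an ordered set of Skolem functions $\Psi^*$ for $F$ with $|\mathrm{Im}(\Psi^*)|=k$, then there is a randomized algorithm with access to an NP oracle that synthesizes Skolem functions for $F$ in time $\mathrm{poly}(n,m,|F|,k)$.
   Context: $F(X,Y)$ is a Boolean formula/relation over Boolean input variables $X$ and Boolean output variables $Y$, and $|F|$ is its size. Skolem functions for $F$ are an $m$-tuple $\Psi=\langle\psi_1,\dots,\psi_m\rangle$ of Boolean functions (output as circuits) such that $\exists Y\,F(X,Y)\equiv F(X,\Psi(X))$, where $F(X,\Psi(X))$ is the substitution of $\psi_i(X)$ for each $Y_i$. It is not required that $\forall X\,\exists Y\,F(X,Y)$ holds. The image of $\Psi$ is $$\mathrm{Im}(\Psi)=\{\Psi(\vec x):\vec x\in\{0,1\}^n\text{ and }F(\vec x,\Psi(\vec x))=1\}.$$ -}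

module Defs where

open import Data.Bool using (Bool; true; false; not; _∧_; _∨_)
open import Data.Fin using (Fin; zero; suc; toℕ)
open import Data.List using (List; []; _∷_; length)
open import Data.List.Membership.Propositional using (_∈_)
open import Data.List.Relation.Unary.All using (All)
open import Data.List.Relation.Unary.Unique.Propositional using (Unique)
open import Data.Nat using (ℕ; zero; suc; _+_; _*_; _^_; _≤_)
open import Data.Product using (Σ-syntax; ∃-syntax; _×_; _,_)
open import Data.Vec using (Vec; []; _∷_; lookup; map; toList)
open import Function using (_⇔_)
open import Relation.Binary.PropositionalEquality using (_≡_)

data Formula (n m : ℕ) : Set where
  con     : Bool → Formula n m
  X       : Fin n → Formula n m
  Y       : Fin m → Formula n m
  neg     : Formula n m → Formula n m
  and or  : Formula n m → Formula n m → Formula n m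

⟦_⟧ : ∀ {n m} → Formula n m → Vec Bool n → Vec Bool m → Bool
⟦ con b   ⟧ x y = b
⟦ X i     ⟧ x y = lookup x i
⟦ Y j     ⟧ x y = lookup y j
⟦ neg F   ⟧ x y = not (⟦ F ⟧ x y)
⟦ and F G ⟧ x y = ⟦ F ⟧ x y ∧ ⟦ G ⟧ x y
⟦ or F G  ⟧ x y = ⟦ F ⟧ x y ∨ ⟦ G ⟧ x y

∣_∣ : ∀ {n m} → Formula n m → ℕ
∣ con b   ∣ = 1
∣ X i     ∣ = 1
∣ Y j     ∣ = 1
∣ neg F   ∣ = suc ∣ F ∣
∣ and F G ∣ = suc (∣ F ∣ + ∣ G ∣)
∣ or F G  ∣ = suc (∣ F ∣ + ∣ G ∣)

BoolFun : ℕ → Set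
BoolFun n = Vec Bool n → Bool

_at_ : ∀ {n m} → Vec (BoolFun n) m → Vec Bool n → Vec Bool m
Ψ at x = map (λ ψ → ψ x) Ψ

IsSkolem : ∀ {n m} → Formula n m → Vec (BoolFun n) m → Set
IsSkolem F Ψ = ∀ x → (∃[ y ] ⟦ F ⟧ x y ≡ true) ⇔ (⟦ F ⟧ x (Ψ at x) ≡ true)

InImage : ∀ {n m} → Formula n m → Vec (BoolFun n) m → Vec Bool m → Set
InImage F Ψ y = ∃[ x ] (Ψ at x ≡ y × ⟦ F ⟧ x (Ψ at x) ≡ true)

ImageSize : ∀ {n m} → Formula n m → Vec (BoolFun n) m → ℕ → Set
ImageSize {m = m} F Ψ k =
  Σ[ ys ∈ List (Vec Bool m) ]
    Unique ys × length ys ≡ k × (∀ y → y ∈ ys ⇔ InImage F Ψ y)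

data Gate (w : ℕ) : Set where
  con    : Bool → Gate w
  neg    : Fin w → Gate w
  and or : Fin w → Fin w → Gate w

-- Straight-line circuits over w existing wires.  A new gate becomes
-- wire zero and shifts the earlier wires up by one.

data Circuit (w : ℕ) : Set where
  output : Fin w → Circuit w
  gate   : Gate w → Circuit (suc w) → Circuit w

⟦_⟧ᵍ : ∀ {w} → Gate w → Vec Bool w → Bool
⟦ con b   ⟧ᵍ ρ = b
⟦ neg i   ⟧ᵍ ρ = not (lookup ρ i)
⟦ and i j ⟧ᵍ ρ = lookup ρ i ∧ lookup ρ j
⟦ or i j  ⟧ᵍ ρ = lookup ρ i ∨ lookup ρ j

⟦_⟧ᶜ : ∀ {w} → Circuit w → BoolFun w
⟦ output i ⟧ᶜ ρ = lookup ρ i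
⟦ gate g c ⟧ᶜ ρ = ⟦ c ⟧ᶜ (⟦ g ⟧ᵍ ρ ∷ ρ)

infixr 5 _∙_

data Tree : Set where
  leaf : Tree
  _∙_  : Tree → Tree → Tree

size : Tree → ℕ
size leaf    = 1
size (a ∙ b) = suc (size a + size b)

bool : Bool → Tree
bool false = leaf
bool true  = leaf ∙ leaf

unary : ℕ → Tree
unary zero    = leaf
unary (suc i) = leaf ∙ unary i

encFormula : ∀ {n m} → Formula n m → Tree
encFormula (con b)   = unary 0 ∙ bool b
encFormula (X i)     = unary 1 ∙ unary (toℕ i)
encFormula (Y j)     = unary 2 ∙ unary (toℕ j)
encFormula (neg F)   = unary 3 ∙ encFormula F
encFormula (and F G) = unary 4 ∙ encFormula F ∙ encFormula G
encFormula (or F G)  = unary 5 ∙ encFormula F ∙ encFormula G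

encGate : ∀ {w} → Gate w → Tree
encGate (con b)   = unary 0 ∙ bool b
encGate (neg i)   = unary 1 ∙ unary (toℕ i)
encGate (and i j) = unary 2 ∙ unary (toℕ i) ∙ unary (toℕ j)
encGate (or i j)  = unary 3 ∙ unary (toℕ i) ∙ unary (toℕ j)

encCircuit : ∀ {w} → Circuit w → Tree
encCircuit (output i) = unary 0 ∙ unary (toℕ i)
encCircuit (gate g c) = unary 1 ∙ encGate g ∙ encCircuit c

encCircuits : ∀ {n m} → Vec (Circuit n) m → Tree
encCircuits []       = leaf
encCircuits (c ∷ cs) = encCircuit c ∙ encCircuits cs

-- Algorithms: first-order recursive programs over binary trees, after
-- N. D. Jones, "Computability and Complexity from a Programming
-- Perspective".  Every step costs one unit.  Trees can be shared in
-- memory, so this is polynomially related to Turing machine time; for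
-- the same reason, whatever leaves the machine (oracle queries and the
-- final output) has to be charged by its full size.

data Mode : Set where
  det   : Mode
  randᴼ : Mode   -- may also toss fair coins and query an oracle

data Expr (μ : Mode) {s : ℕ} (arity : Vec ℕ s) (Γ : ℕ) : Set where
  var  : Fin Γ → Expr μ arity Γ
  leaf : Expr μ arity Γ
  _∙_  : Expr μ arity Γ → Expr μ arity Γ → Expr μ arity Γ
  case : Expr μ arity Γ → Expr μ arity Γ → Expr μ arity (2 + Γ) →
         Expr μ arity Γ
  bind : Expr μ arity Γ → Expr μ arity (suc Γ) → Expr μ arity Γ
  call : (f : Fin s) → Vec (Expr μ arity Γ) (lookup arity f) →
         Expr μ arity Γ
  toss : μ ≡ randᴼ → Expr μ arity Γ
  ask  : μ ≡ randᴼ → Expr μ arity Γ → Expr μ arity Γ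

record Program (μ : Mode) (inputs : ℕ) : Set where
  field
    {functions} : ℕ
    arity       : Vec ℕ functions
    body        : (f : Fin functions) → Expr μ arity (lookup arity f)
    main        : Expr μ arity inputs

-- ρ ⊢ e ∣ r ⇓ v ∣ r′ # t : in environment ρ, with r the coins still to be
-- tossed, e evaluates to v in time t, leaving the coins r′.

module Semantics (L : Tree → Bool) {μ : Mode} {s : ℕ} {arity : Vec ℕ s}
                 (body : (f : Fin s) → Expr μ arity (lookup arity f)) where

  infix 4 _⊢_∣_⇓_∣_#_ _⊢_∣_⇓*_∣_#_

  mutual

    data _⊢_∣_⇓_∣_#_ {Γ : ℕ} (ρ : Vec Tree Γ) :
           Expr μ arity Γ → List Bool → Tree → List Bool → ℕ → Set where

      ⇓var : ∀ {i r} → ρ ⊢ var i ∣ r ⇓ lookup ρ i ∣ r # 1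

      ⇓leaf : ∀ {r} → ρ ⊢ leaf ∣ r ⇓ leaf ∣ r # 1

      ⇓∙ : ∀ {e₁ e₂ r r₁ r₂ a b t₁ t₂} →
           ρ ⊢ e₁ ∣ r ⇓ a ∣ r₁ # t₁ →
           ρ ⊢ e₂ ∣ r₁ ⇓ b ∣ r₂ # t₂ →
           ρ ⊢ e₁ ∙ e₂ ∣ r ⇓ a ∙ b ∣ r₂ # suc (t₁ + t₂)

      ⇓case-leaf : ∀ {e e₀ e₁ r r₁ r₂ v t₁ t₂} →
                   ρ ⊢ e ∣ r ⇓ leaf ∣ r₁ # t₁ →
                   ρ ⊢ e₀ ∣ r₁ ⇓ v ∣ r₂ # t₂ →
                   ρ ⊢ case e e₀ e₁ ∣ r ⇓ v ∣ r₂ # suc (t₁ + t₂)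

      ⇓case-∙ : ∀ {e e₀ e₁ r r₁ r₂ a b v t₁ t₂} →
                ρ ⊢ e ∣ r ⇓ a ∙ b ∣ r₁ # t₁ →
                (a ∷ b ∷ ρ) ⊢ e₁ ∣ r₁ ⇓ v ∣ r₂ # t₂ →
                ρ ⊢ case e e₀ e₁ ∣ r ⇓ v ∣ r₂ # suc (t₁ + t₂)

      ⇓bind : ∀ {e₁ e₂ r r₁ r₂ a v t₁ t₂} →
              ρ ⊢ e₁ ∣ r ⇓ a ∣ r₁ # t₁ →
              (a ∷ ρ) ⊢ e₂ ∣ r₁ ⇓ v ∣ r₂ # t₂ →
              ρ ⊢ bind e₁ e₂ ∣ r ⇓ v ∣ r₂ # suc (t₁ + t₂)

      ⇓call : ∀ {f es r r₁ r₂ as v t₁ t₂} →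
              ρ ⊢ es ∣ r ⇓* as ∣ r₁ # t₁ →
              as ⊢ body f ∣ r₁ ⇓ v ∣ r₂ # t₂ →
              ρ ⊢ call f es ∣ r ⇓ v ∣ r₂ # suc (t₁ + t₂)

      ⇓toss : ∀ {p b r} → ρ ⊢ toss p ∣ b ∷ r ⇓ bool b ∣ r # 1

      ⇓ask : ∀ {p e r r₁ q t} →
             ρ ⊢ e ∣ r ⇓ q ∣ r₁ # t →
             ρ ⊢ ask p e ∣ r ⇓ bool (L q) ∣ r₁ # suc (t + size q)

    data _⊢_∣_⇓*_∣_#_ {Γ : ℕ} (ρ : Vec Tree Γ) :
           ∀ {a} → Vec (Expr μ arity Γ) a → List Bool →
           Vec Tree a → List Bool → ℕ → Set where

      ⇓[] : ∀ {r} → ρ ⊢ [] ∣ r ⇓* [] ∣ r # 0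

      ⇓∷ : ∀ {a} {e} {es : Vec (Expr μ arity Γ) a} {r r₁ r₂ v vs t₁ t₂} →
           ρ ⊢ e ∣ r ⇓ v ∣ r₁ # t₁ →
           ρ ⊢ es ∣ r₁ ⇓* vs ∣ r₂ # t₂ →
           ρ ⊢ e ∷ es ∣ r ⇓* v ∷ vs ∣ r₂ # t₁ + t₂

-- P with oracle L and coins r, on the given inputs, halts with output v;
-- computing and writing v takes at most T units of time.

RunsTo : ∀ {μ a} → (Tree → Bool) → Program μ a → List Bool →
         Vec Tree a → Tree → ℕ → Set
RunsTo L P r inputs v T =
  ∃[ r′ ] ∃[ t ] (inputs ⊢ main ∣ r ⇓ v ∣ r′ # t × t + size v ≤ T)
  where
  open Program P
  open Semantics L body

data Poly (v : ℕ) : Set where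
  con     : ℕ → Poly v
  var     : Fin v → Poly v
  _⊕_ _⊗_ : Poly v → Poly v → Poly v

eval : ∀ {v} → Poly v → Vec ℕ v → ℕ
eval (con c) xs = c
eval (var i) xs = lookup xs i
eval (p ⊕ q) xs = eval p xs + eval q xs
eval (p ⊗ q) xs = eval p xs * eval q xs

-- NP, by polynomial-time verifiers with polynomially long certificates.
-- A det program uses neither the oracle nor the coins it is run with.

record NP (L : Tree → Bool) : Set where
  field
    verifier    : Program det 2
    verdict     : Tree → Tree → Bool
    time        : Poly 2
    certificate : Poly 1
    verifies    : ∀ x w → RunsTo (λ _ → false) verifier [] (x ∷ w ∷ [])
                            (bool (verdict x w))
                            (eval time (size x ∷ size w ∷ []))
    correct     : ∀ x → (L x ≡ true) ⇔
                    (∃[ w ] (size w ≤ eval certificate (size x ∷ [])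
                             × verdict x w ≡ true))

-- For r drawn uniformly from {0,1}^T, A r holds with probability ≥ 2/3.

Probably : ∀ {T} → (Vec Bool T → Set) → Set
Probably {T} A =
  Σ[ rs ∈ List (Vec Bool T) ]
    Unique rs × All A rs × 2 * 2 ^ T ≤ 3 * length rs

Synthesizes : ∀ {n m} → (Tree → Bool) → Program randᴼ 3 → Formula n m →
              ℕ → List Bool → Set
Synthesizes {n} {m} L P F T r =
  Σ[ Ψ ∈ Vec (Circuit n) m ]
    IsSkolem F (map ⟦_⟧ᶜ Ψ)
    × RunsTo L P r (unary n ∷ unary m ∷ encFormula F ∷ []) (encCircuits Ψ) T

-- A toss takes a unit of time, so T coins suffice for T units of time.

SynthesizesWithin : ∀ {n m} → (Tree → Bool) → Program randᴼ 3 →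
                    Formula n m → ℕ → Set
SynthesizesWithin L P F T =
  Probably {T} (λ r → Synthesizes L P F T (toList r))

{-# OPTIONS --safe #-}

-- For the right k, some k-tuple u* of outputs contains a correct output for
-- every input that has one.  Keep a list S of counterexample inputs and let W
-- be the set of k-tuples that serve all of S.  Adding random affine equations
-- until W has about one solution left (Valiant–Vazirani) and letting the
-- oracle find a solution hits any half of W with probability at least 1/16,
-- so the outputs H found with polynomially many random equation systems
-- serve, with high probability, every input that at least half of W serves.
-- The union bound is taken over all lists S, hence the equations can be drawn
-- in advance and the rest of the algorithm is deterministic.  If the oracle
-- finds an input that H does not serve, putting it on S halves W; as u*
-- always stays in W, this happens at most k m times.  Otherwise the circuits
-- output the first element of H that is correct.  Since k is not known, k =
-- 0, 1, 2, … are tried in turn; success is certified by the oracle.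

module Submission where

open import Defs
open import Data.Bool using (Bool; T; true; false; not; _∧_; _∨_; _xor_; if_then_else_)
open import Data.Bool.Properties using (∧-zeroʳ; ∧-comm; ∧-idem; ∨-zeroʳ; ∨-comm; ∨-assoc)
open import Data.Empty using (⊥; ⊥-elim)
open import Data.Fin using (Fin; zero; suc; toℕ; #_)
open import Data.Fin.Properties using (toℕ<n)
open import Data.List using (List; []; _∷_; length)
open import Data.List.Membership.Propositional using (_∈_)
open import Data.List.Properties using (length-++; length-map; ++-identityʳ)
open import Data.List.Membership.Propositional.Properties using (∈-map⁻)
open import Data.List.Relation.Unary.All as All using (All; []; _∷_)
import Data.List.Relation.Unary.All.Properties as All
open import Data.List.Relation.Unary.Any using (here; there)
open import Data.List.Relation.Unary.Unique.Propositional using (Unique; []; _∷_)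
import Data.List.Relation.Unary.Unique.Propositional.Properties as Unique
open import Data.Maybe using (Maybe; just; nothing)
open import Data.Nat using (ℕ; zero; suc; _+_; _*_; _^_; _∸_; _⊔_; _≤_; _<_; z≤n; s≤s; _≤?_; _≤ᵇ_; >-nonZero)
open import Data.Nat.Properties
open import Data.Nat.Tactic.RingSolver using (solve-∀)
open import Data.Product using (Σ-syntax; ∃-syntax; _×_; _,_; proj₁; proj₂)
open import Data.Sum using (_⊎_; inj₁; inj₂)
open import Data.Vec using (Vec; []; _∷_; lookup; map; toList; tabulate)
open import Data.Vec.Properties using (tabulate-cong; tabulate∘lookup)
open import Function using (_⇔_; _∘_; Equivalence; mk⇔)
open import Relation.Binary.PropositionalEquality using (_≡_; refl; sym; trans; cong; cong₂; subst; module ≡-Reasoning)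
open import Relation.Nullary.Decidable using (True; toWitness; dec-true)
import Data.List as List
import Data.Vec as Vec

-- The tuples found need not be nearly uniform in W, and no majority vote is taken: a single output
-- that serves the input is enough, because the circuits can test every element of H against F
-- themselves. Hitting a large half with constant probability therefore suffices. Chance affects
-- only whether the search ends in time. Whatever H an attempt returns has passed a final oracle
-- query, so an attempt with too small a k may succeed by luck and is still right, and the
-- probability has to be estimated for the true k alone. The number of coins of an attempt depends
-- only on the sizes, so the coins set aside for the attempts 0, ..., k form a product of uniform
-- distributions. The verifier has to keep its polynomial bound on every tree, malformed ones
-- included. Hence the functions on trees are total and treat missing parts as `leaf`. What a
-- program function computes and what it costs are established together, while the meaning of the
-- computed tree is a separate matter.

-- Binary trees

nonleaf : Tree → Bool
nonleaf leaf    = false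
nonleaf (a ∙ b) = true

fst snd : Tree → Tree
fst leaf    = leaf
fst (a ∙ b) = a
snd leaf    = leaf
snd (a ∙ b) = b

hd : Tree → Bool
hd t = nonleaf (fst t)

len : Tree → ℕ
len leaf    = 0
len (a ∙ b) = suc (len b)

len<size : ∀ t → suc (len t) ≤ size t
len<size leaf    = ≤-refl
len<size (a ∙ b) = s≤s (≤-trans (len<size b) (m≤n+m (size b) (size a)))

size-fst : ∀ t → size (fst t) ≤ size t
size-fst leaf    = ≤-refl
size-fst (a ∙ b) = m≤n⇒m≤1+n (m≤m+n (size a) (size b))

size-snd : ∀ t → size (snd t) ≤ size t
size-snd leaf    = ≤-refl
size-snd (a ∙ b) = m≤n⇒m≤1+n (m≤n+m (size b) (size a))

size-bool : ∀ b → size (bool b) ≤ 3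
size-bool false = s≤s z≤n
size-bool true  = ≤-refl

nonleaf-bool : ∀ b → nonleaf (bool b) ≡ b
nonleaf-bool false = refl
nonleaf-bool true  = refl

-- Polynomial bounds as degrees

opaque
  -- Opaque, because exponents in the hundreds should not unfold into iterated products.
  _^ᵖ_ : ∀ {a} → Poly a → ℕ → Poly a
  p ^ᵖ zero  = con 1
  p ^ᵖ suc d = p ⊗ (p ^ᵖ d)

-- Bounds are tracked as powers of a base M ≥ 2: only the degree is kept,
-- and it absorbs every constant factor.  The numerals that occur as degrees
-- are not sharp.

module Growth (M : ℕ) (2≤M : 2 ≤ M) where

  opaque
    unfolding _^ᵖ_

    P : ℕ → ℕ
    P d = M ^ d

    P-mono : ∀ {a b} → a ≤ b → P a ≤ P b
    P-mono = ^-monoʳ-≤ M ⦃ >-nonZero (≤-trans (s≤s z≤n) 2≤M) ⦄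

    P-* : ∀ a b → P a * P b ≡ P (a + b)
    P-* a b = sym (^-distribˡ-+-* M a b)

    1≤P : ∀ d → 1 ≤ P d
    1≤P d = P-mono {0} {d} z≤n

    2P≤P : ∀ d → P d + P d ≤ P (suc d)
    2P≤P d = ≤-trans (≤-reflexive (cong (P d +_) (sym (+-identityʳ (P d)))))
                     (*-monoˡ-≤ (P d) 2≤M)

    M≤P1 : M ≤ P 1
    M≤P1 = ≤-reflexive (sym (*-identityʳ M))

    eval-^ᵖ : ∀ {a} (p : Poly a) xs → eval p xs ≡ M → ∀ d → eval (p ^ᵖ d) xs ≡ P d
    eval-^ᵖ p xs e zero    = refl
    eval-^ᵖ p xs e (suc d) = cong₂ _*_ e (eval-^ᵖ p xs e d)

    infix 7 _×P_
    -- The cost of `ℓ` iterations at `P b` each. It is kept apart from the powers, since absorbing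
    -- it would raise the degree at every iteration.
    _×P_ : ℕ → ℕ → ℕ
    ℓ ×P b = ℓ * P b

    ×P≡ : ∀ ℓ b → ℓ ×P b ≡ ℓ * P b
    ×P≡ ℓ b = refl

    ×P-mono : ∀ {ℓ k} b → ℓ ≤ k → ℓ ×P b ≤ k ×P b
    ×P-mono b = *-monoˡ-≤ (P b)

    ×P-+ : ∀ ℓ k b → ℓ ×P b + k ×P b ≤ (ℓ + k) ×P b
    ×P-+ ℓ k b = ≤-reflexive (sym (*-distribʳ-+ (P b) ℓ k))

  n≤P : ∀ n → n ≤ P n
  n≤P zero    = z≤n
  n≤P (suc n) = ≤-trans (+-mono-≤ (1≤P n) (n≤P n)) (2P≤P n)

  P-+ : ∀ {a b x y} → x ≤ P a → y ≤ P b → x + y ≤ P (suc (a ⊔ b))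
  P-+ {a} {b} p q =
    ≤-trans (+-mono-≤ (≤-trans p (P-mono (m≤m⊔n a b))) (≤-trans q (P-mono (m≤n⊔m a b))))
            (2P≤P (a ⊔ b))

  P-suc : ∀ {a x} → x ≤ P a → suc x ≤ P (suc a)
  P-suc {a} p = ≤-trans (+-mono-≤ (1≤P a) p) (2P≤P a)

  P-×  : ∀ {a b x y} → x ≤ P a → y ≤ P b → x * y ≤ P (a + b)
  P-× {a} {b} p q = ≤-trans (*-mono-≤ p q) (≤-reflexive (P-* a b))

  P-node : ∀ {a b x y} → x ≤ P a → y ≤ P b → suc (x + y) ≤ P (2 + (a ⊔ b))
  P-node p q = P-suc (P-+ p q)

  P-up : ∀ {a b x} → {True (a ≤? b)} → x ≤ P a → x ≤ P b
  P-up {a} {b} {_} {t} p = ≤-trans p (P-mono (toWitness t))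

-- Derived expressions and evaluation rules with cost

tt ff : Tree
tt = bool true
ff = leaf

module _ {μ : Mode} {s : ℕ} {arity : Vec ℕ s} where

  v : ∀ {Γ} (i : ℕ) {i<Γ : True (suc i ≤? Γ)} → Expr μ arity Γ
  v {Γ} i {i<Γ} = var (#_ i {Γ} {i<Γ})

  const : ∀ {Γ} → Tree → Expr μ arity Γ
  const leaf    = leaf
  const (a ∙ b) = const a ∙ const b

  Fst Snd Truth : ∀ {Γ} → Expr μ arity Γ → Expr μ arity Γ
  Fst e   = case e leaf (v 0)
  Snd e   = case e leaf (v 1)
  Truth e = case e leaf (const tt)

module Timed (L : Tree → Bool) {μ : Mode} {s : ℕ} {arity : Vec ℕ s}
             (body : (f : Fin s) → Expr μ arity (lookup arity f))
             (M : ℕ) (2≤M : 2 ≤ M) where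

  open Semantics L body
  open Growth M 2≤M

  -- The time is at most P d + D; D collects the cost of recursive calls,
  -- which must not be inflated by the arithmetic of degrees.

  record Runs {Γ} (ρ : Vec Tree Γ) (e : Expr μ arity Γ) (r : List Bool)
              (t : Tree) (r′ : List Bool) (d D : ℕ) : Set where
    constructor runs
    field
      {time} : ℕ
      eval⇓  : ρ ⊢ e ∣ r ⇓ t ∣ r′ # time
      bound  : time ≤ P d + D

  record Runs* {Γ a} (ρ : Vec Tree Γ) (es : Vec (Expr μ arity Γ) a) (r : List Bool)
               (ts : Vec Tree a) (r′ : List Bool) (d D : ℕ) : Set where
    constructor runs
    field
      {time} : ℕ
      eval⇓  : ρ ⊢ es ∣ r ⇓* ts ∣ r′ # time
      bound  : time ≤ P d + D

  +-bound : ∀ {d₁ d₂ D₁ D₂ t₁ t₂} → t₁ ≤ P d₁ + D₁ → t₂ ≤ P d₂ + D₂ →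
            t₁ + t₂ ≤ P (suc (d₁ ⊔ d₂)) + (D₁ + D₂)
  +-bound {d₁} {d₂} {D₁} {D₂} p q =
    ≤-trans (+-mono-≤ p q)
      (≤-trans (≤-reflexive (interchange (P d₁) D₁ (P d₂) D₂))
               (+-monoˡ-≤ (D₁ + D₂) (P-+ {d₁} {d₂} ≤-refl ≤-refl)))
    where
    interchange : ∀ a b c d → (a + b) + (c + d) ≡ (a + c) + (b + d)
    interchange = solve-∀

  suc-bound : ∀ {d D t} → t ≤ P d + D → suc t ≤ P (suc d) + D
  suc-bound {d} {D} p = ≤-trans (s≤s p) (+-monoˡ-≤ D (P-suc {d} ≤-refl))

  node-bound : ∀ {d₁ d₂ D₁ D₂ t₁ t₂} → t₁ ≤ P d₁ + D₁ → t₂ ≤ P d₂ + D₂ →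
               suc (t₁ + t₂) ≤ P (2 + (d₁ ⊔ d₂)) + (D₁ + D₂)
  node-bound p q = suc-bound (+-bound p q)

  1≤P0 : 1 ≤ P 0 + 0
  1≤P0 = ≤-trans (1≤P 0) (m≤m+n _ 0)

  module _ {Γ} {ρ : Vec Tree Γ} where

    var⇓ : ∀ {i r} → Runs ρ (var i) r (lookup ρ i) r 0 0
    var⇓ = runs ⇓var 1≤P0

    leaf⇓ : ∀ {r} → Runs ρ leaf r leaf r 0 0
    leaf⇓ = runs ⇓leaf 1≤P0

    infixr 5 _∙⇓_
    _∙⇓_ : ∀ {e₁ e₂ r r₁ r₂ a b d₁ d₂ D₁ D₂} →
           Runs ρ e₁ r a r₁ d₁ D₁ → Runs ρ e₂ r₁ b r₂ d₂ D₂ →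
           Runs ρ (e₁ ∙ e₂) r (a ∙ b) r₂ (2 + (d₁ ⊔ d₂)) (D₁ + D₂)
    runs p x ∙⇓ runs q y = runs (⇓∙ p q) (node-bound x y)

    case-leaf⇓ : ∀ {e e₀ e₁ r r₁ r₂ a d₁ d₂ D₁ D₂} →
                 Runs ρ e r leaf r₁ d₁ D₁ → Runs ρ e₀ r₁ a r₂ d₂ D₂ →
                 Runs ρ (case e e₀ e₁) r a r₂ (2 + (d₁ ⊔ d₂)) (D₁ + D₂)
    case-leaf⇓ (runs p x) (runs q y) = runs (⇓case-leaf p q) (node-bound x y)

    case-∙⇓ : ∀ {e e₀ e₁ r r₁ r₂ a b c d₁ d₂ D₁ D₂} →
              Runs ρ e r (a ∙ b) r₁ d₁ D₁ → Runs (a ∷ b ∷ ρ) e₁ r₁ c r₂ d₂ D₂ →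
              Runs ρ (case e e₀ e₁) r c r₂ (2 + (d₁ ⊔ d₂)) (D₁ + D₂)
    case-∙⇓ (runs p x) (runs q y) = runs (⇓case-∙ p q) (node-bound x y)

    bind⇓ : ∀ {e₁ e₂ r r₁ r₂ a c d₁ d₂ D₁ D₂} →
            Runs ρ e₁ r a r₁ d₁ D₁ → Runs (a ∷ ρ) e₂ r₁ c r₂ d₂ D₂ →
            Runs ρ (bind e₁ e₂) r c r₂ (2 + (d₁ ⊔ d₂)) (D₁ + D₂)
    bind⇓ (runs p x) (runs q y) = runs (⇓bind p q) (node-bound x y)

    call⇓ : ∀ {f es r r₁ r₂ as c d₁ d₂ D₁ D₂} →
            Runs* ρ es r as r₁ d₁ D₁ → Runs as (body f) r₁ c r₂ d₂ D₂ →
            Runs ρ (call f es) r c r₂ (2 + (d₁ ⊔ d₂)) (D₁ + D₂)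
    call⇓ (runs p x) (runs q y) = runs (⇓call p q) (node-bound x y)

    toss⇓ : ∀ {p b r} → Runs ρ (toss p) (b ∷ r) (bool b) r 0 0
    toss⇓ = runs ⇓toss 1≤P0

    ask⇓ : ∀ {p e r r₁ q d c D} → size q ≤ P c → Runs ρ e r q r₁ d D →
           Runs ρ (ask p e) r (bool (L q)) r₁ (2 + (d ⊔ c)) (D + 0)
    ask⇓ x (runs p y) = runs (⇓ask p) (node-bound y (≤-trans x (m≤m+n _ 0)))

    []⇓ : ∀ {r} → Runs* ρ [] r [] r 0 0
    []⇓ = runs ⇓[] z≤n

    infixr 5 _∷⇓_
    _∷⇓_ : ∀ {a} {e} {es : Vec (Expr μ arity Γ) a} {r r₁ r₂ t ts d₁ d₂ D₁ D₂} →
           Runs ρ e r t r₁ d₁ D₁ → Runs* ρ es r₁ ts r₂ d₂ D₂ →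
           Runs* ρ (e ∷ es) r (t ∷ ts) r₂ (suc (d₁ ⊔ d₂)) (D₁ + D₂)
    runs p x ∷⇓ runs q y = runs (⇓∷ p q) (+-bound x y)

    up⇓ : ∀ {b e r t r′ d D} → {d≤b : True (d ≤? b)} →
          Runs ρ e r t r′ d D → Runs ρ e r t r′ b D
    up⇓ {b} {d = d} {D} {d≤b} (runs p x) = runs p (≤-trans x (+-monoˡ-≤ D (P-mono (toWitness d≤b))))

    upD⇓ : ∀ {e r t r′ d D E} → D ≤ E → Runs ρ e r t r′ d D → Runs ρ e r t r′ d E
    upD⇓ {d = d} D≤E (runs p x) = runs p (≤-trans x (+-monoʳ-≤ (P d) D≤E))

  module _ {Γ} {ρ : Vec Tree Γ} where

    const⇓ : ∀ {r} t → Runs ρ (const t) r t r (size t) 0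
    const⇓ t = runs (go t) (≤-trans (n≤P (size t)) (m≤m+n _ 0))
      where
      go : ∀ {r} t → ρ ⊢ const t ∣ r ⇓ t ∣ r # size t
      go leaf    = ⇓leaf
      go (a ∙ b) = ⇓∙ (go a) (go b)

  module _ {Γ} {ρ : Vec Tree Γ} where

    Fst⇓ : ∀ {e r r′ t d D} → Runs ρ e r t r′ d D →
           Runs ρ (Fst e) r (fst t) r′ (2 + (d ⊔ 0)) (D + 0)
    Fst⇓ {t = leaf}  x = case-leaf⇓ x leaf⇓
    Fst⇓ {t = a ∙ b} x = case-∙⇓ x var⇓

    Snd⇓ : ∀ {e r r′ t d D} → Runs ρ e r t r′ d D →
           Runs ρ (Snd e) r (snd t) r′ (2 + (d ⊔ 0)) (D + 0)
    Snd⇓ {t = leaf}  x = case-leaf⇓ x leaf⇓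
    Snd⇓ {t = a ∙ b} x = case-∙⇓ x var⇓

    Truth⇓ : ∀ {e r r′ t d D} → Runs ρ e r t r′ d D →
             Runs ρ (Truth e) r (bool (nonleaf t)) r′ (2 + (d ⊔ 3)) (D + 0)
    Truth⇓ {t = leaf}  x = case-leaf⇓ x (up⇓ leaf⇓)
    Truth⇓ {t = a ∙ b} x = case-∙⇓ x (const⇓ tt)

    -- The bound covers both branches, as `b` is unknown; each branch may use its own equation for
    -- `b`.
    if⇓ : ∀ {e e₀ e₁ r r₁ r₂ b c d₁ d₂ d₃ D₁ D₂} →
          Runs ρ e r (bool b) r₁ d₁ D₁ →
          (b ≡ false → Runs ρ e₀ r₁ c r₂ d₂ D₂) →
          (b ≡ true → Runs (leaf ∷ leaf ∷ ρ) e₁ r₁ c r₂ d₃ D₂) →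
          Runs ρ (case e e₀ e₁) r c r₂ (2 + (d₁ ⊔ (d₂ ⊔ d₃))) (D₁ + D₂)
    if⇓ {b = false} {d₂ = d₂} {d₃} x y z with y refl
    ... | runs q w = case-leaf⇓ x (runs q (≤-trans w (+-monoˡ-≤ _ (P-mono (m≤m⊔n d₂ d₃)))))
    if⇓ {b = true} {d₂ = d₂} {d₃} x y z with z refl
    ... | runs q w = case-∙⇓ x (runs q (≤-trans w (+-monoˡ-≤ _ (P-mono (m≤n⊔m d₂ d₃)))))

    -- The work of one iteration fits into one unit `P b`, and the recursive calls stay linear in
    -- their number. Composing degrees through the recursion would give an exponential bound
    -- instead.
    iterate⇓ : ∀ {ℓ b e r t r′ d D} → {d≤b : True (d ≤? b)} → D ≤ ℓ ×P b →
               Runs ρ e r t r′ d D → Runs ρ e r t r′ 0 (suc ℓ ×P b)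
    iterate⇓ {ℓ} {b} {d≤b = d≤b} D≤ (runs p x) =
      runs p (≤-trans x (≤-trans (+-mono-≤ (P-mono (toWitness d≤b)) D≤)
        (≤-trans (≤-reflexive (trans (cong (P b +_) (×P≡ ℓ b)) (sym (×P≡ (suc ℓ) b))))
                 (m≤n+m _ (P 0)))))

    last⇓ : ∀ {b e r t r′ d} → {d≤b : True (d ≤? b)} →
            Runs ρ e r t r′ d 0 → Runs ρ e r t r′ 0 (1 ×P b)
    last⇓ {d≤b = d≤b} = iterate⇓ {ℓ = 0} {d≤b = d≤b} z≤n

    tail⇓ : ∀ {ℓ b e r t r′ d} → {d≤b : True (d ≤? b)} →
            Runs ρ e r t r′ d (ℓ ×P b) → Runs ρ e r t r′ 0 (suc ℓ ×P b)
    tail⇓ {d≤b = d≤b} = iterate⇓ {d≤b = d≤b} ≤-refl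

    -- Closes a recursion. Once the number of iterations is known to be polynomial, the product is
    -- again a power, and the function can be called inside another loop.
    flat⇓ : ∀ {ℓ b e r t r′ a} → ℓ ≤ P a → Runs ρ e r t r′ 0 (ℓ ×P b) →
            Runs ρ e r t r′ (suc (a + b)) 0
    flat⇓ {ℓ} {b} {a = a} ℓ≤ (runs p x) =
      runs p (≤-trans x (≤-trans (P-+ {0} ≤-refl (≤-trans (≤-reflexive (×P≡ ℓ b)) (P-× {a} {b} ℓ≤ ≤-refl)))
                                 (m≤m+n _ 0)))

    value⇓ : ∀ {e r t t′ r′ d D} → t ≡ t′ → Runs ρ e r t r′ d D → Runs ρ e r t′ r′ d D
    value⇓ refl x = x

-- The program

arity : Vec ℕ 24
arity = 2 ∷ 3 ∷ 2 ∷ 4 ∷ 3 ∷ 3 ∷ 3 ∷ 2 ∷ 3 ∷ 2 ∷ 2 ∷ 1 ∷ 2 ∷ 2 ∷ 3 ∷ 4 ∷ 4 ∷ 8 ∷ 4 ∷ 2 ∷ 3 ∷ 2 ∷ 3 ∷ 4 ∷ []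

pattern lookupᶠ     = zero
pattern evalᶠ       = suc lookupᶠ
pattern dropᶠ       = suc evalᶠ
pattern chopᶠ       = suc dropᶠ
pattern coversᶠ     = suc chopᶠ
pattern coversAllᶠ  = suc coversᶠ
pattern dotᶠ        = suc coversAllᶠ
pattern rowsᶠ       = suc dotᶠ
pattern padᶠ        = suc rowsᶠ
pattern addᶠ        = suc padᶠ
pattern mulᶠ        = suc addᶠ
pattern drawRowᶠ    = suc mulᶠ
pattern drawBlockᶠ  = suc drawRowᶠ
pattern drawPoolᶠ   = suc drawBlockᶠ
pattern findᶠ       = suc drawPoolᶠ
pattern sampleᶠ     = suc findᶠ
pattern samplesᶠ    = suc sampleᶠ
pattern roundsᶠ     = suc samplesᶠ
pattern loopᶠ       = suc roundsᶠ
pattern substᶠ      = suc loopᶠ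
pattern chooseᶠ     = suc substᶠ
pattern gatesᶠ      = suc chooseᶠ
pattern compileᶠ    = suc gatesᶠ
pattern circuitsᶠ   = suc compileᶠ

-- One table of functions serves both modes; the verifier calls none of
-- the functions that toss coins or ask the oracle.

tossᵉ : ∀ {Γ} μ → Expr μ arity Γ
tossᵉ det   = leaf
tossᵉ randᴼ = toss refl

askᵉ : ∀ {Γ} μ → Expr μ arity Γ → Expr μ arity Γ
askᵉ det   e = leaf
askᵉ randᴼ e = ask refl e

-- Above each clause: the function and its arguments.  v i is the variable
-- bound i binders ago; case binds two in its second branch only.

body : ∀ μ (f : Fin 24) → Expr μ arity (lookup arity f)
-- lookup (i , xs)
body μ lookupᶠ =
  case (v 0) (Truth (Fst (v 1))) (call lookupᶠ (v 1 ∷ Snd (v 3) ∷ []))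
-- eval (F , x , y)
body μ evalᶠ =
  case (v 0) leaf
  -- The tag is a unary number. Each further `case` strips one unit of it and, by binding two
  -- variables, shifts all other indices by two.
  (case (v 0) (Truth (v 1))
  (case (v 1) (call lookupᶠ (v 3 ∷ v 5 ∷ []))
  (case (v 1) (call lookupᶠ (v 5 ∷ v 8 ∷ []))
  (case (v 1) (case (call evalᶠ (v 7 ∷ v 9 ∷ v 10 ∷ [])) (const tt) leaf)
  (case (v 1)
    (case (call evalᶠ (Fst (v 9) ∷ v 11 ∷ v 12 ∷ [])) leaf
          (call evalᶠ (Snd (v 11) ∷ v 13 ∷ v 14 ∷ [])))
    (case (call evalᶠ (Fst (v 11) ∷ v 13 ∷ v 14 ∷ []))
          (call evalᶠ (Snd (v 11) ∷ v 13 ∷ v 14 ∷ []))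
          (const tt)))))))
-- drop (l , t)
body μ dropᶠ = case (v 0) (v 1) (call dropᶠ (v 1 ∷ Snd (v 3) ∷ []))
-- chop (K , m , t , acc)
body μ chopᶠ =
  case (v 0) (v 3)
    (v 4 ∙ call chopᶠ (v 1 ∷ v 3 ∷ call dropᶠ (v 3 ∷ v 4 ∷ []) ∷ v 5 ∷ []))
-- covers (F , x , H)
body μ coversᶠ =
  case (v 2) leaf
    (case (call evalᶠ (v 2 ∷ v 3 ∷ v 0 ∷ [])) (call coversᶠ (v 2 ∷ v 3 ∷ v 1 ∷ [])) (const tt))
-- coversAll (F , S , C)
body μ coversAllᶠ =
  case (v 1) (const tt)
    (case (call coversᶠ (v 2 ∷ v 0 ∷ v 4 ∷ [])) leaf
          (call coversAllᶠ (v 4 ∷ v 3 ∷ v 6 ∷ [])))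
-- dot (row , t , acc)
body μ dotᶠ =
  case (v 0) (v 2)
    (call dotᶠ (v 1 ∷ Snd (v 3) ∷
      case (v 0) (v 4) (case (Fst (v 5)) (v 6) (case (v 8) (const tt) leaf)) ∷ []))
-- rows (rows , t)
body μ rowsᶠ =
  case (v 0) (const tt)
    (case (call dotᶠ (v 0 ∷ v 3 ∷ leaf ∷ [])) (call rowsᶠ (v 1 ∷ v 3 ∷ [])) leaf)
-- pad (l , w , s)
body μ padᶠ =
  case (v 0) (v 2) (Truth (Fst (v 3)) ∙ call padᶠ (v 1 ∷ Snd (v 3) ∷ v 4 ∷ []))
-- add (a , b)
body μ addᶠ = case (v 0) (v 1) (leaf ∙ call addᶠ (v 1 ∷ v 3 ∷ []))
-- mul (a , b)
body μ mulᶠ = case (v 0) leaf (call addᶠ (v 3 ∷ call mulᶠ (v 1 ∷ v 3 ∷ []) ∷ []))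
-- drawRow s
body μ drawRowᶠ = case (v 0) leaf (tossᵉ μ ∙ call drawRowᶠ (v 1 ∷ []))
-- drawBlock (j , s)
body μ drawBlockᶠ =
  case (v 0) leaf (call drawRowᶠ (v 3 ∷ []) ∙ call drawBlockᶠ (v 1 ∷ v 3 ∷ []))
-- drawPool (R , s)
body μ drawPoolᶠ =
  case (v 0) leaf (call drawBlockᶠ (v 3 ∷ v 3 ∷ []) ∙ call drawPoolᶠ (v 1 ∷ v 3 ∷ []))
-- find (l , s , stuff)
body μ findᶠ =
  case (v 0) (v 1)
    (call findᶠ (v 1 ∷ (askᵉ μ (v 1 ∙ (const tt ∙ v 3) ∙ v 4) ∙ v 3) ∷ v 4 ∷ []))
-- sample (rows , N , C , acc)
body μ sampleᶠ =
  bind (call chopᶠ (Fst (Snd (v 2)) ∷ Snd (Snd (v 2)) ∷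
                    call findᶠ (v 1 ∷ leaf ∷ (leaf ∙ v 0 ∙ v 2) ∷ []) ∷ v 3 ∷ []))
    (case (v 1) (v 0) (call sampleᶠ (v 1 ∷ v 4 ∷ v 5 ∷ v 2 ∷ [])))
-- samples (pool , N , C , acc)
body μ samplesᶠ =
  case (v 0) (v 3)
    (call samplesᶠ (v 1 ∷ v 3 ∷ v 4 ∷ call sampleᶠ (v 0 ∷ v 3 ∷ v 4 ∷ v 5 ∷ []) ∷ []))
-- rounds (fuel , S , pool , N , F , n , m , K)
body μ roundsᶠ =
  case (v 0) leaf
    (bind (call samplesᶠ (v 4 ∷ v 5 ∷ ((v 6 ∙ v 3) ∙ v 9 ∙ v 8) ∷ leaf ∷ []))
    (bind (const tt ∙ v 7 ∙ v 8 ∙ v 0)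
    (bind (call findᶠ (call addᶠ (v 9 ∷ v 10 ∷ []) ∷ leaf ∷ v 0 ∷ []))
      -- The search returns some vector even if there is no counterexample; a query without free
      -- bits tells the two cases apart.
      (case (askᵉ μ (leaf ∙ v 0 ∙ v 1))
        (leaf ∙ call circuitsᶠ (v 11 ∷ leaf ∷ v 9 ∷ v 2 ∷ []))
        (call roundsᶠ (v 6 ∷ (v 2 ∙ v 8) ∷ v 9 ∷ v 10 ∷ v 11 ∷ v 12 ∷ v 13 ∷ v 14 ∷ []))))))
-- loop (K , n , m , F)
body μ loopᶠ =
  bind (call mulᶠ (v 0 ∷ v 2 ∷ []))
  (bind (call drawPoolᶠ
           -- This product is `poolSize`; every block then gets `suc N` rows of `suc N` bits.
           (call mulᶠ (const (unary 16) ∷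
              call mulᶠ ((leaf ∙ leaf ∙ call addᶠ (v 2 ∷ v 3 ∷ [])) ∷ (leaf ∙ leaf ∙ v 0) ∷ []) ∷ [])
            ∷ (leaf ∙ v 0) ∷ []))
    (case (call roundsᶠ ((leaf ∙ v 1) ∷ leaf ∷ v 0 ∷ v 1 ∷ v 5 ∷ v 3 ∷ v 4 ∷ v 2 ∷ []))
      (call loopᶠ ((leaf ∙ v 2) ∷ v 3 ∷ v 4 ∷ v 5 ∷ []))
      (v 1)))
-- subst (F , h)
body μ substᶠ =
  case (v 0) leaf
  (case (v 0) (v 2)
  (case (v 1) (v 4)
  (case (v 1) (leaf ∙ call lookupᶠ (v 5 ∷ v 7 ∷ []))
  (case (v 1) (const (unary 3) ∙ call substᶠ (v 7 ∷ v 9 ∷ []))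
  (case (v 1)
    (const (unary 4) ∙ call substᶠ (Fst (v 9) ∷ v 11 ∷ []) ∙ call substᶠ (Snd (v 9) ∷ v 11 ∷ []))
    (const (unary 5) ∙ call substᶠ (Fst (v 11) ∷ v 13 ∷ []) ∙ call substᶠ (Snd (v 11) ∷ v 13 ∷ [])))))))
-- choose (H , j , F)
body μ chooseᶠ =
  case (v 0) (leaf ∙ leaf)
    (case (call lookupᶠ (v 3 ∷ v 0 ∷ []))
      (const (unary 4) ∙ (const (unary 3) ∙ call substᶠ (v 4 ∷ v 0 ∷ [])) ∙ call chooseᶠ (v 1 ∷ v 3 ∷ v 4 ∷ []))
      (const (unary 5) ∙ call substᶠ (v 6 ∷ v 2 ∷ []) ∙ call chooseᶠ (v 3 ∷ v 5 ∷ v 6 ∷ [])))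
-- gates (F , d)
body μ gatesᶠ =
  case (v 0) leaf
  (case (v 0) (leaf ∙ v 3)
  (case (v 1) (leaf ∙ v 5)
  (case (v 1) (leaf ∙ v 7)
  (case (v 1) (leaf ∙ call gatesᶠ (v 7 ∷ v 9 ∷ []))
    (leaf ∙ call gatesᶠ (Snd (v 9) ∷ call gatesᶠ (Fst (v 9) ∷ v 11 ∷ []) ∷ []))))))
-- compile (F , d , rest)
body μ compileᶠ =
  case (v 0) leaf
  (case (v 0) (const (unary 1) ∙ (leaf ∙ v 1) ∙ v 4)
  (case (v 1)
    (bind (call addᶠ (v 5 ∷ v 3 ∷ []))
          (const (unary 1) ∙ (const (unary 2) ∙ v 0 ∙ v 0) ∙ v 7))
  (case (v 1) leaf
  (case (v 1)
    (call compileᶠ (v 7 ∷ v 9 ∷ (const (unary 1) ∙ (const (unary 1) ∙ leaf) ∙ v 10) ∷ []))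
  (case (v 1) (binary 2 (Fst (v 9)) (Snd (v 9)) (v 11) (v 12))
              (binary 3 (Fst (v 11)) (Snd (v 11)) (v 13) (v 14)))))))
  where
  binary : ∀ {Γ} → ℕ → (a b d c : Expr μ arity Γ) → Expr μ arity Γ
  binary g a b d c =
    call compileᶠ (a ∷ d ∷
      call compileᶠ (b ∷ call gatesᶠ (a ∷ d ∷ []) ∷
        (const (unary 1) ∙ (const (unary g) ∙ leaf ∙ call gatesᶠ (b ∷ leaf ∷ [])) ∙ c) ∷ []) ∷ [])
-- circuits (l , j , F , H)
body μ circuitsᶠ =
  case (v 0) leaf
    (call compileᶠ (call chooseᶠ (v 5 ∷ v 3 ∷ v 4 ∷ []) ∷ leaf ∷ (leaf ∙ leaf) ∷ [])
     ∙ call circuitsᶠ (v 1 ∷ (leaf ∙ v 3) ∷ v 4 ∷ v 5 ∷ []))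

-- The verifier: models on trees and their cost

lookupT : Tree → Tree → Bool
lookupT leaf    xs = hd xs
lookupT (_ ∙ i) xs = lookupT i (snd xs)

evalT : Tree → Tree → Tree → Bool
evalT leaf x y = false
evalT (leaf ∙ p) x y = nonleaf p
evalT ((_ ∙ leaf) ∙ p) x y = lookupT p x
evalT ((_ ∙ _ ∙ leaf) ∙ p) x y = lookupT p y
evalT ((_ ∙ _ ∙ _ ∙ leaf) ∙ p) x y = not (evalT p x y)
evalT ((_ ∙ _ ∙ _ ∙ _ ∙ leaf) ∙ leaf) x y = false
evalT ((_ ∙ _ ∙ _ ∙ _ ∙ leaf) ∙ (p ∙ q)) x y = evalT p x y ∧ evalT q x y
evalT ((_ ∙ _ ∙ _ ∙ _ ∙ _ ∙ _) ∙ leaf) x y = false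
evalT ((_ ∙ _ ∙ _ ∙ _ ∙ _ ∙ _) ∙ (p ∙ q)) x y = evalT p x y ∨ evalT q x y

dropT : Tree → Tree → Tree
dropT leaf    t = t
dropT (_ ∙ l) t = dropT l (snd t)

-- The entries are whole suffixes of `t` rather than pieces of `m` bits. Later readers look only at
-- the first `m` bits, and sharing makes a suffix free.
chopT : Tree → Tree → Tree → Tree → Tree
chopT leaf    m t acc = acc
chopT (_ ∙ K) m t acc = t ∙ chopT K m (dropT m t) acc

coversT : Tree → Tree → Tree → Bool
coversT F x leaf    = false
coversT F x (h ∙ H) = evalT F x h ∨ coversT F x H

coversAllT : Tree → Tree → Tree → Bool
coversAllT F leaf    C = true
coversAllT F (x ∙ S) C = coversT F x C ∧ coversAllT F S C

dotT : Tree → Tree → Bool → Bool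
dotT leaf      t a = a
dotT (b ∙ row) t a = dotT row (snd t) ((nonleaf b ∧ hd t) xor a)

rowsT : Tree → Tree → Bool
rowsT leaf         t = true
rowsT (row ∙ rows) t = not (dotT row t false) ∧ rowsT rows t

padT : Tree → Tree → Tree → Tree
padT leaf    w s = s
padT (_ ∙ l) w s = bool (hd w) ∙ padT l (snd w) s

module VerifierTime (L : Tree → Bool) (μ : Mode) (M : ℕ) (2≤M : 2 ≤ M) where

  open Growth M 2≤M public
  open Timed L (body μ) M 2≤M public

  infix 4 _⟨_⟩⇓_∣_
  _⟨_⟩⇓_∣_ : ∀ f → Vec Tree (lookup arity f) → Tree → ℕ → Set
  f ⟨ as ⟩⇓ t ∣ D = ∀ {r} → Runs as (body μ f) r t r 0 D

  infix 4 _⟨_⟩⇓_#_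
  _⟨_⟩⇓_#_ : ∀ f → Vec Tree (lookup arity f) → Tree → ℕ → Set
  f ⟨ as ⟩⇓ t # d = ∀ {r} → Runs as (body μ f) r t r d 0

  infix 4 _≼
  record _≼ (t : Tree) : Set where
    constructor small
    field size≤ : size t ≤ P 1
  open _≼ public

  ≼-fst : ∀ {a b} → a ∙ b ≼ → a ≼
  ≼-fst {a} {b} (small p) = small (≤-trans (size-fst (a ∙ b)) p)

  ≼-snd : ∀ {a b} → a ∙ b ≼ → b ≼
  ≼-snd {a} {b} (small p) = small (≤-trans (size-snd (a ∙ b)) p)

  -- For a list that is merely scanned only the length matters. A list cut from a tuple consists of
  -- overlapping suffixes, so its size need not stay below `M`.
  record Short (t : Tree) : Set where
    constructor short
    field len≤ : suc (len t) ≤ P 1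
  open Short public

  ≼-short : ∀ {t} → t ≼ → Short t
  ≼-short {t} (small p) = short (≤-trans (len<size t) p)

  len≼ : ∀ {t} → t ≼ → suc (len t) ≤ P 1
  len≼ = len≤ ∘ ≼-short

  lookup-spine⇓ : ∀ i xs → lookupᶠ ⟨ i ∷ xs ∷ [] ⟩⇓ bool (lookupT i xs) ∣ suc (len i) ×P 20
  lookup-spine⇓ leaf xs =
    last⇓ (case-leaf⇓ var⇓ (Truth⇓ (Fst⇓ var⇓)))
  lookup-spine⇓ (a ∙ i) xs =
    tail⇓ (case-∙⇓ var⇓ (call⇓ (var⇓ ∷⇓ Snd⇓ var⇓ ∷⇓ []⇓) (lookup-spine⇓ i (snd xs))))

  lookup⇓ : ∀ {i xs} → i ≼ → lookupᶠ ⟨ i ∷ xs ∷ [] ⟩⇓ bool (lookupT i xs) # 22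
  lookup⇓ {i} {xs} i≼ = flat⇓ (len≼ i≼) (lookup-spine⇓ i xs)

  drop-spine⇓ : ∀ l t → dropᶠ ⟨ l ∷ t ∷ [] ⟩⇓ dropT l t ∣ suc (len l) ×P 20
  drop-spine⇓ leaf t = last⇓ (case-leaf⇓ var⇓ var⇓)
  drop-spine⇓ (a ∙ l) t =
    tail⇓ (case-∙⇓ var⇓ (call⇓ (var⇓ ∷⇓ Snd⇓ var⇓ ∷⇓ []⇓) (drop-spine⇓ l (snd t))))

  drop⇓ : ∀ {l t} → l ≼ → dropᶠ ⟨ l ∷ t ∷ [] ⟩⇓ dropT l t # 22
  drop⇓ {l} {t} l≼ = flat⇓ (len≼ l≼) (drop-spine⇓ l t)

  if-false⇓ : ∀ {Γ} {ρ : Vec Tree Γ} {r b} (f : Bool → Bool) → b ≡ false →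
    ∀ {e r′ d D} → Runs ρ e r (bool (f false)) r′ d D → Runs ρ e r (bool (f b)) r′ d D
  if-false⇓ f refl x = x

  if-true⇓ : ∀ {Γ} {ρ : Vec Tree Γ} {r b} (f : Bool → Bool) → b ≡ true →
    ∀ {e r′ d D} → Runs ρ e r (bool (f true)) r′ d D → Runs ρ e r (bool (f b)) r′ d D
  if-true⇓ f refl x = x

  eval-leaf⇓ : ∀ x y → evalᶠ ⟨ leaf ∷ x ∷ y ∷ [] ⟩⇓ leaf # 2
  eval-leaf⇓ x y = case-leaf⇓ var⇓ leaf⇓

  -- With two recursive calls the charge has to be additive over subtrees; hence the measure is
  -- `size` and not `len`.
  two-calls : ∀ b g p q → (size p ×P b) + (size q ×P b) ≤ (size g + size (p ∙ q)) ×P b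
  two-calls b g p q = ≤-trans (×P-+ (size p) (size q) b) (×P-mono b (≤-trans (n≤1+n _) (m≤n+m _ (size g))))

  eval-size⇓ : ∀ F x y → F ≼ → evalᶠ ⟨ F ∷ x ∷ y ∷ [] ⟩⇓ bool (evalT F x y) ∣ size F ×P 60
  eval-size⇓ leaf x y F≼ = last⇓ (case-leaf⇓ var⇓ leaf⇓)
  eval-size⇓ (leaf ∙ p) x y F≼ =
    iterate⇓ z≤n (case-∙⇓ var⇓ (case-leaf⇓ var⇓ (Truth⇓ var⇓)))
  eval-size⇓ ((_ ∙ leaf) ∙ p) x y F≼ =
    iterate⇓ z≤n (case-∙⇓ var⇓ (case-∙⇓ var⇓ (case-leaf⇓ var⇓
      (call⇓ (var⇓ ∷⇓ var⇓ ∷⇓ []⇓) (lookup⇓ (≼-snd F≼))))))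
  eval-size⇓ ((_ ∙ _ ∙ leaf) ∙ p) x y F≼ =
    iterate⇓ z≤n (case-∙⇓ var⇓ (case-∙⇓ var⇓ (case-∙⇓ var⇓ (case-leaf⇓ var⇓
      (call⇓ (var⇓ ∷⇓ var⇓ ∷⇓ []⇓) (lookup⇓ (≼-snd F≼)))))))
  eval-size⇓ (g@(_ ∙ _ ∙ _ ∙ leaf) ∙ p) x y F≼ =
    iterate⇓ (≤-trans (≤-reflexive (+-identityʳ _)) (×P-mono 60 (m≤n+m (size p) (size g))))
      (case-∙⇓ var⇓ (case-∙⇓ var⇓ (case-∙⇓ var⇓ (case-∙⇓ var⇓ (case-leaf⇓ var⇓
        (if⇓ (call⇓ (var⇓ ∷⇓ var⇓ ∷⇓ var⇓ ∷⇓ []⇓) (eval-size⇓ p x y (≼-snd F≼)))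
             (λ e → if-false⇓ not e (const⇓ tt))
             (λ e → if-true⇓ not e leaf⇓)))))))
  eval-size⇓ ((_ ∙ _ ∙ _ ∙ _ ∙ leaf) ∙ leaf) x y F≼ =
    iterate⇓ z≤n
      (case-∙⇓ var⇓ (case-∙⇓ var⇓ (case-∙⇓ var⇓ (case-∙⇓ var⇓ (case-∙⇓ var⇓ (case-leaf⇓ var⇓
        (case-leaf⇓ (upD⇓ z≤n (call⇓ (Fst⇓ var⇓ ∷⇓ var⇓ ∷⇓ var⇓ ∷⇓ []⇓) (eval-leaf⇓ x y))) leaf⇓)))))))
  eval-size⇓ (g@(_ ∙ _ ∙ _ ∙ _ ∙ leaf) ∙ (p ∙ q)) x y F≼ =
    iterate⇓ (two-calls 60 g p q)
      (case-∙⇓ var⇓ (case-∙⇓ var⇓ (case-∙⇓ var⇓ (case-∙⇓ var⇓ (case-∙⇓ var⇓ (case-leaf⇓ var⇓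
        (if⇓ (call⇓ (Fst⇓ var⇓ ∷⇓ var⇓ ∷⇓ var⇓ ∷⇓ []⇓) (eval-size⇓ p x y (≼-fst (≼-snd F≼))))
             (λ e → if-false⇓ (_∧ _) e (upD⇓ z≤n leaf⇓))
             (λ e → if-true⇓ (_∧ _) e
               (call⇓ (Snd⇓ var⇓ ∷⇓ var⇓ ∷⇓ var⇓ ∷⇓ []⇓) (eval-size⇓ q x y (≼-snd (≼-snd F≼))))))))))))
  eval-size⇓ ((_ ∙ _ ∙ _ ∙ _ ∙ _ ∙ _) ∙ leaf) x y F≼ =
    iterate⇓ z≤n
      (case-∙⇓ var⇓ (case-∙⇓ var⇓ (case-∙⇓ var⇓ (case-∙⇓ var⇓ (case-∙⇓ var⇓ (case-∙⇓ var⇓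
        (case-leaf⇓ (call⇓ (Fst⇓ var⇓ ∷⇓ var⇓ ∷⇓ var⇓ ∷⇓ []⇓) (eval-leaf⇓ x y))
                    (call⇓ (Snd⇓ var⇓ ∷⇓ var⇓ ∷⇓ var⇓ ∷⇓ []⇓) (eval-leaf⇓ x y)))))))))
  eval-size⇓ (g@(_ ∙ _ ∙ _ ∙ _ ∙ _ ∙ _) ∙ (p ∙ q)) x y F≼ =
    iterate⇓ (two-calls 60 g p q)
      (case-∙⇓ var⇓ (case-∙⇓ var⇓ (case-∙⇓ var⇓ (case-∙⇓ var⇓ (case-∙⇓ var⇓ (case-∙⇓ var⇓
        (if⇓ (call⇓ (Fst⇓ var⇓ ∷⇓ var⇓ ∷⇓ var⇓ ∷⇓ []⇓) (eval-size⇓ p x y (≼-fst (≼-snd F≼))))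
             (λ e → if-false⇓ (_∨ _) e
               (call⇓ (Snd⇓ var⇓ ∷⇓ var⇓ ∷⇓ var⇓ ∷⇓ []⇓) (eval-size⇓ q x y (≼-snd (≼-snd F≼)))))
             (λ e → if-true⇓ (_∨ _) e (upD⇓ z≤n (const⇓ tt))))))))))

  eval⇓ : ∀ {F x y} → F ≼ → evalᶠ ⟨ F ∷ x ∷ y ∷ [] ⟩⇓ bool (evalT F x y) # 62
  eval⇓ {F} {x} {y} F≼ = flat⇓ (size≤ F≼) (eval-size⇓ F x y F≼)

  chop-spine⇓ : ∀ K {m} t acc → m ≼ → chopᶠ ⟨ K ∷ m ∷ t ∷ acc ∷ [] ⟩⇓ chopT K m t acc ∣ suc (len K) ×P 40
  chop-spine⇓ leaf t acc m≼ = last⇓ (case-leaf⇓ var⇓ var⇓)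
  chop-spine⇓ (_ ∙ K) {m} t acc m≼ =
    tail⇓ (case-∙⇓ var⇓ (var⇓ ∙⇓ call⇓
      (var⇓ ∷⇓ var⇓ ∷⇓ call⇓ (var⇓ ∷⇓ var⇓ ∷⇓ []⇓) (drop⇓ m≼) ∷⇓ var⇓ ∷⇓ []⇓)
      (chop-spine⇓ K (dropT m t) acc m≼)))

  chop⇓ : ∀ {K m t acc} → K ≼ → m ≼ → chopᶠ ⟨ K ∷ m ∷ t ∷ acc ∷ [] ⟩⇓ chopT K m t acc # 42
  chop⇓ {K} K≼ m≼ = flat⇓ (len≼ K≼) (chop-spine⇓ K _ _ m≼)

  covers-spine⇓ : ∀ {F} x H → F ≼ → coversᶠ ⟨ F ∷ x ∷ H ∷ [] ⟩⇓ bool (coversT F x H) ∣ suc (len H) ×P 80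
  covers-spine⇓ x leaf F≼ = last⇓ (case-leaf⇓ var⇓ leaf⇓)
  covers-spine⇓ x (h ∙ H) F≼ =
    tail⇓ (case-∙⇓ var⇓ (if⇓ (call⇓ (var⇓ ∷⇓ var⇓ ∷⇓ var⇓ ∷⇓ []⇓) (eval⇓ F≼))
      (λ e → if-false⇓ (_∨ _) e (call⇓ (var⇓ ∷⇓ var⇓ ∷⇓ var⇓ ∷⇓ []⇓) (covers-spine⇓ x H F≼)))
      (λ e → if-true⇓ (_∨ _) e (upD⇓ z≤n (const⇓ tt)))))

  covers⇓ : ∀ {F x H} → F ≼ → Short H → coversᶠ ⟨ F ∷ x ∷ H ∷ [] ⟩⇓ bool (coversT F x H) # 82
  covers⇓ F≼ H≤ = flat⇓ (len≤ H≤) (covers-spine⇓ _ _ F≼)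

  coversAll-spine⇓ : ∀ {F} S {C} → F ≼ → Short C →
    coversAllᶠ ⟨ F ∷ S ∷ C ∷ [] ⟩⇓ bool (coversAllT F S C) ∣ suc (len S) ×P 100
  coversAll-spine⇓ leaf F≼ C≤ = last⇓ (case-leaf⇓ var⇓ (const⇓ tt))
  coversAll-spine⇓ (x ∙ S) F≼ C≤ =
    tail⇓ (case-∙⇓ var⇓ (if⇓ (call⇓ (var⇓ ∷⇓ var⇓ ∷⇓ var⇓ ∷⇓ []⇓) (covers⇓ F≼ C≤))
      (λ e → if-false⇓ (_∧ _) e (upD⇓ z≤n leaf⇓))
      (λ e → if-true⇓ (_∧ _) e (call⇓ (var⇓ ∷⇓ var⇓ ∷⇓ var⇓ ∷⇓ []⇓) (coversAll-spine⇓ S F≼ C≤)))))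

  coversAll⇓ : ∀ {F S C} → F ≼ → Short S → Short C →
    coversAllᶠ ⟨ F ∷ S ∷ C ∷ [] ⟩⇓ bool (coversAllT F S C) # 102
  coversAll⇓ F≼ S≤ C≤ = flat⇓ (len≤ S≤) (coversAll-spine⇓ _ F≼ C≤)

  dot-step⇓ : ∀ {a b t acc r d D row} →
    Runs (a ∷ row ∷ (a ∙ row) ∷ t ∷ bool acc ∷ []) (case (v 0) (v 4)
      (case (Fst (v 5)) (v 6) (case (v 8) (const tt) leaf))) r (bool b) r d 0 →
    dotᶠ ⟨ row ∷ snd t ∷ bool b ∷ [] ⟩⇓ bool (dotT row (snd t) b) ∣ D →
    Runs ((a ∙ row) ∷ t ∷ bool acc ∷ []) (body μ dotᶠ) r (bool (dotT row (snd t) b)) r _ D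
  dot-step⇓ x y = case-∙⇓ var⇓ (call⇓ (var⇓ ∷⇓ Snd⇓ var⇓ ∷⇓ x ∷⇓ []⇓) y)

  dot-spine⇓ : ∀ row t a → dotᶠ ⟨ row ∷ t ∷ bool a ∷ [] ⟩⇓ bool (dotT row t a) ∣ suc (len row) ×P 40
  dot-spine⇓ leaf t a = last⇓ (case-leaf⇓ var⇓ var⇓)
  dot-spine⇓ (leaf ∙ row) t a =
    tail⇓ (dot-step⇓ {b = a} (case-leaf⇓ var⇓ var⇓) (dot-spine⇓ row (snd t) a))
  dot-spine⇓ ((_ ∙ _) ∙ row) leaf a =
    tail⇓ (dot-step⇓ {b = a} (case-∙⇓ var⇓ (case-leaf⇓ (Fst⇓ var⇓) var⇓)) (dot-spine⇓ row leaf a))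
  dot-spine⇓ ((_ ∙ _) ∙ row) (leaf ∙ t) a =
    tail⇓ (dot-step⇓ {b = a} (case-∙⇓ var⇓ (case-leaf⇓ (Fst⇓ var⇓) var⇓)) (dot-spine⇓ row t a))
  dot-spine⇓ ((_ ∙ _) ∙ row) ((_ ∙ _) ∙ t) false =
    tail⇓ (dot-step⇓ {b = true} (case-∙⇓ var⇓ (case-∙⇓ (Fst⇓ var⇓) (case-leaf⇓ var⇓ (const⇓ tt))))
                     (dot-spine⇓ row t true))
  dot-spine⇓ ((_ ∙ _) ∙ row) ((_ ∙ _) ∙ t) true =
    tail⇓ (dot-step⇓ {b = false} (case-∙⇓ var⇓ (case-∙⇓ (Fst⇓ var⇓) (case-∙⇓ var⇓ leaf⇓)))
                     (dot-spine⇓ row t false))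

  dot⇓ : ∀ {row t} → row ≼ → dotᶠ ⟨ row ∷ t ∷ leaf ∷ [] ⟩⇓ bool (dotT row t false) # 42
  dot⇓ row≼ = flat⇓ (len≼ row≼) (dot-spine⇓ _ _ false)

  rows-spine⇓ : ∀ rows t → rows ≼ → rowsᶠ ⟨ rows ∷ t ∷ [] ⟩⇓ bool (rowsT rows t) ∣ suc (len rows) ×P 60
  rows-spine⇓ leaf t rows≼ = last⇓ (case-leaf⇓ var⇓ (const⇓ tt))
  rows-spine⇓ (row ∙ rows) t rows≼ =
    tail⇓ (case-∙⇓ var⇓ (if⇓ (call⇓ (var⇓ ∷⇓ var⇓ ∷⇓ leaf⇓ ∷⇓ []⇓) (dot⇓ (≼-fst rows≼)))
      (λ e → if-false⇓ (λ b → not b ∧ _) e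
         (call⇓ (var⇓ ∷⇓ var⇓ ∷⇓ []⇓) (rows-spine⇓ rows t (≼-snd rows≼))))
      (λ e → if-true⇓ (λ b → not b ∧ _) e (upD⇓ z≤n leaf⇓))))

  rows⇓ : ∀ {rows t} → rows ≼ → rowsᶠ ⟨ rows ∷ t ∷ [] ⟩⇓ bool (rowsT rows t) # 62
  rows⇓ rows≼ = flat⇓ (len≼ rows≼) (rows-spine⇓ _ _ rows≼)

  pad-spine⇓ : ∀ l w s → padᶠ ⟨ l ∷ w ∷ s ∷ [] ⟩⇓ padT l w s ∣ suc (len l) ×P 40
  pad-spine⇓ leaf w s = last⇓ (case-leaf⇓ var⇓ var⇓)
  pad-spine⇓ (_ ∙ l) w s =
    tail⇓ (case-∙⇓ var⇓ (Truth⇓ (Fst⇓ var⇓) ∙⇓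
      call⇓ (var⇓ ∷⇓ Snd⇓ var⇓ ∷⇓ var⇓ ∷⇓ []⇓) (pad-spine⇓ l (snd w) s)))

  pad⇓ : ∀ {l w s} → l ≼ → padᶠ ⟨ l ∷ w ∷ s ∷ [] ⟩⇓ padT l w s # 42
  pad⇓ l≼ = flat⇓ (len≼ l≼) (pad-spine⇓ _ _ _)

-- A query is l ∙ s ∙ stuff: does some v of length l make the check
-- described by stuff succeed on v followed by s?  The two kinds of check
-- are leaf ∙ rows ∙ (F ∙ S) ∙ (K ∙ m), where v s is a tuple of K outputs of
-- which one is correct for each input of S and which satisfies the linear
-- equations rows, and tt ∙ F ∙ (n ∙ H), where v s is an input with a correct
-- output, while no output of H is correct for it.

isTupleT : Tree → Tree → Bool
isTupleT u t =
  rowsT (fst u) (tt ∙ t) ∧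
  coversAllT (fst (fst (snd u))) (snd (fst (snd u)))
             (chopT (fst (snd (snd u))) (snd (snd (snd u))) t leaf)

isUncoveredT : Tree → Tree → Bool
isUncoveredT u t =
  evalT (fst u) t (dropT (fst (snd u)) t) ∧ not (coversT (fst u) t (snd (snd u)))

checkT : Tree → Tree → Bool
checkT stuff t = if nonleaf (fst stuff) then isUncoveredT (snd stuff) t else isTupleT (snd stuff) t

verdict : Tree → Tree → Bool
verdict q w = checkT (snd (snd q)) (padT (fst q) w (fst (snd q)))

verifier : Program det 2
verifier = record
  { arity = arity
  ; body  = body det
  ; main  =
      bind (call padᶠ (Fst (v 0) ∷ v 1 ∷ Fst (Snd (v 0)) ∷ []))
      (bind (Snd (Snd (v 1)))
      (bind (Snd (v 0))
        (case (Truth (Fst (v 1)))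
          (case (call rowsᶠ (Fst (v 0) ∷ (const tt ∙ v 2) ∷ [])) leaf
            (call coversAllᶠ (Fst (Fst (Snd (v 2))) ∷ Snd (Fst (Snd (v 2))) ∷
               call chopᶠ (Fst (Snd (Snd (v 2))) ∷ Snd (Snd (Snd (v 2))) ∷ v 4 ∷ leaf ∷ []) ∷ [])))
          (case (call evalᶠ (Fst (v 2) ∷ v 4 ∷ call dropᶠ (Fst (Snd (v 2)) ∷ v 4 ∷ []) ∷ [])) leaf
            (case (call coversᶠ (Fst (v 4) ∷ v 6 ∷ Snd (Snd (v 4)) ∷ [])) (const tt) leaf)))))
  }

-- The oracle language and its membership in NP

anyᵇ : ∀ n → (Vec Bool n → Bool) → Bool
anyᵇ zero    f = f []
anyᵇ (suc n) f = anyᵇ n (f ∘ (false ∷_)) ∨ anyᵇ n (f ∘ (true ∷_))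

anyᵇ-cong : ∀ n {f g : Vec Bool n → Bool} → (∀ u → f u ≡ g u) → anyᵇ n f ≡ anyᵇ n g
anyᵇ-cong zero    e = e []
anyᵇ-cong (suc n) e = cong₂ _∨_ (anyᵇ-cong n (e ∘ (false ∷_))) (anyᵇ-cong n (e ∘ (true ∷_)))

∨-true : ∀ {a b} → a ∨ b ≡ true → a ≡ true ⊎ b ≡ true
∨-true {false} e = inj₂ e
∨-true {true}  e = inj₁ refl

∧-true : ∀ {a b} → a ∧ b ≡ true → a ≡ true × b ≡ true
∧-true {true} {true} e = refl , refl

anyᵇ-sound : ∀ n (f : Vec Bool n → Bool) → anyᵇ n f ≡ true → ∃[ u ] f u ≡ true
anyᵇ-sound zero f e = [] , e
anyᵇ-sound (suc n) f e with ∨-true {anyᵇ n (f ∘ (false ∷_))} e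
... | inj₁ p = let u , q = anyᵇ-sound n _ p in false ∷ u , q
... | inj₂ p = let u , q = anyᵇ-sound n _ p in true ∷ u , q

anyᵇ-complete : ∀ {n} (f : Vec Bool n → Bool) u → f u ≡ true → anyᵇ n f ≡ true
anyᵇ-complete f [] e = e
anyᵇ-complete f (false ∷ u) e rewrite anyᵇ-complete (f ∘ (false ∷_)) u e = refl
anyᵇ-complete f (true ∷ u)  e rewrite anyᵇ-complete (f ∘ (true ∷_)) u e = ∨-zeroʳ _

anyᵇ-false : ∀ {n} (f : Vec Bool n → Bool) → anyᵇ n f ≡ false → ∀ u → f u ≡ false
anyᵇ-false f e u with f u in eq
... | false = refl
... | true  = trans (sym (anyᵇ-complete f u eq)) e

infixr 5 _▹_
_▹_ : ∀ {n} → Vec Bool n → Tree → Tree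
[]      ▹ t = t
(b ∷ u) ▹ t = bool b ∙ (u ▹ t)

dec : ∀ n → Tree → Vec Bool n
dec zero    t = []
dec (suc n) t = hd t ∷ dec n (snd t)

dec-▹ : ∀ {n} (u : Vec Bool n) t → dec n (u ▹ t) ≡ u
dec-▹ []      t = refl
dec-▹ (b ∷ u) t = cong₂ _∷_ (nonleaf-bool b) (dec-▹ u t)

pad≡ : ∀ l w s → padT l w s ≡ dec (len l) w ▹ s
pad≡ leaf    w s = refl
pad≡ (_ ∙ l) w s = cong (bool (hd w) ∙_) (pad≡ l (snd w) s)

size-▹ : ∀ {n} (u : Vec Bool n) t → size (u ▹ t) ≤ n * 4 + size t
size-▹ []      t = ≤-refl
size-▹ (b ∷ u) t = s≤s (≤-trans (+-mono-≤ (size-bool b) (size-▹ u t)) (≤-reflexive (sym (+-assoc 3 _ (size t)))))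

-- A certificate may be any tree, but it is read as a bit vector whose length the query fixes, so
-- exhaustive search over such vectors decides the language.
oracle : Tree → Bool
oracle q = anyᵇ (len (fst q)) (λ u → verdict q (u ▹ leaf))

verdict-▹ : ∀ q (u : Vec Bool (len (fst q))) t →
            verdict q (u ▹ t) ≡ checkT (snd (snd q)) (u ▹ fst (snd q))
verdict-▹ q u t =
  cong (checkT (snd (snd q))) (trans (pad≡ (fst q) (u ▹ t) (fst (snd q))) (cong (_▹ fst (snd q)) (dec-▹ u t)))

verdict-normal : ∀ q w → verdict q w ≡ verdict q (dec (len (fst q)) w ▹ leaf)
verdict-normal q w =
  trans (cong (checkT (snd (snd q))) (pad≡ (fst q) w (fst (snd q))))
        (sym (verdict-▹ q (dec (len (fst q)) w) leaf))

len-chop : ∀ K m t acc → len (chopT K m t acc) ≡ len K + len acc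
len-chop leaf    m t acc = refl
len-chop (_ ∙ K) m t acc = cong suc (len-chop K m (dropT m t) acc)

module VerifierRun (q w : Tree) where

  open VerifierTime (λ _ → false) det (2 + size q) (s≤s (s≤s z≤n))

  q≼ : q ≼
  q≼ = small (≤-trans (m≤n+m (size q) 2) M≤P1)

  fst≼ : ∀ {t} → t ≼ → fst t ≼
  fst≼ {t} (small p) = small (≤-trans (size-fst t) p)

  snd≼ : ∀ {t} → t ≼ → snd t ≼
  snd≼ {t} (small p) = small (≤-trans (size-snd t) p)

  chop-short : ∀ K m t → K ≼ → Short (chopT K m t leaf)
  chop-short K m t K≼ =
    short (subst (λ l → suc l ≤ P 1) (sym (trans (len-chop K m t leaf) (+-identityʳ (len K)))) (len≼ K≼))

  verifier⇓ : ∀ {r} → Runs (q ∷ w ∷ []) (Program.main verifier) r (bool (verdict q w)) r 300 0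
  verifier⇓ = up⇓
    (bind⇓ (call⇓ (Fst⇓ var⇓ ∷⇓ var⇓ ∷⇓ Fst⇓ (Snd⇓ var⇓) ∷⇓ []⇓) (pad⇓ (fst≼ q≼)))
    (bind⇓ (Snd⇓ (Snd⇓ var⇓))
    (bind⇓ (Snd⇓ var⇓)
      (if⇓ (Truth⇓ (Fst⇓ var⇓))
        (λ e → value⇓ (cong (λ b → bool (if b then isUncoveredT u t else isTupleT u t)) (sym e))
          (if⇓ (call⇓ (Fst⇓ var⇓ ∷⇓ (const⇓ tt ∙⇓ var⇓) ∷⇓ []⇓) (rows⇓ (fst≼ u≼)))
            (λ e → if-false⇓ (_∧ cov) e leaf⇓)
            (λ e → if-true⇓ (_∧ cov) e
              (call⇓ (Fst⇓ (Fst⇓ (Snd⇓ var⇓)) ∷⇓ Snd⇓ (Fst⇓ (Snd⇓ var⇓)) ∷⇓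
                      call⇓ (Fst⇓ (Snd⇓ (Snd⇓ var⇓)) ∷⇓ Snd⇓ (Snd⇓ (Snd⇓ var⇓)) ∷⇓ var⇓ ∷⇓ leaf⇓ ∷⇓ []⇓)
                        (chop⇓ (fst≼ (snd≼ (snd≼ u≼))) (snd≼ (snd≼ (snd≼ u≼)))) ∷⇓ []⇓)
                (coversAll⇓ (fst≼ (fst≼ (snd≼ u≼))) (≼-short (snd≼ (fst≼ (snd≼ u≼))))
                  (chop-short _ _ _ (fst≼ (snd≼ (snd≼ u≼)))))))))
        (λ e → value⇓ (cong (λ b → bool (if b then isUncoveredT u t else isTupleT u t)) (sym e))
          (if⇓ (call⇓ (Fst⇓ var⇓ ∷⇓ var⇓ ∷⇓
                       call⇓ (Fst⇓ (Snd⇓ var⇓) ∷⇓ var⇓ ∷⇓ []⇓) (drop⇓ (fst≼ (snd≼ u≼))) ∷⇓ []⇓)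
                  (eval⇓ (fst≼ u≼)))
            (λ e → if-false⇓ (_∧ unc) e leaf⇓)
            (λ e → if-true⇓ (_∧ unc) e
              (if⇓ (call⇓ (Fst⇓ var⇓ ∷⇓ var⇓ ∷⇓ Snd⇓ (Snd⇓ var⇓) ∷⇓ []⇓)
                     (covers⇓ (fst≼ u≼) (≼-short (snd≼ (snd≼ u≼)))))
                (λ e → if-false⇓ not e (const⇓ tt))
                (λ e → if-true⇓ not e leaf⇓)))))))))
    where
    t = padT (fst q) w (fst (snd q))
    u = snd (snd (snd q))
    cov = coversAllT (fst (fst (snd u))) (snd (fst (snd u)))
                     (chopT (fst (snd (snd u))) (snd (snd (snd u))) t leaf)
    unc = not (coversT (fst u) t (snd (snd u)))
    u≼ = snd≼ (snd≼ (snd≼ q≼))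

NP-oracle : NP oracle
NP-oracle = record
  { verifier    = verifier
  ; verdict     = verdict
  -- Independent of the certificate, of which only the entries that the query asks for are read. The
  -- summand 2 makes the base at least 2, and the 3 pays for writing the verdict.
  ; time        = ((con 2 ⊕ var zero) ^ᵖ 300) ⊕ con 3
  -- A bit costs at most four nodes, and there are fewer bits than nodes in the query.
  ; certificate = (var zero ⊗ con 4) ⊕ con 1
  ; verifies    = verifies
  ; correct     = λ q → mk⇔ (accept q) (reject q)
  }
  where
  verifies : ∀ q w → RunsTo (λ _ → false) verifier [] (q ∷ w ∷ []) (bool (verdict q w))
             (eval (((con 2 ⊕ var zero) ^ᵖ 300) ⊕ con 3) (size q ∷ size w ∷ []))
  verifies q w = [] , time , eval⇓ ,
    +-mono-≤ (≤-trans bound (≤-reflexive (trans (+-identityʳ _)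
      (sym (eval-^ᵖ (con 2 ⊕ var zero) (size q ∷ size w ∷ []) refl 300)))))
      (size-bool (verdict q w))
    where
    open VerifierRun q w
    open VerifierTime (λ _ → false) det (2 + size q) (s≤s (s≤s z≤n)) using (eval-^ᵖ; module Runs)
    open Runs (verifier⇓ {[]})

  accept : ∀ q → oracle q ≡ true → ∃[ w ] (size w ≤ size q * 4 + 1 × verdict q w ≡ true)
  accept q e with anyᵇ-sound (len (fst q)) _ e
  ... | u , p = u ▹ leaf ,
    ≤-trans (size-▹ u leaf) (+-monoˡ-≤ 1 (*-monoˡ-≤ 4
      (≤-trans (n≤1+n _) (≤-trans (len<size (fst q)) (size-fst q))))) , p

  reject : ∀ q → ∃[ w ] (size w ≤ size q * 4 + 1 × verdict q w ≡ true) → oracle q ≡ true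
  reject q (w , _ , e) =
    anyᵇ-complete (λ u → verdict q (u ▹ leaf)) (dec _ w) (trans (sym (verdict-normal q w)) e)

-- Counting as unnormalised expectation

Sum : Set → Set
Sum A = (A → ℕ) → ℕ

-- An expectation without its denominator: `S (λ _ → 1)` is the number of outcomes, so probabilities
-- become comparisons of natural numbers. The three laws pass on to vectors and pairs of independent
-- draws.
record IsSum {A : Set} (S : Sum A) : Set where
  field
    mono  : ∀ {f g} → (∀ a → f a ≤ g a) → S f ≤ S g
    plus  : ∀ f g → S (λ a → f a + g a) ≡ S f + S g
    scale : ∀ c f → S (λ a → c * f a) ≡ c * S f

  ext : ∀ {f g} → (∀ a → f a ≡ g a) → S f ≡ S g
  ext e = ≤-antisym (mono (λ a → ≤-reflexive (e a))) (mono (λ a → ≤-reflexive (sym (e a))))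

  scaleʳ : ∀ c f → S (λ a → f a * c) ≡ S f * c
  scaleʳ c f = trans (ext (λ a → *-comm (f a) c)) (trans (scale c f) (*-comm c (S f)))

  constant : ∀ c → S (λ _ → c) ≡ S (λ _ → 1) * c
  constant c = trans (ext (λ _ → sym (*-identityˡ c))) (scaleʳ c (λ _ → 1))

open IsSum public

∑ᵇ : Sum Bool
∑ᵇ f = f false + f true

∑ᵛ : ∀ {A} → Sum A → ∀ n → Sum (Vec A n)
∑ᵛ S zero    f = f []
∑ᵛ S (suc n) f = S (λ a → ∑ᵛ S n (λ u → f (a ∷ u)))

∑ⁿ : ∀ n → Sum (Vec Bool n)
∑ⁿ = ∑ᵛ ∑ᵇ

∑ᵇ-isSum : IsSum ∑ᵇ
∑ᵇ-isSum = record
  { mono  = λ f≤g → +-mono-≤ (f≤g false) (f≤g true)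
  ; plus  = λ f g → interchange (f false) (g false) (f true) (g true)
  ; scale = λ c f → sym (*-distribˡ-+ c (f false) (f true))
  }
  where
  interchange : ∀ a b c d → (a + b) + (c + d) ≡ (a + c) + (b + d)
  interchange = solve-∀

∑ᵛ-isSum : ∀ {A} {S : Sum A} → IsSum S → ∀ n → IsSum (∑ᵛ S n)
∑ᵛ-isSum I zero = record { mono = λ f≤g → f≤g [] ; plus = λ _ _ → refl ; scale = λ _ _ → refl }
∑ᵛ-isSum I (suc n) = record
  { mono  = λ f≤g → mono I (λ a → mono (∑ᵛ-isSum I n) (λ u → f≤g (a ∷ u)))
  ; plus  = λ f g → trans (ext I (λ a → plus (∑ᵛ-isSum I n) _ _)) (plus I _ _)
  ; scale = λ c f → trans (ext I (λ a → scale (∑ᵛ-isSum I n) c _)) (scale I c _)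
  }

∑ⁿ-isSum : ∀ n → IsSum (∑ⁿ n)
∑ⁿ-isSum = ∑ᵛ-isSum ∑ᵇ-isSum

-- One of the two sums runs over bit vectors, so additivity of `S` is enough: each bit splits that
-- sum in two.
swap : ∀ {A} {S : Sum A} → IsSum S → ∀ n (f : A → Vec Bool n → ℕ) →
       S (λ a → ∑ⁿ n (f a)) ≡ ∑ⁿ n (λ u → S (λ a → f a u))
swap I zero    f = refl
swap I (suc n) f =
  trans (plus I _ _) (cong₂ _+_ (swap I n (λ a u → f a (false ∷ u))) (swap I n (λ a u → f a (true ∷ u))))

mass : ∀ {A} {S : Sum A} → IsSum S → ∀ n → ∑ᵛ S n (λ _ → 1) ≡ S (λ _ → 1) ^ n
mass I zero    = refl
mass {S = S} I (suc n) = trans (constant I _) (cong (S (λ _ → 1) *_) (mass I n))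

ind : Bool → ℕ
ind false = 0
ind true  = 1

ind-∧ : ∀ a b → ind (a ∧ b) ≡ ind a * ind b
ind-∧ false b = refl
ind-∧ true  b = sym (+-identityʳ (ind b))

ind-∨ : ∀ a b → ind (a ∨ b) ≤ ind a + ind b
ind-∨ false b = ≤-refl
ind-∨ true  b = s≤s z≤n

ind-not : ∀ a → ind a + ind (not a) ≡ 1
ind-not false = refl
ind-not true  = refl

ind≤1 : ∀ a → ind a ≤ 1
ind≤1 false = z≤n
ind≤1 true  = ≤-refl

count : ∀ {n} → (Vec Bool n → Bool) → ℕ
count {n} f = ∑ⁿ n (ind ∘ f)

count-mono : ∀ {n} {f g : Vec Bool n → Bool} → (∀ u → f u ≡ true → g u ≡ true) → count f ≤ count g
count-mono {n} {f} {g} f⇒g = mono (∑ⁿ-isSum n) pointwise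
  where
  pointwise : ∀ u → ind (f u) ≤ ind (g u)
  pointwise u with f u in e
  ... | false = z≤n
  ... | true rewrite f⇒g u e = ≤-refl

count-< : ∀ {n} {f g : Vec Bool n → Bool} → (∀ u → f u ≡ true → g u ≡ true) →
          ∀ u → f u ≡ false → g u ≡ true → count f < count g
count-< f⇒g [] p q rewrite p | q = ≤-refl
count-< f⇒g (false ∷ u) p q =
  +-mono-<-≤ (count-< (f⇒g ∘ (false ∷_)) u p q) (count-mono (f⇒g ∘ (true ∷_)))
count-< f⇒g (true ∷ u) p q =
  +-mono-≤-< (count-mono (f⇒g ∘ (false ∷_))) (count-< (f⇒g ∘ (true ∷_)) u p q)

count-∃ : ∀ {n} (f : Vec Bool n → Bool) → 1 ≤ count f → ∃[ u ] f u ≡ true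
count-∃ {zero} f p with f [] in e
... | true = [] , e
count-∃ {suc n} f p with count (f ∘ (false ∷_)) in e
... | zero  = let u , q = count-∃ (f ∘ (true ∷_)) p in true ∷ u , q
... | suc _ = let u , q = count-∃ (f ∘ (false ∷_)) (subst (1 ≤_) (sym e) (s≤s z≤n)) in false ∷ u , q

2^-mass : ∀ n → ∑ⁿ n (λ _ → 1) ≡ 2 ^ n
2^-mass = mass ∑ᵇ-isSum

count≤ : ∀ {n} (f : Vec Bool n → Bool) → count f ≤ 2 ^ n
count≤ {n} f = ≤-trans (mono (∑ⁿ-isSum n) (ind≤1 ∘ f)) (≤-reflexive (2^-mass n))

∃⇒count : ∀ {n} (f : Vec Bool n → Bool) u → f u ≡ true → 1 ≤ count f
∃⇒count f u e = ≤-trans (s≤s z≤n) (count-< {f = λ _ → false} (λ _ ()) u refl e)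

allᵛ : ∀ {A : Set} {n} → (A → Bool) → Vec A n → Bool
allᵛ p []      = true
allᵛ p (a ∷ u) = p a ∧ allᵛ p u

allᵛ-∧ : ∀ {A : Set} {n} (p q : A → Bool) (u : Vec A n) →
         allᵛ p u ∧ allᵛ q u ≡ allᵛ (λ a → p a ∧ q a) u
allᵛ-∧ p q [] = refl
allᵛ-∧ p q (a ∷ u) = trans (shuffle (p a) (allᵛ p u) (q a) (allᵛ q u)) (cong ((p a ∧ q a) ∧_) (allᵛ-∧ p q u))
  where
  shuffle : ∀ a b c d → (a ∧ b) ∧ (c ∧ d) ≡ (a ∧ c) ∧ (b ∧ d)
  shuffle false b     c d = refl
  shuffle true  true  c d = refl
  shuffle true  false c d = sym (∧-zeroʳ c)

-- Independence: the indicator of the conjunction is a product with one factor per draw.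
∑-all : ∀ {A} {S : Sum A} → IsSum S → ∀ n (p : A → Bool) →
        ∑ᵛ S n (ind ∘ allᵛ p) ≡ S (ind ∘ p) ^ n
∑-all I zero    p = refl
∑-all {S = S} I (suc n) p =
  trans (ext I (λ a → trans (ext (∑ᵛ-isSum I n) (λ u → ind-∧ (p a) (allᵛ p u)))
                            (scale (∑ᵛ-isSum I n) (ind (p a)) _)))
        (trans (scaleʳ I _ (ind ∘ p)) (cong (S (ind ∘ p) *_) (∑-all I n p)))

-- Random affine equations

dot : ∀ {n} → Vec Bool n → Vec Bool n → Bool → Bool
dot []      []      a = a
dot (b ∷ u) (x ∷ w) a = dot u w ((b ∧ x) xor a)

dot-not : ∀ {n} (u w : Vec Bool n) a → dot u w (not a) ≡ not (dot u w a)
dot-not [] [] a = refl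
dot-not (b ∷ u) (x ∷ w) a = trans (cong (dot u w) (xor-not (b ∧ x) a)) (dot-not u w _)
  where
  xor-not : ∀ b a → b xor not a ≡ not (b xor a)
  xor-not false a = refl
  xor-not true  a = refl

eq : ∀ {n} → Vec Bool n → Vec Bool n → Bool
eq []      []      = true
eq (a ∷ u) (b ∷ w) = not (a xor b) ∧ eq u w

eq-sound : ∀ {n} (u w : Vec Bool n) → eq u w ≡ true → u ≡ w
eq-sound []          []          e = refl
eq-sound (false ∷ u) (false ∷ w) e = cong (false ∷_) (eq-sound u w e)
eq-sound (true  ∷ u) (true  ∷ w) e = cong (true ∷_) (eq-sound u w e)

∑-zero : ∀ n → ∑ⁿ n (λ _ → 0) ≡ 0
∑-zero n = trans (constant (∑ⁿ-isSum n) 0) (*-zeroʳ (∑ⁿ n (λ _ → 1)))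

count-eq : ∀ {n} (u : Vec Bool n) → count (eq u) ≡ 1
count-eq [] = refl
count-eq {suc n} (false ∷ u) = trans (cong (count (eq u) +_) (∑-zero n)) (trans (+-identityʳ _) (count-eq u))
count-eq {suc n} (true ∷ u)  = trans (cong (_+ count (eq u)) (∑-zero n)) (count-eq u)

agree : ∀ {n} → Vec Bool n → Vec Bool n → Bool → Bool → ℕ
agree u w a b = count (λ row → not (dot row u a xor dot row w b))

-- At the first coordinate where `u` and `w` differ, the bit of the row flips exactly one of the two
-- parities, so of two rows that differ only there exactly one makes the parities agree. The start
-- values `a` and `b` are arbitrary because earlier coordinates have already changed them.
agree-half : ∀ {n} (u w : Vec Bool n) a b → eq u w ≡ false → 2 * agree u w a b ≡ 2 ^ n
agree-half [] [] a b ()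
agree-half {suc n} (x ∷ u) (y ∷ w) a b e with x | y
... | false | false = trans (*-distribˡ-+ 2 (agree u w a b) (agree u w a b))
                        (trans (cong₂ _+_ (agree-half u w a b e) (agree-half u w a b e))
                               (cong (2 ^ n +_) (sym (+-identityʳ _))))
... | true  | true  = trans (*-distribˡ-+ 2 (agree u w a b) (agree u w (not a) (not b)))
                        (trans (cong₂ _+_ (agree-half u w a b e) (agree-half u w (not a) (not b) e))
                               (cong (2 ^ n +_) (sym (+-identityʳ _))))
... | false | true  = cong (2 *_) (trans (sym (plus (∑ⁿ-isSum n) _ _)) (trans (ext (∑ⁿ-isSum n) one) (2^-mass n)))
  where
  one : ∀ row → ind (not (dot row u a xor dot row w b)) + ind (not (dot row u a xor dot row w (not b))) ≡ 1
  one row rewrite dot-not row w b with dot row u a | dot row w b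
  ... | false | false = refl
  ... | false | true  = refl
  ... | true  | false = refl
  ... | true  | true  = refl
... | true  | false = cong (2 *_) (trans (sym (plus (∑ⁿ-isSum n) _ _)) (trans (ext (∑ⁿ-isSum n) one) (2^-mass n)))
  where
  one : ∀ row → ind (not (dot row u a xor dot row w b)) + ind (not (dot row u (not a) xor dot row w b)) ≡ 1
  one row rewrite dot-not row u a with dot row u a | dot row w b
  ... | false | false = refl
  ... | false | true  = refl
  ... | true  | false = refl
  ... | true  | true  = refl

-- A row is a random affine equation; the leading bit is the constant term.

sat : ∀ {N} → Vec Bool N → Vec Bool (suc N) → Bool
sat u row = not (dot row (true ∷ u) false)

-- Flipping the constant term flips the parity, so half of the `2 ^ suc N` rows remain.
∑-sat : ∀ {N} (u : Vec Bool N) → count (sat u) ≡ 2 ^ N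
∑-sat {N} u = trans (sym (plus (∑ⁿ-isSum N) _ _)) (trans (ext (∑ⁿ-isSum N) one) (2^-mass N))
  where
  one : ∀ row → ind (not (dot row u false)) + ind (not (dot row u true)) ≡ 1
  one row rewrite dot-not row u false with dot row u false
  ... | false = refl
  ... | true  = refl

-- Pairwise independence: a quarter of all rows. If the linear part has the same value on `u` and
-- `w`, exactly one constant term satisfies both, otherwise none does; `agree-half` counts the first
-- case.
∑-sat₂ : ∀ {N} (u w : Vec Bool N) → eq u w ≡ false → 2 * count (λ row → sat u row ∧ sat w row) ≡ 2 ^ N
∑-sat₂ {N} u w e =
  trans (cong (2 *_) (trans (sym (plus (∑ⁿ-isSum N) _ _)) (ext (∑ⁿ-isSum N) one))) (agree-half u w false false e)
  where
  one : ∀ row → ind (not (dot row u false) ∧ not (dot row w false)) + ind (not (dot row u true) ∧ not (dot row w true))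
              ≡ ind (not (dot row u false xor dot row w false))
  one row rewrite dot-not row u false | dot-not row w false with dot row u false | dot row w false
  ... | false | false = refl
  ... | false | true  = refl
  ... | true  | false = refl
  ... | true  | true  = refl

-- Isolation

anySuffix : ∀ {A : Set} → (∀ {i} → Vec A i → Bool) → ∀ {j} → Vec A j → Bool
anySuffix f []      = f []
anySuffix f (a ∷ u) = f (a ∷ u) ∨ anySuffix f u

anyᵛ : ∀ {A : Set} {n} → (A → Bool) → Vec A n → Bool
anyᵛ f []      = false
anyᵛ f (a ∷ u) = f a ∨ anyᵛ f u

-- A suffix of a uniform vector is uniform; the `i` leading draws contribute the factor. Thus one
-- block offers random systems of every length, which is needed because the right length depends on
-- the unknown size of `W`.
∑-suffix : ∀ {A} {S : Sum A} → IsSum S → (f : ∀ {i} → Vec A i → Bool) → ∀ i j →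
           S (λ _ → 1) ^ i * ∑ᵛ S j (ind ∘ f) ≤ ∑ᵛ S (i + j) (ind ∘ anySuffix f)
∑-suffix I f zero zero    = ≤-reflexive (+-identityʳ _)
∑-suffix I f zero (suc j) = ≤-trans (≤-reflexive (+-identityʳ _))
  (mono I (λ a → mono (∑ᵛ-isSum I j) (λ u → ind-∨ˡ (f (a ∷ u)) _)))
  where
  ind-∨ˡ : ∀ a b → ind a ≤ ind (a ∨ b)
  ind-∨ˡ false b = z≤n
  ind-∨ˡ true  b = ≤-refl
∑-suffix {S = S} I f (suc i) j =
  ≤-trans (≤-reflexive (*-assoc (S (λ _ → 1)) _ _))
  (≤-trans (*-monoʳ-≤ (S (λ _ → 1)) (∑-suffix I f i j))
  (≤-trans (≤-reflexive (sym (constant I _)))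
    (mono I (λ a → mono (∑ᵛ-isSum I (i + j)) (λ u → ind-∨ʳ (f (a ∷ u)) _)))))
  where
  ind-∨ʳ : ∀ a b → ind b ≤ ind (a ∨ b)
  ind-∨ʳ false b = ≤-refl
  ind-∨ʳ true  b = ind≤1 b

^-distribʳ-* : ∀ j a b → (a * b) ^ j ≡ a ^ j * b ^ j
^-distribʳ-* zero    a b = refl
^-distribʳ-* (suc j) a b = trans (cong (a * b *_) (^-distribʳ-* j a b)) (lemma a b (a ^ j) (b ^ j))
  where
  lemma : ∀ a b c d → a * b * (c * d) ≡ a * c * (b * d)
  lemma = solve-∀

2^≡ : ∀ n → 2 ^ suc n ≡ 2 ^ n + 2 ^ n
2^≡ n = cong (2 ^ n +_) (+-identityʳ (2 ^ n))

power-between : ∀ N w → 1 ≤ w → w ≤ 2 ^ N → ∃[ j ] (j ≤ N × w ≤ 2 ^ j × 2 ^ j ≤ 2 * w)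
power-between zero w 1≤w w≤1 = 0 , z≤n , w≤1 , ≤-trans 1≤w (m≤m+n w _)
power-between (suc N) w 1≤w w≤ with ≤-total w (2 ^ N)
... | inj₁ p = let j , a , b , c = power-between N w 1≤w p in j , m≤n⇒m≤1+n a , b , c
... | inj₂ p = suc N , ≤-refl , w≤ , *-monoʳ-≤ 2 p

module Isolation {N : ℕ} (W B : Vec Bool N → Bool) (B⇒W : ∀ u → B u ≡ true → W u ≡ true)
  (pick : ∀ {j} → Vec (Vec Bool (suc N)) j → Vec Bool N)
  (pick-ok : ∀ {j} (rows : Vec (Vec Bool (suc N)) j) u → W u ∧ allᵛ (sat u) rows ≡ true →
             W (pick rows) ∧ allᵛ (sat (pick rows)) rows ≡ true) where

  Row : Set
  Row = Vec Bool (suc N)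

  hit : ∀ {j} → Vec Row j → Bool
  hit rows = B (pick rows)

  b c : ∀ {j} → Vec Row j → ℕ
  b rows = count (λ u → B u ∧ allᵛ (sat u) rows)
  c rows = count (λ u → W u ∧ allᵛ (sat u) rows)

  b-implies-c : ∀ {j} (rows : Vec Row j) u → B u ∧ allᵛ (sat u) rows ≡ true → W u ∧ allᵛ (sat u) rows ≡ true
  b-implies-c rows u e = let p , q = ∧-true e in cong₂ _∧_ (B⇒W u p) q

  -- A hit is certain when c = 1 = b; all other cases are paid for by b * c.
  hit-bound : ∀ {j} (rows : Vec Row j) → 2 * b rows ≤ ind (hit rows) + b rows * c rows
  hit-bound rows with hit rows in e
  ... | true = arith (b rows) (c rows) (count-mono (b-implies-c rows))
    where
    arith : ∀ b c → b ≤ c → 2 * b ≤ 1 + b * c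
    arith zero          c p = z≤n
    arith (suc zero)    c p = s≤s (≤-trans p (≤-reflexive (sym (+-identityʳ c))))
    arith (suc (suc b)) c p = m≤n⇒m≤1+n (≤-trans (≤-reflexive (*-comm 2 (2 + b)))
                                (*-monoʳ-≤ (2 + b) (≤-trans (s≤s (s≤s z≤n)) p)))
  ... | false = arith (b rows) (c rows) (count-mono (b-implies-c rows)) strict
    where
    strict : 1 ≤ c rows → b rows < c rows
    strict p = let u , q = count-∃ _ p in
      count-< (b-implies-c rows) (pick rows) (cong (_∧ allᵛ (sat (pick rows)) rows) e) (pick-ok rows u q)

    arith : ∀ b c → b ≤ c → (1 ≤ c → b < c) → 2 * b ≤ b * c
    arith zero    c p q = z≤n
    arith (suc b) c p q = ≤-trans (≤-reflexive (*-comm 2 (suc b)))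
      (*-monoʳ-≤ (suc b) (≤-trans (s≤s (s≤s z≤n)) (q (≤-trans (s≤s z≤n) p))))

  rowSum : IsSum (∑ⁿ (suc N))
  rowSum = ∑ⁿ-isSum (suc N)

  module _ (j : ℕ) where

    E : Sum (Vec Row j)
    E = ∑ᵛ (∑ⁿ (suc N)) j

    E-isSum : IsSum E
    E-isSum = ∑ᵛ-isSum rowSum j

    H J : ℕ
    H = (2 ^ N) ^ j
    J = 2 ^ j

    E-b : E b ≡ count B * H
    E-b = trans (swap E-isSum N _)
      (trans (ext (∑ⁿ-isSum N) (λ u →
          trans (ext E-isSum (λ rows → ind-∧ (B u) _))
          (trans (scale E-isSum (ind (B u)) _)
            (cong (ind (B u) *_) (trans (∑-all rowSum j (sat u)) (cong (_^ j) (∑-sat u)))))))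
        (scaleʳ (∑ⁿ-isSum N) H (ind ∘ B)))

    -- There are `J * H` systems, and a fixed vector satisfies one with probability `1 / J`. Off the
    -- diagonal the two events are independent, on it they coincide.
    E-sat₂ : ∀ u w → J * E (λ rows → ind (allᵛ (sat u) rows ∧ allᵛ (sat w) rows)) ≤ H + ind (eq u w) * (J * H)
    E-sat₂ u w with eq u w in e
    ... | false = ≤-reflexive (trans (cong (J *_)
        (trans (ext E-isSum (λ rows → cong ind (allᵛ-∧ (sat u) (sat w) rows))) (∑-all rowSum j _)))
        (trans (sym (^-distribʳ-* j 2 _))
        (trans (cong (_^ j) (∑-sat₂ u w e)) (sym (+-identityʳ H)))))
    ... | true = ≤-trans (*-monoʳ-≤ J
        (≤-trans (mono E-isSum (λ rows → ≤-trans (≤-reflexive (ind-∧ (allᵛ (sat u) rows) _))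
                   (≤-trans (*-monoʳ-≤ (ind (allᵛ (sat u) rows)) (ind≤1 _)) (≤-reflexive (*-identityʳ _)))))
                 (≤-reflexive (trans (∑-all rowSum j (sat u)) (cong (_^ j) (∑-sat u))))))
        (≤-trans (≤-reflexive (sym (+-identityʳ (J * H)))) (m≤n+m _ H))

    E-bc : J * E (λ rows → b rows * c rows) ≤ count B * (count W * H + J * H)
    E-bc = ≤-trans (≤-reflexive (trans (cong (J *_) expand) collect)) bounded
      where
      I = ∑ⁿ-isSum N

      pair : Vec Bool N → Vec Bool N → ℕ
      pair u w = E (λ rows → ind (allᵛ (sat u) rows ∧ allᵛ (sat w) rows))

      term : ∀ u w (rows : Vec Row j) →
        ind (B u ∧ allᵛ (sat u) rows) * ind (W w ∧ allᵛ (sat w) rows) ≡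
        ind (B u) * (ind (W w) * ind (allᵛ (sat u) rows ∧ allᵛ (sat w) rows))
      term u w rows rewrite ind-∧ (B u) (allᵛ (sat u) rows) | ind-∧ (W w) (allᵛ (sat w) rows)
                          | ind-∧ (allᵛ (sat u) rows) (allᵛ (sat w) rows) = lemma (ind (B u)) _ (ind (W w)) _
        where
        lemma : ∀ a b c d → a * b * (c * d) ≡ a * (c * (b * d))
        lemma = solve-∀

      expand : E (λ rows → b rows * c rows) ≡ ∑ⁿ N (λ u → ind (B u) * ∑ⁿ N (λ w → ind (W w) * pair u w))
      expand = trans (ext E-isSum (λ rows → trans (sym (scaleʳ I (c rows) _))
                       (ext I (λ u → trans (sym (scale I (ind (B u ∧ allᵛ (sat u) rows)) _)) (ext I (λ w → term u w rows))))))
        (trans (swap E-isSum N _)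
          (ext I (λ u → trans (swap E-isSum N _)
            (trans (ext I (λ w → trans (scale E-isSum (ind (B u)) _) (cong (ind (B u) *_) (scale E-isSum (ind (W w)) _))))
                   (scale I (ind (B u)) _)))))

      collect : J * ∑ⁿ N (λ u → ind (B u) * ∑ⁿ N (λ w → ind (W w) * pair u w)) ≡
                ∑ⁿ N (λ u → ind (B u) * ∑ⁿ N (λ w → ind (W w) * (J * pair u w)))
      collect = trans (sym (scale I J _)) (ext I (λ u → trans (swap* J (ind (B u)) _)
                  (cong (ind (B u) *_) (trans (sym (scale I J _)) (ext I (λ w → swap* J (ind (W w)) (pair u w)))))))
        where
        swap* : ∀ a b c → a * (b * c) ≡ b * (a * c)
        swap* = solve-∀

      inner : ∀ u → ∑ⁿ N (λ w → ind (W w) * (J * pair u w)) ≤ count W * H + J * H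
      inner u = ≤-trans (mono I pointwise) (≤-reflexive (trans (plus I _ _)
          (cong₂ _+_ (scaleʳ I H (ind ∘ W))
            (trans (scaleʳ I (J * H) (ind ∘ eq u)) (trans (cong (_* (J * H)) (count-eq u)) (*-identityˡ (J * H)))))))
        where
        pointwise : ∀ w → ind (W w) * (J * pair u w) ≤ ind (W w) * H + ind (eq u w) * (J * H)
        pointwise w = ≤-trans (*-monoʳ-≤ (ind (W w)) (E-sat₂ u w))
          (≤-trans (≤-reflexive (*-distribˡ-+ (ind (W w)) H _))
            (+-monoʳ-≤ (ind (W w) * H) (≤-trans (*-monoˡ-≤ _ (ind≤1 (W w))) (≤-reflexive (*-identityˡ _)))))

      bounded : ∑ⁿ N (λ u → ind (B u) * ∑ⁿ N (λ w → ind (W w) * (J * pair u w))) ≤ count B * (count W * H + J * H)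
      bounded = ≤-trans (mono I (λ u → *-monoʳ-≤ (ind (B u)) (inner u))) (≤-reflexive (scaleʳ I _ (ind ∘ B)))

    -- With β and ω for the sizes of `B` and `W`, `hit-bound` gives a probability of at least 2β/J -
    -- (β/J)(ω/J + 1) = (β/J)(1 - ω/J). The first factor is at least 1/8 by ω ≤ 2β and J ≤ 4ω, the
    -- second at least 1/2 by 2ω ≤ J.
    isolate : count W ≤ 2 * count B → 2 * count W ≤ J → J ≤ 4 * count W → (2 ^ suc N) ^ j ≤ 16 * E (ind ∘ hit)
    isolate W≤2B 2W≤J J≤4W = arith J H (count B) (count W) (E (ind ∘ hit)) (E (λ rows → b rows * c rows))
      (m^n>0 2 j) W≤2B 2W≤J J≤4W
      (≤-trans (≤-reflexive (trans (cong (2 *_) (sym E-b)) (sym (scale E-isSum 2 b))))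
        (≤-trans (mono E-isSum hit-bound) (≤-reflexive (plus E-isSum (ind ∘ hit) _))))
      E-bc (^-distribʳ-* j 2 (2 ^ N))
      where
      arith : ∀ J H β ω h x → 1 ≤ J → ω ≤ 2 * β → 2 * ω ≤ J → J ≤ 4 * ω →
        2 * (β * H) ≤ h + x → J * x ≤ β * (ω * H + J * H) → ∀ {q} → q ≡ J * H → q ≤ 16 * h
      arith J H β ω h x 1≤J ω≤2β 2ω≤J J≤4ω p q refl = begin
        J * H                ≤⟨ *-monoˡ-≤ H (≤-trans J≤4ω (*-monoʳ-≤ 4 ω≤2β)) ⟩
        4 * (2 * β) * H      ≡⟨ l₁ β H ⟩
        8 * (β * H)          ≤⟨ *-monoʳ-≤ 8 (*-cancelˡ-≤ J ⦃ >-nonZero 1≤J ⦄ cancelled) ⟩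
        8 * (2 * h)          ≡⟨ l₂ h ⟩
        16 * h               ∎
        where
        open ≤-Reasoning
        l₁ : ∀ β H → 4 * (2 * β) * H ≡ 8 * (β * H)
        l₁ = solve-∀
        l₂ : ∀ h → 8 * (2 * h) ≡ 16 * h
        l₂ = solve-∀
        l₃ : ∀ J β H → J * (β * H) + 3 * (J * (β * H)) ≡ 2 * J * (2 * (β * H))
        l₃ = solve-∀
        l₄ : ∀ J h x → 2 * J * (h + x) ≡ J * (2 * h) + 2 * (J * x)
        l₄ = solve-∀
        l₅ : ∀ J β ω H → 2 * (β * (ω * H + J * H)) ≡ β * H * (2 * ω) + 2 * (J * (β * H))
        l₅ = solve-∀
        l₆ : ∀ J β H → β * H * J + 2 * (J * (β * H)) ≡ 3 * (J * (β * H))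
        l₆ = solve-∀
        -- Subtraction is avoided by adding `3 * (J * (β * H))` on both sides, which is an upper
        -- bound for `2 * (J * x)`.
        cancelled : J * (β * H) ≤ J * (2 * h)
        cancelled = +-cancelʳ-≤ (3 * (J * (β * H))) _ _ (begin
          J * (β * H) + 3 * (J * (β * H))          ≡⟨ l₃ J β H ⟩
          2 * J * (2 * (β * H))                    ≤⟨ *-monoʳ-≤ (2 * J) p ⟩
          2 * J * (h + x)                          ≡⟨ l₄ J h x ⟩
          J * (2 * h) + 2 * (J * x)                ≤⟨ +-monoʳ-≤ (J * (2 * h)) (*-monoʳ-≤ 2 q) ⟩
          J * (2 * h) + 2 * (β * (ω * H + J * H))  ≡⟨ cong (J * (2 * h) +_) (l₅ J β ω H) ⟩
          J * (2 * h) + (β * H * (2 * ω) + 2 * (J * (β * H)))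
            ≤⟨ +-monoʳ-≤ (J * (2 * h)) (+-monoˡ-≤ (2 * (J * (β * H))) (*-monoʳ-≤ (β * H) 2ω≤J)) ⟩
          J * (2 * h) + (β * H * J + 2 * (J * (β * H))) ≡⟨ cong (J * (2 * h) +_) (l₆ J β H) ⟩
          J * (2 * h) + 3 * (J * (β * H))          ∎)

  -- Doubling the power of two found just above `count W` puts `J` into the required range. This
  -- takes `suc j` equations with `j ≤ N`; hence a block has `suc N` rows.
  isolation : 1 ≤ count W → count W ≤ 2 * count B →
              (2 ^ suc N) ^ suc N ≤ 16 * ∑ᵛ (∑ⁿ (suc N)) (suc N) (ind ∘ anySuffix hit)
  isolation 1≤W W≤2B with power-between N (count W) 1≤W (count≤ W)
  ... | j , j≤N , W≤ , ≤2W = subst (λ k → (2 ^ suc N) ^ k ≤ 16 * ∑ᵛ (∑ⁿ (suc N)) k (ind ∘ anySuffix hit))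
          (trans (+-suc (N ∸ j) j) (cong suc (m∸n+n≡m j≤N))) (begin
    G ^ (i + suc j)                            ≡⟨ ^-distribˡ-+-* G i (suc j) ⟩
    G ^ i * G ^ suc j                          ≤⟨ *-monoʳ-≤ (G ^ i) (isolate (suc j) W≤2B (*-monoʳ-≤ 2 W≤)
                                                    (≤-trans (*-monoʳ-≤ 2 ≤2W) (≤-reflexive (lemma (count W))))) ⟩
    G ^ i * (16 * E (suc j) (ind ∘ hit))       ≡⟨ swap* (G ^ i) 16 _ ⟩
    16 * (G ^ i * E (suc j) (ind ∘ hit))       ≡⟨ cong (λ g → 16 * (g ^ i * E (suc j) (ind ∘ hit))) (sym (2^-mass (suc N))) ⟩
    16 * (∑ⁿ (suc N) (λ _ → 1) ^ i * E (suc j) (ind ∘ hit)) ≤⟨ *-monoʳ-≤ 16 (∑-suffix rowSum hit i (suc j)) ⟩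
    16 * E (i + suc j) (ind ∘ anySuffix hit)   ∎)
    where
    open ≤-Reasoning
    G = 2 ^ suc N
    i = N ∸ j
    lemma : ∀ w → 2 * (2 * w) ≡ 4 * w
    lemma = solve-∀
    swap* : ∀ a b c → a * (b * c) ≡ b * (a * c)
    swap* = solve-∀

-- Union bounds

ListsUpTo : ℕ → ℕ → ℕ
ListsUpTo n zero    = 1
ListsUpTo n (suc D) = 1 + 2 ^ n * ListsUpTo n D

anyList : ∀ {n} → ℕ → (List (Vec Bool n) → Bool) → Bool
anyList     zero    φ = φ []
anyList {n} (suc D) φ = φ [] ∨ anyᵇ n (λ x → anyList D (λ S → φ (x ∷ S)))

∨-falseˡ : ∀ {a b} → a ∨ b ≡ false → a ≡ false
∨-falseˡ {false} e = refl

∨-falseʳ : ∀ {a b} → a ∨ b ≡ false → b ≡ false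
∨-falseʳ {false} e = e

anyList-false : ∀ {n} D (φ : List (Vec Bool n) → Bool) → anyList D φ ≡ false →
                ∀ S → length S ≤ D → φ S ≡ false
anyList-false zero    φ e []      p = e
anyList-false (suc D) φ e []      p = ∨-falseˡ e
anyList-false (suc D) φ e (x ∷ S) (s≤s p) =
  anyList-false D (λ S → φ (x ∷ S)) (anyᵇ-false _ (∨-falseʳ {φ []} e) x) S p

ListsUpTo≤ : ∀ n D → ListsUpTo n D ≤ 2 ^ (suc n * suc D)
ListsUpTo≤ n zero    = m^n>0 2 (suc n * 1)
ListsUpTo≤ n (suc D) = begin
  1 + 2 ^ n * ListsUpTo n D                      ≤⟨ +-mono-≤ (m^n>0 2 (n + e)) (*-monoʳ-≤ (2 ^ n) (ListsUpTo≤ n D)) ⟩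
  2 ^ (n + e) + 2 ^ n * 2 ^ e                    ≡⟨ cong (2 ^ (n + e) +_) (sym (^-distribˡ-+-* 2 n e)) ⟩
  2 ^ (n + e) + 2 ^ (n + e)                      ≡⟨ sym (2^≡ (n + e)) ⟩
  2 ^ (suc n + e)                                ≡⟨ cong (2 ^_) (sym (*-suc (suc n) (suc D))) ⟩
  2 ^ (suc n * suc (suc D))                      ∎
  where
  open ≤-Reasoning
  e = suc n * suc D

module _ {A : Set} {S : Sum A} (I : IsSum S) (K : ℕ) where

  -- `K` is the denominator of a probability; carrying it on the left keeps the bounds in the
  -- natural numbers.
  union : ∀ f g {t u} → K * S (ind ∘ f) ≤ t → K * S (ind ∘ g) ≤ u →
          K * S (λ a → ind (f a ∨ g a)) ≤ t + u
  union f g {t} {u} p q = begin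
    K * S (λ a → ind (f a ∨ g a))          ≤⟨ *-monoʳ-≤ K (mono I (λ a → ind-∨ (f a) (g a))) ⟩
    K * S (λ a → ind (f a) + ind (g a))    ≡⟨ cong (K *_) (plus I (ind ∘ f) (ind ∘ g)) ⟩
    K * (S (ind ∘ f) + S (ind ∘ g))        ≡⟨ *-distribˡ-+ K _ _ ⟩
    K * S (ind ∘ f) + K * S (ind ∘ g)      ≤⟨ +-mono-≤ p q ⟩
    t + u                                  ∎
    where open ≤-Reasoning

  union-any : ∀ n {t} (f : Vec Bool n → A → Bool) → (∀ u → K * S (ind ∘ f u) ≤ t) →
              K * S (λ a → ind (anyᵇ n (λ u → f u a))) ≤ 2 ^ n * t
  union-any zero f h = ≤-trans (h []) (≤-reflexive (sym (+-identityʳ _)))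
  union-any (suc n) {t} f h =
    ≤-trans (union (λ a → anyᵇ n (λ u → f (false ∷ u) a)) (λ a → anyᵇ n (λ u → f (true ∷ u) a))
              (union-any n (f ∘ (false ∷_)) (h ∘ (false ∷_))) (union-any n (f ∘ (true ∷_)) (h ∘ (true ∷_))))
            (≤-reflexive (trans (sym (*-distribʳ-+ t (2 ^ n) (2 ^ n))) (cong (_* t) (sym (2^≡ n)))))

  union-list : ∀ {n} D {t} (φ : List (Vec Bool n) → A → Bool) → (∀ xs → K * S (ind ∘ φ xs) ≤ t) →
               K * S (λ a → ind (anyList D (λ xs → φ xs a))) ≤ ListsUpTo n D * t
  union-list zero φ h = ≤-trans (h []) (≤-reflexive (sym (+-identityʳ _)))
  union-list {n} (suc D) {t} φ h =
    ≤-trans (union (φ []) (λ a → anyᵇ n (λ x → anyList D (λ xs → φ (x ∷ xs) a))) (h [])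
              (union-any n (λ x a → anyList D (λ xs → φ (x ∷ xs) a))
                (λ x → union-list D (λ xs → φ (x ∷ xs)) (λ xs → h (x ∷ xs)))))
            (≤-reflexive (cong (t +_) (sym (*-assoc (2 ^ n) (ListsUpTo n D) t))))

-- Learning from a pool of random blocks

-- Sixteen blocks halve the probability of a miss, and `(2 + ν) * (2 + N)` halvings beat the number
-- of pairs of a list of at most `N` inputs with one further input, with at least the factor 4 to
-- spare.
poolSize : ℕ → ℕ → ℕ
poolSize N ν = 16 * ((2 + ν) * (2 + N))

module Learning {N ν : ℕ} (correct : Vec Bool ν → Vec Bool N → Bool)
  (pick : List (Vec Bool ν) → ∀ {j} → Vec (Vec Bool (suc N)) j → Vec Bool N) where

  versions : List (Vec Bool ν) → Vec Bool N → Bool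
  versions []      u = true
  versions (x ∷ S) u = correct x u ∧ versions S u

  Block : Set
  Block = Vec (Vec Bool (suc N)) (suc N)

  Pool : Set
  Pool = Vec Block (poolSize N ν)

  hits : List (Vec Bool ν) → Vec Bool ν → Block → Bool
  hits S x = anySuffix (λ rows → correct x (pick S rows))

  halving : List (Vec Bool ν) → Vec Bool ν → Bool
  halving S x = (1 ≤ᵇ count (versions S)) ∧ (count (versions S) ≤ᵇ 2 * count (versions (x ∷ S)))

  missed : List (Vec Bool ν) → Vec Bool ν → Pool → Bool
  missed S x pool = halving S x ∧ allᵛ (not ∘ hits S x) pool

  -- Hypotheses are formed from at most `N` stored inputs, as there are `suc N` rounds and the first
  -- starts with none.
  bad : Pool → Bool
  bad pool = anyList N (λ S → anyᵇ ν (λ x → missed S x pool))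

  good : Pool → Bool
  good = not ∘ bad

  good-hits : ∀ pool → good pool ≡ true → ∀ S x → length S ≤ N → 1 ≤ count (versions S) →
              count (versions S) ≤ 2 * count (versions (x ∷ S)) → anyᵛ (hits S x) pool ≡ true
  good-hits pool g S x S≤N p q = all-not (hits S x) pool
    (∧-false (cong₂ _∧_ (dec-true (1 ≤? _) p) (dec-true (_ ≤? _) q))
             (anyᵇ-false _ (anyList-false N (λ S → anyᵇ ν (λ x → missed S x pool)) (not-injective g) S S≤N) x))
    where
    not-injective : ∀ {b} → not b ≡ true → b ≡ false
    not-injective {false} e = refl

    ∧-false : ∀ {a b} → a ≡ true → a ∧ b ≡ false → b ≡ false
    ∧-false refl e = e

    all-not : ∀ {A : Set} {n} (f : A → Bool) (u : Vec A n) → allᵛ (not ∘ f) u ≡ false → anyᵛ f u ≡ true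
    all-not f (a ∷ u) e with f a
    ... | false = all-not f u e
    ... | true  = refl

  blockSum : Sum Block
  blockSum = ∑ᵛ (∑ⁿ (suc N)) (suc N)

  blockSum-isSum : IsSum blockSum
  blockSum-isSum = ∑ᵛ-isSum (∑ⁿ-isSum (suc N)) (suc N)

  poolSum : Sum Pool
  poolSum = ∑ᵛ blockSum (poolSize N ν)

  poolSum-isSum : IsSum poolSum
  poolSum-isSum = ∑ᵛ-isSum blockSum-isSum (poolSize N ν)

  blocks pools : ℕ
  blocks = (2 ^ suc N) ^ suc N
  pools  = blocks ^ poolSize N ν

  mass-block : blockSum (λ _ → 1) ≡ blocks
  mass-block = trans (mass (∑ⁿ-isSum (suc N)) (suc N)) (cong (_^ suc N) (2^-mass (suc N)))

  mass-pool : poolSum (λ _ → 1) ≡ pools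
  mass-pool = trans (mass blockSum-isSum (poolSize N ν)) (cong (_^ poolSize N ν) mass-block)

  -- (15/16)¹⁶ ≤ 1/2
  amplify : ∀ u e G → 16 * e ≤ 15 * G → 2 ^ u * e ^ (16 * u) ≤ G ^ (16 * u)
  amplify u e G h = *-cancelˡ-≤ (16 ^ R) ⦃ m^n≢0 16 R ⦄ (begin
    16 ^ R * (2 ^ u * e ^ R)     ≡⟨ l₁ (16 ^ R) (2 ^ u) (e ^ R) ⟩
    2 ^ u * (16 ^ R * e ^ R)     ≡⟨ cong (2 ^ u *_) (sym (^-distribʳ-* R 16 e)) ⟩
    2 ^ u * (16 * e) ^ R         ≤⟨ *-monoʳ-≤ (2 ^ u) (^-monoˡ-≤ R h) ⟩
    2 ^ u * (15 * G) ^ R         ≡⟨ cong (2 ^ u *_) (^-distribʳ-* R 15 G) ⟩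
    2 ^ u * (15 ^ R * G ^ R)     ≡⟨ sym (*-assoc (2 ^ u) (15 ^ R) (G ^ R)) ⟩
    2 ^ u * 15 ^ R * G ^ R       ≡⟨ cong (λ z → 2 ^ u * z * G ^ R) (sym (^-*-assoc 15 16 u)) ⟩
    2 ^ u * (15 ^ 16) ^ u * G ^ R ≡⟨ cong (_* G ^ R) (sym (^-distribʳ-* u 2 (15 ^ 16))) ⟩
    (2 * 15 ^ 16) ^ u * G ^ R    ≤⟨ *-monoˡ-≤ (G ^ R) (^-monoˡ-≤ u (≤ᵇ⇒≤ (2 * 15 ^ 16) (16 ^ 16) _)) ⟩
    (16 ^ 16) ^ u * G ^ R        ≡⟨ cong (_* G ^ R) (^-*-assoc 16 16 u) ⟩
    16 ^ R * G ^ R               ∎)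
    where
    open ≤-Reasoning
    R = 16 * u
    l₁ : ∀ a b c → a * (b * c) ≡ b * (a * c)
    l₁ = solve-∀

  module _ (pick-ok : ∀ S {j} (rows : Vec (Vec Bool (suc N)) j) u →
              versions S u ∧ allᵛ (sat u) rows ≡ true →
              versions S (pick S rows) ∧ allᵛ (sat (pick S rows)) rows ≡ true) where

    miss : ∀ S x → 2 ^ ((2 + ν) * (2 + N)) * poolSum (ind ∘ missed S x) ≤ pools
    miss S x with halving S x in e₁
    ... | false = ≤-trans (≤-reflexive (trans (cong (2 ^ ((2 + ν) * (2 + N)) *_)
                    (trans (constant poolSum-isSum 0) (*-zeroʳ (poolSum (λ _ → 1)))))
                    (*-zeroʳ (2 ^ ((2 + ν) * (2 + N)))))) z≤n
    ... | true  =
      ≤-trans (≤-reflexive (cong (2 ^ ((2 + ν) * (2 + N)) *_) (∑-all blockSum-isSum (poolSize N ν) (not ∘ hits S x))))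
              (amplify ((2 + ν) * (2 + N)) (blockSum (ind ∘ not ∘ hits S x)) blocks missBlock)
      where
      open Isolation (versions S) (versions (x ∷ S)) (λ u e → proj₂ (∧-true {correct x u} e)) (pick S) (pick-ok S)
        using (isolation)
      ≤ᵇ-sound : ∀ {a b} → (a ≤ᵇ b) ≡ true → a ≤ b
      ≤ᵇ-sound {a} {b} e = ≤ᵇ⇒≤ a b (subst T (sym e) _)
      h e : ℕ
      h = blockSum (ind ∘ hits S x)
      e = blockSum (ind ∘ not ∘ hits S x)
      -- Isolation aims at tuples that serve `x` and all of `S`; `hits` records only the former.
      stronger : ∀ {j} (rows : Vec (Vec Bool (suc N)) j) → ind (anySuffix (λ rows → versions (x ∷ S) (pick S rows)) rows) ≤
                 ind (anySuffix (λ rows → correct x (pick S rows)) rows)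
      stronger [] = weaken _ _
        where
        weaken : ∀ a b → ind (a ∧ b) ≤ ind a
        weaken false b = z≤n
        weaken true  b = ind≤1 b
      stronger (row ∷ rows) with correct x (pick S (row ∷ rows))
      ... | false = stronger rows
      ... | true  = ind≤1 _
      G≤ : blocks ≤ 16 * h
      G≤ = ≤-trans (isolation (≤ᵇ-sound (proj₁ (∧-true e₁))) (≤ᵇ-sound (proj₂ (∧-true {1 ≤ᵇ count (versions S)} e₁)))) (*-monoʳ-≤ 16 (mono blockSum-isSum stronger))
      h+e : h + e ≡ blocks
      h+e = trans (sym (plus blockSum-isSum (ind ∘ hits S x) (ind ∘ not ∘ hits S x))) (trans (ext blockSum-isSum (λ b → ind-not (hits S x b))) mass-block)
      missBlock : 16 * e ≤ 15 * blocks
      missBlock = +-cancelˡ-≤ blocks _ _ (begin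
        blocks + 16 * e    ≤⟨ +-monoˡ-≤ (16 * e) G≤ ⟩
        16 * h + 16 * e    ≡⟨ sym (*-distribˡ-+ 16 h e) ⟩
        16 * (h + e)       ≡⟨ cong (16 *_) h+e ⟩
        16 * blocks        ∎)
        where open ≤-Reasoning

    bad-rare : 4 * poolSum (ind ∘ bad) ≤ pools
    bad-rare = *-cancelˡ-≤ (2 ^ r) ⦃ m^n≢0 2 r ⦄ (begin
      2 ^ r * (4 * poolSum (ind ∘ bad))       ≡⟨ sym (*-assoc (2 ^ r) 4 _) ⟩
      2 ^ r * 4 * poolSum (ind ∘ bad)         ≡⟨ cong (_* poolSum (ind ∘ bad)) (sym (^-distribˡ-+-* 2 r 2)) ⟩
      2 ^ (r + 2) * poolSum (ind ∘ bad)       ≤⟨ *-monoˡ-≤ (poolSum (ind ∘ bad)) (^-monoʳ-≤ 2 r+2≤u) ⟩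
      2 ^ u * poolSum (ind ∘ bad)             ≤⟨ union-list poolSum-isSum (2 ^ u) N
                                                   (λ S pool → anyᵇ ν (λ x → missed S x pool))
                                                   (λ S → union-any poolSum-isSum (2 ^ u) ν (missed S) (miss S)) ⟩
      ListsUpTo ν N * (2 ^ ν * pools)         ≤⟨ *-monoˡ-≤ (2 ^ ν * pools) (ListsUpTo≤ ν N) ⟩
      2 ^ (suc ν * suc N) * (2 ^ ν * pools)   ≡⟨ sym (*-assoc (2 ^ (suc ν * suc N)) (2 ^ ν) pools) ⟩
      2 ^ (suc ν * suc N) * 2 ^ ν * pools     ≡⟨ cong (_* pools) (sym (^-distribˡ-+-* 2 (suc ν * suc N) ν)) ⟩
      2 ^ r * pools                           ∎)
      where
      open ≤-Reasoning
      r = suc ν * suc N + ν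
      u = (2 + ν) * (2 + N)
      r+2≤u : r + 2 ≤ u
      r+2≤u = ≤-trans (m≤m+n (r + 2) (suc N)) (≤-reflexive (lemma ν N))
        where
        lemma : ∀ ν N → (suc ν * suc N + ν) + 2 + suc N ≡ (2 + ν) * (2 + N)
        lemma = solve-∀

    -- At most a quarter of the pools is bad, which is more than the required 2/3 leaves room for in
    -- the other direction: 3/4 are good.
    good-likely : 2 * pools ≤ 3 * poolSum (ind ∘ good)
    good-likely = +-cancelʳ-≤ (3 * b) _ _ (begin
      2 * pools + 3 * b         ≤⟨ +-monoʳ-≤ (2 * pools) (≤-trans (*-monoˡ-≤ b (n≤1+n 3)) bad-rare) ⟩
      2 * pools + pools         ≡⟨ l₁ pools ⟩
      3 * pools                 ≡⟨ cong (3 *_) (sym (trans (sym (plus poolSum-isSum (ind ∘ bad) (ind ∘ good)))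
                                     (trans (ext poolSum-isSum (λ p → ind-not (bad p))) mass-pool))) ⟩
      3 * (b + g)               ≡⟨ l₂ b g ⟩
      3 * g + 3 * b             ∎)
      where
      open ≤-Reasoning
      b = poolSum (ind ∘ bad)
      g = poolSum (ind ∘ good)
      l₁ : ∀ a → 2 * a + a ≡ 3 * a
      l₁ = solve-∀
      l₂ : ∀ a b → 3 * (a + b) ≡ 3 * b + 3 * a
      l₂ = solve-∀

-- Encodings and search by oracle

len-unary : ∀ l → len (unary l) ≡ l
len-unary zero    = refl
len-unary (suc l) = cong suc (len-unary l)

encBits : ∀ {n} → Vec Bool n → Tree
encBits u = u ▹ leaf

encᵛ : ∀ {A : Set} {n} → (A → Tree) → Vec A n → Tree
encᵛ f []      = leaf
encᵛ f (a ∷ u) = f a ∙ encᵛ f u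

encᴸ : ∀ {n} → List (Vec Bool n) → Tree
encᴸ []      = leaf
encᴸ (x ∷ S) = encBits x ∙ encᴸ S

▹-++ : ∀ {k l} (u : Vec Bool k) (w : Vec Bool l) t → (u Vec.++ w) ▹ t ≡ u ▹ (w ▹ t)
▹-++ []      w t = refl
▹-++ (b ∷ u) w t = cong (bool b ∙_) (▹-++ u w t)

drop-▹ : ∀ {n} (u : Vec Bool n) t → dropT (unary n) (u ▹ t) ≡ t
drop-▹ []      t = refl
drop-▹ (b ∷ u) t = drop-▹ u t

lookup-dec : ∀ {n} (i : Fin n) t → lookupT (unary (toℕ i)) t ≡ lookup (dec n t) i
lookup-dec zero    t = refl
lookup-dec (suc i) t = lookup-dec i (snd t)

eval-dec : ∀ {n m} (F : Formula n m) x y → evalT (encFormula F) x y ≡ ⟦ F ⟧ (dec n x) (dec m y)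
eval-dec (con b)   x y = nonleaf-bool b
eval-dec (X i)     x y = lookup-dec i x
eval-dec (Y j)     x y = lookup-dec j y
eval-dec (neg F)   x y = cong not (eval-dec F x y)
eval-dec (and F G) x y = cong₂ _∧_ (eval-dec F x y) (eval-dec G x y)
eval-dec (or F G)  x y = cong₂ _∨_ (eval-dec F x y) (eval-dec G x y)

oracle≡ : ∀ l s stuff → oracle (unary l ∙ s ∙ stuff) ≡ anyᵇ l (λ u → checkT stuff (u ▹ s))
oracle≡ l s stuff =
  subst (λ k → oracle q ≡ anyᵇ k (λ u → checkT stuff (u ▹ s))) (len-unary l)
        (anyᵇ-cong (len (unary l)) (λ u → verdict-▹ q u leaf))
  where q = unary l ∙ s ∙ stuff

-- Reduction of search to decision, from the last bit to the first, so that a new bit is simply put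
-- in front. The answer to whether the bit can be true is the bit itself.
findT : ℕ → Tree → Tree → Tree
findT zero    s stuff = s
findT (suc l) s stuff = findT l (bool (oracle (unary l ∙ (tt ∙ s) ∙ stuff)) ∙ s) stuff

find-bits : ∀ l s stuff → Σ[ u ∈ Vec Bool l ] findT l s stuff ≡ u ▹ s
find-bits zero    s stuff = [] , refl
find-bits (suc l) s stuff =
  let b = oracle (unary l ∙ (tt ∙ s) ∙ stuff)
      u , e = find-bits l (bool b ∙ s) stuff
  in snoc u b , trans e (snoc-▹ u b s)
  where
  snoc : ∀ {k} → Vec Bool k → Bool → Vec Bool (suc k)
  snoc []      b = b ∷ []
  snoc (a ∷ u) b = a ∷ snoc u b
  snoc-▹ : ∀ {k} (u : Vec Bool k) b t → u ▹ (bool b ∙ t) ≡ snoc u b ▹ t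
  snoc-▹ []      b t = refl
  snoc-▹ (a ∷ u) b t = cong (bool a ∙_) (snoc-▹ u b t)

-- The invariant is that `s` has a completion that passes the check. A positive answer supplies a
-- new completion; a negative one forces the last bit of the old one to be false.
find-correct : ∀ l s stuff (u : Vec Bool l) → checkT stuff (u ▹ s) ≡ true → checkT stuff (findT l s stuff) ≡ true
find-correct zero    s stuff [] e = e
find-correct (suc l) s stuff u e with unsnoc u
  where
  unsnoc : ∀ {k} (u : Vec Bool (suc k)) → Σ[ w ∈ Vec Bool k ] Σ[ b ∈ Bool ] (∀ t → u ▹ t ≡ w ▹ (bool b ∙ t))
  unsnoc (b ∷ [])        = [] , b , λ t → refl
  unsnoc (a ∷ u@(_ ∷ _)) = let w , b , e = unsnoc u in a ∷ w , b , λ t → cong (bool a ∙_) (e t)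
... | w , b , u≡ with oracle (unary l ∙ (tt ∙ s) ∙ stuff) in o
...   | true  = let w′ , e′ = anyᵇ-sound l _ (trans (sym (oracle≡ l (tt ∙ s) stuff)) o)
                in find-correct l (tt ∙ s) stuff w′ e′
...   | false with b
...     | false = find-correct l (leaf ∙ s) stuff w (trans (cong (checkT stuff) (sym (u≡ s))) e)
...     | true with trans (sym o) (trans (oracle≡ l (tt ∙ s) stuff)
                     (anyᵇ-complete (λ u → checkT stuff (u ▹ (tt ∙ s))) w (trans (cong (checkT stuff) (sym (u≡ s))) e)))
...       | ()

dot-enc : ∀ {n} (row u : Vec Bool n) a t → dotT (encBits row) (u ▹ t) a ≡ dot row u a
dot-enc []        []      a t = refl
dot-enc (b ∷ row) (x ∷ u) a t rewrite nonleaf-bool b | nonleaf-bool x = dot-enc row u _ t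

rows-enc : ∀ {N j} (rows : Vec (Vec Bool (suc N)) j) (u : Vec Bool N) →
           rowsT (encᵛ encBits rows) (tt ∙ encBits u) ≡ allᵛ (sat u) rows
rows-enc []           u = refl
rows-enc (row ∷ rows) u = cong₂ _∧_ (cong not (dot-enc row (true ∷ u) false leaf)) (rows-enc rows u)

covers-chop : ∀ F x K m t acc →
              coversT F x (chopT K m t acc) ≡ coversT F x (chopT K m t leaf) ∨ coversT F x acc
covers-chop F x leaf    m t acc = refl
covers-chop F x (_ ∙ K) m t acc =
  trans (cong (evalT F x t ∨_) (covers-chop F x K m (dropT m t) acc)) (sym (∨-assoc (evalT F x t) _ _))

coversF : ∀ {n m} → Formula n m → Vec Bool n → Tree → Bool
coversF         F x leaf    = false
coversF {m = m} F x (h ∙ H) = ⟦ F ⟧ x (dec m h) ∨ coversF F x H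

covers≡ : ∀ {n m} (F : Formula n m) t H → coversT (encFormula F) t H ≡ coversF F (dec n t) H
covers≡ F t leaf    = refl
covers≡ F t (h ∙ H) = cong₂ _∨_ (eval-dec F t h) (covers≡ F t H)

-- The halving algorithm for tuples of `K` outputs

module Algorithm {n m : ℕ} (F : Formula n m) (K : ℕ) where

  -- A stored counterexample has `n + m` bits because it keeps the output found along with the
  -- input. Evaluating `F` on it reads only the first `n` of them as input.
  N ν : ℕ
  N = K * m
  ν = n + m

  F̂ : Tree
  F̂ = encFormula F

  chop : Tree → Tree → Tree
  chop = chopT (unary K) (unary m)

  correct : Vec Bool ν → Vec Bool N → Bool
  correct x u = coversT F̂ (encBits x) (chop (encBits u) leaf)

  shared : List (Vec Bool ν) → Tree
  shared S = (F̂ ∙ encᴸ S) ∙ unary K ∙ unary m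

  tuples : ∀ {j} → List (Vec Bool ν) → Vec (Vec Bool (suc N)) j → Tree
  tuples S rows = leaf ∙ encᵛ encBits rows ∙ shared S

  pick : List (Vec Bool ν) → ∀ {j} → Vec (Vec Bool (suc N)) j → Vec Bool N
  pick S rows = dec N (findT N leaf (tuples S rows))

  open Learning correct pick public

  find-pick : ∀ S {j} (rows : Vec (Vec Bool (suc N)) j) → findT N leaf (tuples S rows) ≡ encBits (pick S rows)
  find-pick S rows with find-bits N leaf (tuples S rows)
  ... | u , e = trans e (cong encBits (sym (trans (cong (dec N) e) (dec-▹ u leaf))))

  versions≡ : ∀ S u → coversAllT F̂ (encᴸ S) (chop (encBits u) leaf) ≡ versions S u
  versions≡ []      u = refl
  versions≡ (x ∷ S) u = cong (correct x u ∧_) (versions≡ S u)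

  check-tuples : ∀ S {j} (rows : Vec (Vec Bool (suc N)) j) u →
                 checkT (tuples S rows) (encBits u) ≡ allᵛ (sat u) rows ∧ versions S u
  check-tuples S rows u = cong₂ _∧_ (rows-enc rows u) (versions≡ S u)

  pick-ok : ∀ S {j} (rows : Vec (Vec Bool (suc N)) j) u → versions S u ∧ allᵛ (sat u) rows ≡ true →
            versions S (pick S rows) ∧ allᵛ (sat (pick S rows)) rows ≡ true
  pick-ok S rows u e =
    trans (∧-comm (versions S (pick S rows)) _)
    (trans (sym (check-tuples S rows (pick S rows)))
    (trans (cong (checkT (tuples S rows)) (sym (find-pick S rows)))
      (find-correct N leaf (tuples S rows) u
        (trans (check-tuples S rows u) (trans (∧-comm (allᵛ (sat u) rows) _) e)))))

  sampleT : ∀ {j} → List (Vec Bool ν) → Vec (Vec Bool (suc N)) j → Tree → Tree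
  sampleT S []           acc = chop (findT N leaf (tuples S [])) acc
  sampleT S (row ∷ rows) acc = sampleT S rows (chop (findT N leaf (tuples S (row ∷ rows))) acc)

  samplesT : ∀ {R} → List (Vec Bool ν) → Vec Block R → Tree → Tree
  samplesT S []           acc = acc
  samplesT S (blk ∷ pool) acc = samplesT S pool (sampleT S blk acc)

  module _ (S : List (Vec Bool ν)) (x : Vec Bool ν) where

    covered : Tree → Bool
    covered = coversT F̂ (encBits x)

    chop-keeps : ∀ t acc → covered acc ≡ true → covered (chop t acc) ≡ true
    chop-keeps t acc e = trans (covers-chop F̂ (encBits x) (unary K) (unary m) t acc)
                               (trans (cong (covered (chop t leaf) ∨_) e) (∨-zeroʳ _))

    chop-hits : ∀ {j} (rows : Vec (Vec Bool (suc N)) j) acc → correct x (pick S rows) ≡ true →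
                covered (chop (findT N leaf (tuples S rows)) acc) ≡ true
    chop-hits rows acc e =
      trans (covers-chop F̂ (encBits x) (unary K) (unary m) t acc)
            (cong (_∨ covered acc) (trans (cong (λ t → covered (chop t leaf)) (find-pick S rows)) e))
      where t = findT N leaf (tuples S rows)

    sample-keeps : ∀ {j} (rows : Vec (Vec Bool (suc N)) j) acc → covered acc ≡ true →
                   covered (sampleT S rows acc) ≡ true
    sample-keeps []           acc e = chop-keeps _ acc e
    sample-keeps (row ∷ rows) acc e = sample-keeps rows _ (chop-keeps _ acc e)

    sample-hits : ∀ {j} (rows : Vec (Vec Bool (suc N)) j) acc →
                  anySuffix (λ rows → correct x (pick S rows)) rows ≡ true → covered (sampleT S rows acc) ≡ true
    sample-hits []           acc e = chop-hits [] acc e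
    sample-hits (row ∷ rows) acc e with ∨-true {correct x (pick S (row ∷ rows))} e
    ... | inj₁ p = sample-keeps rows _ (chop-hits (row ∷ rows) acc p)
    ... | inj₂ p = sample-hits rows _ p

    samples-keep : ∀ {R} (pool : Vec Block R) acc → covered acc ≡ true → covered (samplesT S pool acc) ≡ true
    samples-keep []           acc e = e
    samples-keep (blk ∷ pool) acc e = samples-keep pool _ (sample-keeps blk acc e)

    samples-hit : ∀ {R} (pool : Vec Block R) acc → anyᵛ (hits S x) pool ≡ true → covered (samplesT S pool acc) ≡ true
    samples-hit (blk ∷ pool) acc e with ∨-true {hits S x blk} e
    ... | inj₁ p = samples-keep pool _ (sample-hits blk acc p)
    ... | inj₂ p = samples-hit pool _ p

  uncovered : Tree → Tree
  uncovered H = tt ∙ F̂ ∙ (unary n ∙ H)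

  hypothesis : List (Vec Bool ν) → Pool → Tree
  hypothesis S pool = samplesT S pool leaf

  counterexample : Tree → Tree
  counterexample H = findT ν leaf (uncovered H)

  refuted : Tree → Bool
  refuted H = oracle (leaf ∙ counterexample H ∙ uncovered H)

  refuted≡ : ∀ H → refuted H ≡ checkT (uncovered H) (counterexample H)
  refuted≡ H = oracle≡ 0 (counterexample H) (uncovered H)

  counterexample-bits : ∀ H → counterexample H ≡ encBits (dec ν (counterexample H))
  counterexample-bits H =
    let u , e = find-bits ν leaf (uncovered H)
    in trans e (cong encBits (sym (trans (cong (dec ν) e) (dec-▹ u leaf))))

  rounds : ℕ → List (Vec Bool ν) → Pool → Maybe Tree
  rounds zero    S pool = nothing
  rounds (suc f) S pool =
    if refuted (hypothesis S pool)
    then rounds f (dec ν (counterexample (hypothesis S pool)) ∷ S) pool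
    else just (hypothesis S pool)

  -- If some input with an output were uncovered, the search would have found such a pair and the
  -- last query would have confirmed it. This holds for every `H`, however it was sampled.
  unrefuted : ∀ H → refuted H ≡ false → ∀ x y → ⟦ F ⟧ x y ≡ true → coversF F x H ≡ true
  unrefuted H e x y Fxy = not-false (begin
    not (coversF F x H)
      ≡⟨ cong not (sym (trans (covers≡ F (x ▹ encBits y) H) (cong (λ x → coversF F x H) (dec-▹ x (encBits y))))) ⟩
    not (coversT F̂ (x ▹ encBits y) H)
      ≡⟨ cong (_∧ not (coversT F̂ (x ▹ encBits y) H)) (sym valid) ⟩
    checkT (uncovered H) (x ▹ encBits y)
      ≡⟨ cong (checkT (uncovered H)) (sym (▹-++ x y leaf)) ⟩
    checkT (uncovered H) (encBits (x Vec.++ y))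
      ≡⟨ none (x Vec.++ y) ⟩
    false ∎)
    where
    open ≡-Reasoning
    not-false : ∀ {b} → not b ≡ false → b ≡ true
    not-false {true} e = refl
    valid : evalT F̂ (x ▹ encBits y) (dropT (unary n) (x ▹ encBits y)) ≡ true
    valid = trans (cong (evalT F̂ (x ▹ encBits y)) (drop-▹ x (encBits y)))
            (trans (eval-dec F (x ▹ encBits y) (encBits y))
            (trans (cong₂ ⟦ F ⟧ (dec-▹ x (encBits y)) (dec-▹ y leaf)) Fxy))
    none : ∀ u → checkT (uncovered H) (encBits u) ≡ false
    none u with checkT (uncovered H) (encBits u) in c
    ... | false = refl
    ... | true  = trans (sym (find-correct ν leaf (uncovered H) u c)) (trans (sym (refuted≡ H)) e)

  rounds-sound : ∀ f S pool H → rounds f S pool ≡ just H → ∀ x y → ⟦ F ⟧ x y ≡ true → coversF F x H ≡ true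
  rounds-sound (suc f) S pool H e with refuted (hypothesis S pool) in r
  rounds-sound (suc f) S pool H e    | true = rounds-sound f _ pool H e
  rounds-sound (suc f) S pool _ refl | false = unrefuted _ r

  -- Transfers the size bounds, which are proved for hypotheses, to the returned `H`.
  rounds-hypothesis : ∀ f S pool H → rounds f S pool ≡ just H → ∃[ S′ ] hypothesis S′ pool ≡ H
  rounds-hypothesis (suc f) S pool H e with refuted (hypothesis S pool)
  rounds-hypothesis (suc f) S pool H e    | true = rounds-hypothesis f _ pool H e
  rounds-hypothesis (suc f) S pool _ refl | false = S , refl

  module _ (u* : Vec Bool N)
           (u*-correct : ∀ w → evalT F̂ (encBits w) (dropT (unary n) (encBits w)) ≡ true → correct w u* ≡ true) where

    -- The fuel bounds the binary logarithm of the number of versions, and the equation for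
    -- `length S` keeps `S` among the lists for which a good pool is guaranteed to work. Out of
    -- fuel, no version could be left, yet `u*` is one.
    rounds-complete : ∀ f S pool → good pool ≡ true → length S + f ≡ suc N → versions S u* ≡ true →
                      count (versions S) < 2 ^ f → ∃[ H ] rounds f S pool ≡ just H
    rounds-complete zero S pool g _ e few =
      ⊥-elim (<-irrefl refl (≤-trans few (∃⇒count (versions S) u* e)))
    rounds-complete (suc f) S pool g l e few with refuted (hypothesis S pool) in r
    ... | false = _ , refl
    ... | true  = rounds-complete f (x ∷ S) pool g (trans (sym (+-suc (length S) f)) l)
                    (cong₂ _∧_ (u*-correct x (proj₁ new)) e)
                    (*-cancelˡ-< 2 _ _ (≤-trans (s≤s (<⇒≤ fewer)) few))
      where
      H = hypothesis S pool
      x = dec ν (counterexample H)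
      new : evalT F̂ (encBits x) (dropT (unary n) (encBits x)) ≡ true × not (coversT F̂ (encBits x) H) ≡ true
      new = ∧-true (trans (cong (checkT (uncovered H)) (sym (counterexample-bits H))) (trans (sym (refuted≡ H)) r))
      S≤N : length S ≤ N
      S≤N = ≤-trans (m≤m+n (length S) f) (≤-reflexive (suc-injective (trans (sym (+-suc (length S) f)) l)))
      -- If at least half of the versions served `x`, the good pool would have put an output for `x`
      -- into `H`, and `x` would be no counterexample.
      fewer : 2 * count (versions (x ∷ S)) < count (versions S)
      fewer = ≰⇒> (λ many → absurd (proj₂ new)
        (samples-hit S x pool leaf (good-hits pool g S x S≤N (∃⇒count (versions S) u* e) many)))
        where
        absurd : ∀ {b} → not b ≡ true → b ≡ true → ⊥
        absurd {true} () q

  start : ∀ pool → good pool ≡ true → (u* : Vec Bool N) →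
          (∀ w → evalT F̂ (encBits w) (dropT (unary n) (encBits w)) ≡ true → correct w u* ≡ true) →
          ∃[ H ] rounds (suc N) [] pool ≡ just H
  start pool g u* u*-correct = rounds-complete u* u*-correct (suc N) [] pool g refl refl
    (≤-trans (s≤s (≤-reflexive (2^-mass N))) 2^-mono)
    where
    2^-mono : suc (2 ^ N) ≤ 2 ^ suc N
    2^-mono = ≤-trans (+-monoˡ-≤ (2 ^ N) (m^n>0 2 N)) (≤-reflexive (sym (2^≡ N)))

-- From hypotheses to circuits

substitute : ∀ {n m} → Formula n m → Tree → Formula n 0
substitute (con b)   h = con b
substitute (X i)     h = X i
substitute (Y j)     h = con (lookupT (unary (toℕ j)) h)
substitute (neg F)   h = neg (substitute F h)
substitute (and F G) h = and (substitute F h) (substitute G h)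
substitute (or F G)  h = or (substitute F h) (substitute G h)

substitute-correct : ∀ {n m} (F : Formula n m) h x → ⟦ substitute F h ⟧ x [] ≡ ⟦ F ⟧ x (dec m h)
substitute-correct (con b)   h x = refl
substitute-correct (X i)     h x = refl
substitute-correct (Y j)     h x = lookup-dec j h
substitute-correct (neg F)   h x = cong not (substitute-correct F h x)
substitute-correct (and F G) h x = cong₂ _∧_ (substitute-correct F h x) (substitute-correct G h x)
substitute-correct (or F G)  h x = cong₂ _∨_ (substitute-correct F h x) (substitute-correct G h x)

-- A multiplexer with control `G` whose first data input is the constant `b`.
prefer : ∀ {n} → Bool → Formula n 0 → Formula n 0 → Formula n 0
prefer false G φ = and (neg G) φ
prefer true  G φ = or G φ

-- A candidate is tested by `F` with its bits plugged in, which leaves a formula over the inputs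
-- alone. `con false` is the default when all candidates fail.
choose : ∀ {n m} → Formula n m → Tree → Fin m → Formula n 0
choose F leaf    j = con false
choose F (h ∙ H) j = prefer (lookupT (unary (toℕ j)) h) (substitute F h) (choose F H j)

prefer-correct : ∀ {n} b (G φ : Formula n 0) x →
                 ⟦ prefer b G φ ⟧ x [] ≡ (if ⟦ G ⟧ x [] then b else ⟦ φ ⟧ x [])
prefer-correct false G φ x with ⟦ G ⟧ x []
... | false = refl
... | true  = refl
prefer-correct true G φ x with ⟦ G ⟧ x []
... | false = refl
... | true  = refl

chosen : ∀ {n m} → Formula n m → Tree → Vec Bool n → Vec Bool m
chosen F H x = tabulate (λ j → ⟦ choose F H j ⟧ x [])

-- wires F w + 1 wires are in use after F has been compiled on w wires, and
-- wire zero then carries its value.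

wires : ∀ {n} → Formula n 0 → ℕ → ℕ
wires (con b)   w = w
wires (X i)     w = w
wires (neg F)   w = suc (wires F w)
wires (and F G) w = suc (wires G (suc (wires F w)))
wires (or F G)  w = suc (wires G (suc (wires F w)))

shift : ∀ {n} (F : Formula n 0) {w} → Fin w → Fin (suc (wires F w))
shift (con b)   i = suc i
shift (X _)     i = suc i
shift (neg F)   i = suc (shift F i)
shift (and F G) i = suc (shift G (shift F i))
shift (or F G)  i = suc (shift G (shift F i))

-- In continuation style: `c` is the rest of the circuit, so circuits are never concatenated. `σ`
-- records where the inputs are, since every gate moves the older wires.
compile : ∀ {n w} (F : Formula n 0) → (Fin n → Fin w) → Circuit (suc (wires F w)) → Circuit w
compile (con b)   σ c = gate (con b) c
-- A copy gate, so that the value is on wire zero for inputs too.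
compile (X i)     σ c = gate (and (σ i) (σ i)) c
compile (neg F)   σ c = compile F σ (gate (neg zero) c)
-- At the last gate wire zero carries the value of `G`, while that of `F` has been moved by the
-- gates of `G`.
compile (and F G) σ c = compile F σ (compile G (shift F ∘ σ) (gate (and zero (shift G zero)) c))
compile (or F G)  σ c = compile F σ (compile G (shift F ∘ σ) (gate (or zero (shift G zero)) c))

extend : ∀ {n w} (F : Formula n 0) → (Fin n → Fin w) → Vec Bool w → Vec Bool (suc (wires F w))
extend (con b)   σ ρ = b ∷ ρ
extend (X i)     σ ρ = (lookup ρ (σ i) ∧ lookup ρ (σ i)) ∷ ρ
extend (neg F)   σ ρ = let ρ₁ = extend F σ ρ in not (lookup ρ₁ zero) ∷ ρ₁
extend (and F G) σ ρ = let ρ₂ = extend G (shift F ∘ σ) (extend F σ ρ)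
                       in (lookup ρ₂ zero ∧ lookup ρ₂ (shift G zero)) ∷ ρ₂
extend (or F G)  σ ρ = let ρ₂ = extend G (shift F ∘ σ) (extend F σ ρ)
                       in (lookup ρ₂ zero ∨ lookup ρ₂ (shift G zero)) ∷ ρ₂

compile-extend : ∀ {n w} (F : Formula n 0) (σ : Fin n → Fin w) c ρ → ⟦ compile F σ c ⟧ᶜ ρ ≡ ⟦ c ⟧ᶜ (extend F σ ρ)
compile-extend (con b)   σ c ρ = refl
compile-extend (X i)     σ c ρ = refl
compile-extend (neg F)   σ c ρ = compile-extend F σ _ ρ
compile-extend (and F G) σ c ρ = trans (compile-extend F σ _ ρ) (compile-extend G _ _ _)
compile-extend (or F G)  σ c ρ = trans (compile-extend F σ _ ρ) (compile-extend G _ _ _)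

extend-shift : ∀ {n w} (F : Formula n 0) (σ : Fin n → Fin w) ρ i → lookup (extend F σ ρ) (shift F i) ≡ lookup ρ i
extend-shift (con b)   σ ρ i = refl
extend-shift (X _)     σ ρ i = refl
extend-shift (neg F)   σ ρ i = extend-shift F σ ρ i
extend-shift (and F G) σ ρ i = trans (extend-shift G _ _ _) (extend-shift F σ ρ i)
extend-shift (or F G)  σ ρ i = trans (extend-shift G _ _ _) (extend-shift F σ ρ i)

extend-value : ∀ {n w} (F : Formula n 0) (σ : Fin n → Fin w) ρ x → (∀ i → lookup ρ (σ i) ≡ lookup x i) →
               lookup (extend F σ ρ) zero ≡ ⟦ F ⟧ x []
extend-value (con b)   σ ρ x e = refl
extend-value (X i)     σ ρ x e = trans (∧-idem _) (e i)
extend-value (neg F)   σ ρ x e = cong not (extend-value F σ ρ x e)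
extend-value (and F G) σ ρ x e =
  trans (cong₂ _∧_ (extend-value G _ _ x (λ i → trans (extend-shift F σ ρ _) (e i)))
                   (trans (extend-shift G _ _ zero) (extend-value F σ ρ x e)))
        (∧-comm (⟦ G ⟧ x []) _)
extend-value (or F G) σ ρ x e =
  trans (cong₂ _∨_ (extend-value G _ _ x (λ i → trans (extend-shift F σ ρ _) (e i)))
                   (trans (extend-shift G _ _ zero) (extend-value F σ ρ x e)))
        (∨-comm (⟦ G ⟧ x []) _)

circuit : ∀ {n m} → Formula n m → Tree → Fin m → Circuit n
circuit F H j = compile (choose F H j) (λ i → i) (output zero)

circuit-correct : ∀ {n m} (F : Formula n m) H j x → ⟦ circuit F H j ⟧ᶜ x ≡ ⟦ choose F H j ⟧ x []
circuit-correct F H j x =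
  trans (compile-extend (choose F H j) _ _ x) (extend-value (choose F H j) _ x x (λ i → refl))

circuits : ∀ {n m} → Formula n m → Tree → Vec (Circuit n) m
circuits F H = tabulate (circuit F H)

tabulate-at : ∀ {n m} (f : Fin m → Circuit n) x → map ⟦_⟧ᶜ (tabulate f) at x ≡ tabulate (λ j → ⟦ f j ⟧ᶜ x)
tabulate-at {m = zero}  f x = refl
tabulate-at {m = suc m} f x = cong (⟦ f zero ⟧ᶜ x ∷_) (tabulate-at (f ∘ suc) x)

-- Correctness of the circuits, and the tuple given by an image

module Correctness {n m : ℕ} (F : Formula n m) where

  chosen-correct : ∀ H x → coversF F x H ≡ true → ⟦ F ⟧ x (chosen F H x) ≡ true
  chosen-correct (h ∙ H) x e with ⟦ F ⟧ x (dec m h) in eq₁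
  ... | true  = trans (cong (⟦ F ⟧ x) (trans (tabulate-cong value) (tabulate∘lookup (dec m h)))) eq₁
    where
    value : ∀ j → ⟦ choose F (h ∙ H) j ⟧ x [] ≡ lookup (dec m h) j
    value j = trans (prefer-correct (lookupT (unary (toℕ j)) h) (substitute F h) (choose F H j) x)
      (trans (cong (if_then lookupT (unary (toℕ j)) h else ⟦ choose F H j ⟧ x []) (trans (substitute-correct F h x) eq₁))
             (lookup-dec j h))
  ... | false = trans (cong (⟦ F ⟧ x) (tabulate-cong value)) (chosen-correct H x e)
    where
    value : ∀ j → ⟦ choose F (h ∙ H) j ⟧ x [] ≡ ⟦ choose F H j ⟧ x []
    value j = trans (prefer-correct (lookupT (unary (toℕ j)) h) (substitute F h) (choose F H j) x)
      (cong (if_then lookupT (unary (toℕ j)) h else ⟦ choose F H j ⟧ x []) (trans (substitute-correct F h x) eq₁))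

  isSkolem : ∀ H → (∀ x y → ⟦ F ⟧ x y ≡ true → coversF F x H ≡ true) →
             IsSkolem F (map ⟦_⟧ᶜ (circuits F H))
  isSkolem H covering x = mk⇔
    (λ { (y , e) → trans (cong (⟦ F ⟧ x) at≡) (chosen-correct H x (covering x y e)) })
    (λ e → _ , e)
    where
    at≡ : map ⟦_⟧ᶜ (circuits F H) at x ≡ chosen F H x
    at≡ = trans (tabulate-at (circuit F H) x) (tabulate-cong (λ j → circuit-correct F H j x))

  -- Applied to the image of the given Skolem functions, this is the tuple `u*`.
  concat : (ys : List (Vec Bool m)) → Vec Bool (length ys * m)
  concat []       = []
  concat (y ∷ ys) = y Vec.++ concat ys

  concat-covers : ∀ ys x y → y ∈ ys → ⟦ F ⟧ x y ≡ true →
    coversF F x (chopT (unary (length ys)) (unary m) (encBits (concat ys)) leaf) ≡ true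
  concat-covers (y ∷ ys) x _ (here refl) e
    rewrite ▹-++ y (concat ys) leaf | dec-▹ y (encBits (concat ys)) | e = refl
  concat-covers (y ∷ ys) x z (there p) e
    rewrite ▹-++ y (concat ys) leaf | drop-▹ y (encBits (concat ys)) =
      trans (cong (⟦ F ⟧ x (dec m (y ▹ encBits (concat ys))) ∨_) (concat-covers ys x z p e)) (∨-zeroʳ _)

  module _ {Ψ : Vec (BoolFun n) m} (skolem : IsSkolem F Ψ) (ys : List (Vec Bool m))
           (image : ∀ y → y ∈ ys ⇔ InImage F Ψ y) where

    open Algorithm F (length ys)

    -- Here `w` joins an input to a correct output. The input has an output, so `Ψ` sends it to a
    -- correct one, and that lies in the image.
    concat-correct : ∀ w → evalT F̂ (encBits w) (dropT (unary n) (encBits w)) ≡ true → correct w (concat ys) ≡ true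
    concat-correct w e = trans (covers≡ F (encBits w) (chop (encBits (concat ys)) leaf))
      (concat-covers ys x (Ψ at x) (Equivalence.from (image (Ψ at x)) (x , refl , Fx)) Fx)
      where
      x = dec n (encBits w)
      Fx : ⟦ F ⟧ x (Ψ at x) ≡ true
      Fx = Equivalence.to (skolem x) (_ , trans (sym (eval-dec F (encBits w) _)) e)

-- Cost of the functions of the synthesizer

size-unary : ∀ l → size (unary l) ≡ suc (l * 2)
size-unary zero    = refl
size-unary (suc l) = cong (2 +_) (size-unary l)

unary-mono : ∀ {a b} → a ≤ b → size (unary a) ≤ size (unary b)
unary-mono {b = b} z≤n = ≤-trans (s≤s z≤n) (len<size (unary b))
unary-mono (s≤s p) = s≤s (s≤s (unary-mono p))

feedᵛ : ∀ {A : Set} {n} → (A → List Bool → List Bool) → Vec A n → List Bool → List Bool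
feedᵛ feed []      r = r
feedᵛ feed (a ∷ u) r = feed a (feedᵛ feed u r)

feed₁ : ∀ {s} → Vec Bool s → List Bool → List Bool
feed₁ u r = toList u List.++ r

feed₂ : ∀ {s j} → Vec (Vec Bool s) j → List Bool → List Bool
feed₂ = feedᵛ feed₁

feed₃ : ∀ {s i j} → Vec (Vec (Vec Bool s) i) j → List Bool → List Bool
feed₃ = feedᵛ feed₂

gates : ∀ {n} → Formula n 0 → ℕ → ℕ
gates (con b)   d = suc d
gates (X i)     d = suc d
gates (neg F)   d = suc (gates F d)
gates (and F G) d = suc (gates G (gates F d))
gates (or F G)  d = suc (gates G (gates F d))

shift-gates : ∀ {n w} (F : Formula n 0) (i : Fin w) → toℕ (shift F i) ≡ gates F (toℕ i)
shift-gates (con b)   i = refl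
shift-gates (X _)     i = refl
shift-gates (neg F)   i = cong suc (shift-gates F i)
shift-gates (and F G) i = cong suc (trans (shift-gates G _) (cong (gates G) (shift-gates F i)))
shift-gates (or F G)  i = cong suc (trans (shift-gates G _) (cong (gates G) (shift-gates F i)))

gates-+ : ∀ {n} (F : Formula n 0) d → gates F d ≡ ∣ F ∣ + d
gates-+ (con b)   d = refl
gates-+ (X i)     d = refl
gates-+ (neg F)   d = cong suc (gates-+ F d)
gates-+ (and F G) d = cong suc (trans (gates-+ G _) (trans (cong (∣ G ∣ +_) (gates-+ F d)) (lemma ∣ F ∣ ∣ G ∣ d)))
  where
  lemma : ∀ a b d → b + (a + d) ≡ a + b + d
  lemma = solve-∀
gates-+ (or F G)  d = cong suc (trans (gates-+ G _) (trans (cong (∣ G ∣ +_) (gates-+ F d)) (lemma ∣ F ∣ ∣ G ∣ d)))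
  where
  lemma : ∀ a b d → b + (a + d) ≡ a + b + d
  lemma = solve-∀

≤-gates : ∀ {n} (F : Formula n 0) d → d ≤ gates F d
≤-gates F d = ≤-trans (m≤n+m d ∣ F ∣) (≤-reflexive (sym (gates-+ F d)))

-- All older wires move by the same amount, so input `k` is always at wire `d + k`. The program can
-- therefore carry the number `d` in place of `σ`.
gates-shift : ∀ {n w} (F : Formula n 0) d (i : Fin w) k → toℕ i ≡ d + k → toℕ (shift F i) ≡ gates F d + k
gates-shift F d i k e = trans (shift-gates F i) (trans (cong (gates F) e) (trans (gates-+ F (d + k))
  (trans (sym (+-assoc ∣ F ∣ d k)) (cong (_+ k) (sym (gates-+ F d))))))

module AlgorithmTime (M : ℕ) (2≤M : 2 ≤ M) where

  open VerifierTime oracle randᴼ M 2≤M public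

  add-spine⇓ : ∀ a b → addᶠ ⟨ unary a ∷ unary b ∷ [] ⟩⇓ unary (a + b) ∣ suc a ×P 20
  add-spine⇓ zero    b = last⇓ (case-leaf⇓ var⇓ var⇓)
  add-spine⇓ (suc a) b =
    tail⇓ (case-∙⇓ var⇓ (leaf⇓ ∙⇓ call⇓ (var⇓ ∷⇓ var⇓ ∷⇓ []⇓) (add-spine⇓ a b)))

  add⇓ : ∀ {a b} → suc a ≤ P 1 → addᶠ ⟨ unary a ∷ unary b ∷ [] ⟩⇓ unary (a + b) # 22
  add⇓ {a} {b} a< = flat⇓ a< (add-spine⇓ a b)

  mul-spine⇓ : ∀ a b → suc b ≤ P 1 → mulᶠ ⟨ unary a ∷ unary b ∷ [] ⟩⇓ unary (a * b) ∣ suc a ×P 40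
  mul-spine⇓ zero    b b< = last⇓ (case-leaf⇓ var⇓ leaf⇓)
  mul-spine⇓ (suc a) b b< =
    iterate⇓ (≤-reflexive (trans (+-identityʳ _) (+-identityʳ _)))
      (case-∙⇓ var⇓ (call⇓ (var⇓ ∷⇓ call⇓ (var⇓ ∷⇓ var⇓ ∷⇓ []⇓) (mul-spine⇓ a b b<) ∷⇓ []⇓) (add⇓ b<)))

  mul⇓ : ∀ {a b} → suc a ≤ P 1 → suc b ≤ P 1 → mulᶠ ⟨ unary a ∷ unary b ∷ [] ⟩⇓ unary (a * b) # 42
  mul⇓ {a} {b} a< b< = flat⇓ a< (mul-spine⇓ a b b<)

  row-spine⇓ : ∀ {s} (row : Vec Bool s) r →
    Runs (unary s ∷ []) (body randᴼ drawRowᶠ) (feed₁ row r) (encBits row) r 0 (suc s ×P 20)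
  row-spine⇓ []        r = last⇓ (case-leaf⇓ var⇓ leaf⇓)
  row-spine⇓ (b ∷ row) r = tail⇓ (case-∙⇓ var⇓ (toss⇓ ∙⇓ call⇓ (var⇓ ∷⇓ []⇓) (row-spine⇓ row r)))

  block-spine⇓ : ∀ {s j} (rows : Vec (Vec Bool s) j) r → suc s ≤ P 1 →
    Runs (unary j ∷ unary s ∷ []) (body randᴼ drawBlockᶠ) (feed₂ rows r) (encᵛ encBits rows) r 0 (suc j ×P 40)
  block-spine⇓ []           r s< = last⇓ (case-leaf⇓ var⇓ leaf⇓)
  block-spine⇓ (row ∷ rows) r s< =
    tail⇓ (case-∙⇓ var⇓ (call⇓ (var⇓ ∷⇓ []⇓) (flat⇓ s< (row-spine⇓ row _)) ∙⇓
                         call⇓ (var⇓ ∷⇓ var⇓ ∷⇓ []⇓) (block-spine⇓ rows r s<)))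

  pool-spine⇓ : ∀ {s j} (pool : Vec (Vec (Vec Bool s) s) j) r → suc s ≤ P 1 →
    Runs (unary j ∷ unary s ∷ []) (body randᴼ drawPoolᶠ) (feed₃ pool r) (encᵛ (encᵛ encBits) pool) r 0 (suc j ×P 60)
  pool-spine⇓ []           r s< = last⇓ (case-leaf⇓ var⇓ leaf⇓)
  pool-spine⇓ (blk ∷ pool) r s< =
    tail⇓ (case-∙⇓ var⇓ (call⇓ (var⇓ ∷⇓ var⇓ ∷⇓ []⇓) (flat⇓ s< (block-spine⇓ blk _ s<)) ∙⇓
                         call⇓ (var⇓ ∷⇓ var⇓ ∷⇓ []⇓) (pool-spine⇓ pool r s<)))

  -- The invariant survives a step because a bit taken from `l` adds at most four nodes to `s`. It
  -- bounds the queries, which are charged by their full size.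
  find-spine⇓ : ∀ l s {stuff} → l * 4 + size s ≤ P 1 → stuff ≼ →
    findᶠ ⟨ unary l ∷ s ∷ stuff ∷ [] ⟩⇓ findT l s stuff ∣ suc l ×P 40
  find-spine⇓ zero    s bits stuff≼ = last⇓ (case-leaf⇓ var⇓ var⇓)
  find-spine⇓ (suc l) s {stuff} bits stuff≼ =
    tail⇓ (case-∙⇓ var⇓ (call⇓
      (var⇓ ∷⇓ (ask⇓ (P-node {1} {3} l≼ (P-node {1} {1} s≼ (size≤ stuff≼)))
                     (var⇓ ∙⇓ (const⇓ tt ∙⇓ var⇓) ∙⇓ var⇓) ∙⇓ var⇓) ∷⇓ var⇓ ∷⇓ []⇓)
      (find-spine⇓ l (bool b ∙ s) bits′ stuff≼)))
    where
    b = oracle (unary l ∙ (tt ∙ s) ∙ stuff)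
    s≼ : size (tt ∙ s) ≤ P 1
    s≼ = ≤-trans (+-monoʳ-≤ 4 (m≤n+m (size s) (l * 4))) bits
    l≼ : size (unary l) ≤ P 1
    l≼ = ≤-trans (≤-reflexive (size-unary l))
           (≤-trans (s≤s (≤-trans (*-monoʳ-≤ l (s≤s (s≤s z≤n))) (≤-trans (m≤n+m (l * 4) 3) (m≤m+n _ (size s))))) bits)
    bits′ : l * 4 + size (bool b ∙ s) ≤ P 1
    bits′ = ≤-trans (+-monoʳ-≤ (l * 4) (s≤s (+-monoˡ-≤ (size s) (size-bool b))))
              (≤-trans (≤-reflexive (lemma (l * 4) (size s))) bits)
      where
      lemma : ∀ a b → a + (4 + b) ≡ 4 + (a + b)
      lemma = solve-∀

  find⇓ : ∀ {l stuff} → l * 4 + 1 ≤ P 1 → stuff ≼ → findᶠ ⟨ unary l ∷ leaf ∷ stuff ∷ [] ⟩⇓ findT l leaf stuff # 42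
  find⇓ {l} bits stuff≼ = flat⇓ (≤-trans (≤-trans (≤-reflexive (+-comm 1 l)) (+-monoˡ-≤ 1 (m≤m*n l 4))) bits)
                                (find-spine⇓ l leaf bits stuff≼)

  subst-size⇓ : ∀ {n m} (F : Formula n m) h → encFormula F ≼ →
    substᶠ ⟨ encFormula F ∷ h ∷ [] ⟩⇓ encFormula (substitute F h) ∣ size (encFormula F) ×P 60
  subst-size⇓ (con b) h F≼ = iterate⇓ z≤n (case-∙⇓ var⇓ (case-leaf⇓ var⇓ var⇓))
  subst-size⇓ (X i)   h F≼ = iterate⇓ z≤n (case-∙⇓ var⇓ (case-∙⇓ var⇓ (case-leaf⇓ var⇓ var⇓)))
  subst-size⇓ (Y j)   h F≼ =
    iterate⇓ z≤n (case-∙⇓ var⇓ (case-∙⇓ var⇓ (case-∙⇓ var⇓ (case-leaf⇓ var⇓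
      (leaf⇓ ∙⇓ call⇓ (var⇓ ∷⇓ var⇓ ∷⇓ []⇓) (lookup⇓ (≼-snd F≼)))))))
  subst-size⇓ (neg F) h F≼ =
    iterate⇓ (×P-mono 60 (m≤n+m _ (size (unary 3))))
      (case-∙⇓ var⇓ (case-∙⇓ var⇓ (case-∙⇓ var⇓ (case-∙⇓ var⇓ (case-leaf⇓ var⇓
        (const⇓ (unary 3) ∙⇓ call⇓ (var⇓ ∷⇓ var⇓ ∷⇓ []⇓) (subst-size⇓ F h (≼-snd F≼))))))))
  subst-size⇓ (and F G) h F≼ =
    iterate⇓ (two-calls 60 (unary 4) (encFormula F) (encFormula G))
      (case-∙⇓ var⇓ (case-∙⇓ var⇓ (case-∙⇓ var⇓ (case-∙⇓ var⇓ (case-∙⇓ var⇓ (case-leaf⇓ var⇓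
        (const⇓ (unary 4) ∙⇓
         call⇓ (Fst⇓ var⇓ ∷⇓ var⇓ ∷⇓ []⇓) (subst-size⇓ F h (≼-fst (≼-snd F≼))) ∙⇓
         call⇓ (Snd⇓ var⇓ ∷⇓ var⇓ ∷⇓ []⇓) (subst-size⇓ G h (≼-snd (≼-snd F≼))))))))))
  subst-size⇓ (or F G) h F≼ =
    iterate⇓ (two-calls 60 (unary 5) (encFormula F) (encFormula G))
      (case-∙⇓ var⇓ (case-∙⇓ var⇓ (case-∙⇓ var⇓ (case-∙⇓ var⇓ (case-∙⇓ var⇓ (case-∙⇓ var⇓
        (const⇓ (unary 5) ∙⇓
         call⇓ (Fst⇓ var⇓ ∷⇓ var⇓ ∷⇓ []⇓) (subst-size⇓ F h (≼-fst (≼-snd F≼))) ∙⇓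
         call⇓ (Snd⇓ var⇓ ∷⇓ var⇓ ∷⇓ []⇓) (subst-size⇓ G h (≼-snd (≼-snd F≼))))))))))

  substitute⇓ : ∀ {n m} {F : Formula n m} {h} → encFormula F ≼ →
    substᶠ ⟨ encFormula F ∷ h ∷ [] ⟩⇓ encFormula (substitute F h) # 62
  substitute⇓ F≼ = flat⇓ (size≤ F≼) (subst-size⇓ _ _ F≼)

  choose-spine⇓ : ∀ {n m} (F : Formula n m) H j → encFormula F ≼ → unary (toℕ j) ≼ →
    chooseᶠ ⟨ H ∷ unary (toℕ j) ∷ encFormula F ∷ [] ⟩⇓ encFormula (choose F H j) ∣ suc (len H) ×P 100
  choose-spine⇓ F leaf    j F≼ j≼ = last⇓ (case-leaf⇓ var⇓ (leaf⇓ ∙⇓ leaf⇓))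
  choose-spine⇓ F (h ∙ H) j F≼ j≼ =
    tail⇓ (case-∙⇓ var⇓ (if⇓ (call⇓ (var⇓ ∷⇓ var⇓ ∷⇓ []⇓) (lookup⇓ j≼))
      (λ e → value⇓ (cong (λ b → encFormula (prefer b (substitute F h) (choose F H j))) (sym e))
        (const⇓ (unary 4) ∙⇓ (const⇓ (unary 3) ∙⇓ call⇓ (var⇓ ∷⇓ var⇓ ∷⇓ []⇓) (substitute⇓ F≼)) ∙⇓
         call⇓ (var⇓ ∷⇓ var⇓ ∷⇓ var⇓ ∷⇓ []⇓) (choose-spine⇓ F H j F≼ j≼)))
      (λ e → value⇓ (cong (λ b → encFormula (prefer b (substitute F h) (choose F H j))) (sym e))
        (const⇓ (unary 5) ∙⇓ call⇓ (var⇓ ∷⇓ var⇓ ∷⇓ []⇓) (substitute⇓ F≼) ∙⇓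
         call⇓ (var⇓ ∷⇓ var⇓ ∷⇓ var⇓ ∷⇓ []⇓) (choose-spine⇓ F H j F≼ j≼)))))

  nested-calls : ∀ b g p q → (size p ×P b + 0) + size q ×P b ≤ (size g + size (p ∙ q)) ×P b
  nested-calls b g p q = ≤-trans (+-monoˡ-≤ (size q ×P b) (≤-reflexive (+-identityʳ (size p ×P b)))) (two-calls b g p q)

  -- The circuit of the second subformula is the continuation for the first and is computed before
  -- it.
  swapped-calls : ∀ b g p q → (size q ×P b + 0) + size p ×P b ≤ (size g + size (p ∙ q)) ×P b
  swapped-calls b g p q =
    ≤-trans (≤-reflexive (trans (cong (_+ size p ×P b) (+-identityʳ (size q ×P b))) (+-comm (size q ×P b) (size p ×P b))))
            (two-calls b g p q)

  gates-size⇓ : ∀ {n} (F : Formula n 0) d →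
    gatesᶠ ⟨ encFormula F ∷ unary d ∷ [] ⟩⇓ unary (gates F d) ∣ size (encFormula F) ×P 40
  gates-size⇓ (con b) d = iterate⇓ z≤n (case-∙⇓ var⇓ (case-leaf⇓ var⇓ (leaf⇓ ∙⇓ var⇓)))
  gates-size⇓ (X i)   d = iterate⇓ z≤n (case-∙⇓ var⇓ (case-∙⇓ var⇓ (case-leaf⇓ var⇓ (leaf⇓ ∙⇓ var⇓))))
  gates-size⇓ (neg F) d =
    iterate⇓ (×P-mono 40 (m≤n+m _ (size (unary 3))))
      (case-∙⇓ var⇓ (case-∙⇓ var⇓ (case-∙⇓ var⇓ (case-∙⇓ var⇓ (case-leaf⇓ var⇓
        (leaf⇓ ∙⇓ call⇓ (var⇓ ∷⇓ var⇓ ∷⇓ []⇓) (gates-size⇓ F d)))))))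
  gates-size⇓ (and F G) d =
    iterate⇓ (nested-calls 40 (unary 4) (encFormula F) (encFormula G))
      (case-∙⇓ var⇓ (case-∙⇓ var⇓ (case-∙⇓ var⇓ (case-∙⇓ var⇓ (case-∙⇓ var⇓
        (leaf⇓ ∙⇓ call⇓ (Snd⇓ var⇓ ∷⇓ call⇓ (Fst⇓ var⇓ ∷⇓ var⇓ ∷⇓ []⇓) (gates-size⇓ F d) ∷⇓ []⇓)
                        (gates-size⇓ G (gates F d))))))))
  gates-size⇓ (or F G) d =
    iterate⇓ (nested-calls 40 (unary 5) (encFormula F) (encFormula G))
      (case-∙⇓ var⇓ (case-∙⇓ var⇓ (case-∙⇓ var⇓ (case-∙⇓ var⇓ (case-∙⇓ var⇓
        (leaf⇓ ∙⇓ call⇓ (Snd⇓ var⇓ ∷⇓ call⇓ (Fst⇓ var⇓ ∷⇓ var⇓ ∷⇓ []⇓) (gates-size⇓ F d) ∷⇓ []⇓)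
                        (gates-size⇓ G (gates F d))))))))

  gates⇓ : ∀ {n} (F : Formula n 0) d → encFormula F ≼ → gatesᶠ ⟨ encFormula F ∷ unary d ∷ [] ⟩⇓ unary (gates F d) # 42
  gates⇓ F d F≼ = flat⇓ (size≤ F≼) (gates-size⇓ F d)

  compile-size⇓ : ∀ {n w} (F : Formula n 0) (σ : Fin n → Fin w) d c → (∀ i → toℕ (σ i) ≡ d + toℕ i) →
    encFormula F ≼ → suc (gates F d) ≤ P 1 →
    compileᶠ ⟨ encFormula F ∷ unary d ∷ encCircuit c ∷ [] ⟩⇓ encCircuit (compile F σ c) ∣ size (encFormula F) ×P 100
  compile-size⇓ (con b) σ d c σ≡ F≼ d≤ =
    iterate⇓ z≤n (case-∙⇓ var⇓ (case-leaf⇓ var⇓ (const⇓ (unary 1) ∙⇓ (leaf⇓ ∙⇓ var⇓) ∙⇓ var⇓)))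
  compile-size⇓ (X i) σ d c σ≡ F≼ d≤ =
    iterate⇓ z≤n (case-∙⇓ var⇓ (case-∙⇓ var⇓ (case-leaf⇓ var⇓
      (bind⇓ (value⇓ (cong unary (sym (σ≡ i))) (call⇓ (var⇓ ∷⇓ var⇓ ∷⇓ []⇓) (add⇓ {d} {toℕ i} (≤-trans (n≤1+n _) d≤))))
        (const⇓ (unary 1) ∙⇓ (const⇓ (unary 2) ∙⇓ var⇓ ∙⇓ var⇓) ∙⇓ var⇓)))))
  compile-size⇓ (neg F) σ d c σ≡ F≼ d≤ =
    iterate⇓ (×P-mono 100 (m≤n+m _ (size (unary 3))))
      (case-∙⇓ var⇓ (case-∙⇓ var⇓ (case-∙⇓ var⇓ (case-∙⇓ var⇓ (case-leaf⇓ var⇓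
        (call⇓ (var⇓ ∷⇓ var⇓ ∷⇓ (const⇓ (unary 1) ∙⇓ (const⇓ (unary 1) ∙⇓ leaf⇓) ∙⇓ var⇓) ∷⇓ []⇓)
          (compile-size⇓ F σ d (gate (neg zero) c) σ≡ (≼-snd F≼) (≤-trans (n≤1+n _) d≤))))))))
  compile-size⇓ (and F G) σ d c σ≡ F≼ d≤ =
    iterate⇓ (swapped-calls 100 (unary 4) (encFormula F) (encFormula G))
      (case-∙⇓ var⇓ (case-∙⇓ var⇓ (case-∙⇓ var⇓ (case-∙⇓ var⇓ (case-∙⇓ var⇓ (case-leaf⇓ var⇓
        (call⇓ (Fst⇓ var⇓ ∷⇓ var⇓ ∷⇓
          call⇓ (Snd⇓ var⇓ ∷⇓ call⇓ (Fst⇓ var⇓ ∷⇓ var⇓ ∷⇓ []⇓) (gates⇓ F d F≼′) ∷⇓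
                 (const⇓ (unary 1) ∙⇓ (const⇓ (unary 2) ∙⇓ leaf⇓ ∙⇓
                    value⇓ (cong unary (sym (shift-gates G zero))) (call⇓ (Snd⇓ var⇓ ∷⇓ leaf⇓ ∷⇓ []⇓) (gates⇓ G 0 G≼))) ∙⇓ var⇓)
                 ∷⇓ []⇓)
            (compile-size⇓ G (shift F ∘ σ) (gates F d) (gate (and zero (shift G zero)) c)
              (λ i → gates-shift F d (σ i) (toℕ i) (σ≡ i)) G≼ (≤-trans (n≤1+n _) d≤)) ∷⇓ []⇓)
          (compile-size⇓ F σ d _ σ≡ F≼′ (≤-trans (s≤s (≤-gates G (gates F d))) (≤-trans (n≤1+n _) d≤))))))))))
    where
    F≼′ = ≼-fst (≼-snd F≼)
    G≼ = ≼-snd (≼-snd F≼)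
  compile-size⇓ (or F G) σ d c σ≡ F≼ d≤ =
    iterate⇓ (swapped-calls 100 (unary 5) (encFormula F) (encFormula G))
      (case-∙⇓ var⇓ (case-∙⇓ var⇓ (case-∙⇓ var⇓ (case-∙⇓ var⇓ (case-∙⇓ var⇓ (case-∙⇓ var⇓
        (call⇓ (Fst⇓ var⇓ ∷⇓ var⇓ ∷⇓
          call⇓ (Snd⇓ var⇓ ∷⇓ call⇓ (Fst⇓ var⇓ ∷⇓ var⇓ ∷⇓ []⇓) (gates⇓ F d F≼′) ∷⇓
                 (const⇓ (unary 1) ∙⇓ (const⇓ (unary 3) ∙⇓ leaf⇓ ∙⇓
                    value⇓ (cong unary (sym (shift-gates G zero))) (call⇓ (Snd⇓ var⇓ ∷⇓ leaf⇓ ∷⇓ []⇓) (gates⇓ G 0 G≼))) ∙⇓ var⇓)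
                 ∷⇓ []⇓)
            (compile-size⇓ G (shift F ∘ σ) (gates F d) (gate (or zero (shift G zero)) c)
              (λ i → gates-shift F d (σ i) (toℕ i) (σ≡ i)) G≼ (≤-trans (n≤1+n _) d≤)) ∷⇓ []⇓)
          (compile-size⇓ F σ d _ σ≡ F≼′ (≤-trans (s≤s (≤-gates G (gates F d))) (≤-trans (n≤1+n _) d≤))))))))))
    where
    F≼′ = ≼-fst (≼-snd F≼)
    G≼ = ≼-snd (≼-snd F≼)

  -- The embedding `f` permits induction on the number of remaining outputs while their indices stay
  -- in `Fin m`.
  circuits-spine⇓ : ∀ {n m} (F : Formula n m) H l (f : Fin l → Fin m) j → (∀ i → toℕ (f i) ≡ j + toℕ i) →
    encFormula F ≼ → unary m ≼ → Short H →
    (∀ j → size (encFormula (choose F H j)) ≤ P 1) → (∀ j → suc (gates (choose F H j) 0) ≤ P 1) →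
    circuitsᶠ ⟨ unary l ∷ unary j ∷ encFormula F ∷ H ∷ [] ⟩⇓ encCircuits (tabulate (circuit F H ∘ f)) ∣ suc l ×P 140
  circuits-spine⇓ F H zero    f j f≡ F≼ m≼ H≤ φ≼ g≤ = last⇓ (case-leaf⇓ var⇓ leaf⇓)
  circuits-spine⇓ F H (suc l) f j f≡ F≼ m≼ H≤ φ≼ g≤ =
    tail⇓ (case-∙⇓ var⇓
      (call⇓ (call⇓ (var⇓ ∷⇓ value⇓ (cong unary (sym j≡)) var⇓ ∷⇓ var⇓ ∷⇓ []⇓)
                (flat⇓ (len≤ H≤) (choose-spine⇓ F H (f zero) F≼ j≼))
              ∷⇓ leaf⇓ ∷⇓ (leaf⇓ ∙⇓ leaf⇓) ∷⇓ []⇓)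
        (flat⇓ (φ≼ (f zero)) (compile-size⇓ (choose F H (f zero)) (λ i → i) 0 (output zero) (λ i → refl)
          (small (φ≼ (f zero))) (g≤ (f zero))))
       ∙⇓ call⇓ (var⇓ ∷⇓ (leaf⇓ ∙⇓ var⇓) ∷⇓ var⇓ ∷⇓ var⇓ ∷⇓ []⇓)
            (circuits-spine⇓ F H l (f ∘ suc) (suc j) (λ i → trans (f≡ (suc i)) (+-suc j (toℕ i))) F≼ m≼ H≤ φ≼ g≤)))
    where
    j≡ : toℕ (f zero) ≡ j
    j≡ = trans (f≡ zero) (+-identityʳ j)
    j≼ : unary (toℕ (f zero)) ≼
    j≼ = small (≤-trans (unary-mono (<⇒≤ (toℕ<n (f zero)))) (size≤ m≼))

  circuits⇓ : ∀ {n m} (F : Formula n m) H → encFormula F ≼ → unary m ≼ → Short H →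
    (∀ j → size (encFormula (choose F H j)) ≤ P 1) → (∀ j → suc (gates (choose F H j) 0) ≤ P 1) →
    circuitsᶠ ⟨ unary m ∷ leaf ∷ encFormula F ∷ H ∷ [] ⟩⇓ encCircuits (circuits F H) # 142
  circuits⇓ {m = m} F H F≼ m≼ H≤ φ≼ g≤ =
    flat⇓ (subst (λ l → suc l ≤ P 1) (len-unary m) (len≼ m≼))
          (circuits-spine⇓ F H m (λ j → j) 0 (λ j → refl) F≼ m≼ H≤ φ≼ g≤)

-- Rounds and attempts

result : ∀ {n m} → Formula n m → Maybe Tree → Tree
result F nothing  = leaf
result F (just H) = leaf ∙ encCircuits (circuits F H)

module Attempts {n m : ℕ} (F : Formula n m) where

  -- One pool for each of the attempts `K` to `K + i`, set aside in advance; a success leaves the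
  -- later ones untouched.
  Pools : ℕ → ℕ → Set
  Pools K zero    = Algorithm.Pool F K
  Pools K (suc i) = Algorithm.Pool F K × Pools (suc K) i

  coins : ∀ K i → Pools K i → List Bool → List Bool
  coins K zero    pool         r = feed₃ pool r
  coins K (suc i) (pool , rest) r = feed₃ pool (coins (suc K) i rest r)

  -- Speaks of the last attempt alone. A success before it is sound anyway and only shortens the
  -- run.
  Succeeds : ∀ K i → Pools K i → Set
  Succeeds K zero    pool       = ∃[ H ] Algorithm.rounds F K (suc (K * m)) [] pool ≡ just H
  Succeeds K (suc i) (_ , rest) = Succeeds (suc K) i rest

  Covering : Tree → Set
  Covering H = ∀ x y → ⟦ F ⟧ x y ≡ true → coversF F x H ≡ true

module RoundTime (M : ℕ) (2≤M : 2 ≤ M) {n m : ℕ} (F : Formula n m) where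

  open AlgorithmTime M 2≤M public
  open Attempts F public

  -- All sizes met in an attempt, collected as assumptions, so that running times can be derived
  -- before `M` is chosen.
  record Fits (K : ℕ) : Set where
    open Algorithm F K
    field
      F≼         : F̂ ≼
      n<         : suc n ≤ P 1
      m≼         : unary m ≼
      K≼         : unary K ≼
      input-bits : ν * 4 + 1 ≤ P 1
      tuple-bits : N * 4 + 1 ≤ P 1
      s<         : suc (suc N) ≤ P 1
      volume<    : suc ((2 + ν) * (2 + N)) ≤ P 1
      pool<      : suc (poolSize N ν) ≤ P 1
      tuples≼    : ∀ S → length S ≤ N → ∀ {j} → j ≤ suc N → (rows : Vec (Vec Bool (suc N)) j) → tuples S rows ≼
      uncovered≼ : ∀ S pool → uncovered (hypothesis S pool) ≼
      choose≼    : ∀ S pool j → size (encFormula (choose F (hypothesis S pool) j)) ≤ P 1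
      output≼    : ∀ S pool → size (encCircuits (circuits F (hypothesis S pool))) ≤ P 1
      gates≤     : ∀ S pool j → suc (gates (choose F (hypothesis S pool) j) 0) ≤ P 1

  module _ {K : ℕ} (fits : Fits K) where

    open Algorithm F K
    open Fits fits

    chop-unary⇓ : ∀ {t acc} → chopᶠ ⟨ unary K ∷ unary m ∷ t ∷ acc ∷ [] ⟩⇓ chop t acc # 42
    chop-unary⇓ = chop⇓ K≼ m≼

    m< : suc m ≤ P 1
    m< = subst (λ l → suc l ≤ P 1) (len-unary m) (len≼ m≼)

    K< : suc K ≤ P 1
    K< = subst (λ l → suc l ≤ P 1) (len-unary K) (len≼ K≼)

    sample-spine⇓ : ∀ S → length S ≤ N → ∀ {j} → j ≤ suc N → (rows : Vec (Vec Bool (suc N)) j) → ∀ acc →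
      sampleᶠ ⟨ encᵛ encBits rows ∷ unary N ∷ shared S ∷ acc ∷ [] ⟩⇓ sampleT S rows acc ∣ suc j ×P 80
    sample-spine⇓ S S≤ j≤ [] acc =
      last⇓ (bind⇓ (call⇓ (Fst⇓ (Snd⇓ var⇓) ∷⇓ Snd⇓ (Snd⇓ var⇓) ∷⇓
          call⇓ (var⇓ ∷⇓ leaf⇓ ∷⇓ (leaf⇓ ∙⇓ var⇓ ∙⇓ var⇓) ∷⇓ []⇓) (find⇓ tuple-bits (tuples≼ S S≤ j≤ [])) ∷⇓ var⇓ ∷⇓ []⇓) chop-unary⇓)
        (case-leaf⇓ var⇓ var⇓))
    sample-spine⇓ S S≤ j≤ (row ∷ rows) acc =
      tail⇓ (bind⇓ (call⇓ (Fst⇓ (Snd⇓ var⇓) ∷⇓ Snd⇓ (Snd⇓ var⇓) ∷⇓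
          call⇓ (var⇓ ∷⇓ leaf⇓ ∷⇓ (leaf⇓ ∙⇓ var⇓ ∙⇓ var⇓) ∷⇓ []⇓) (find⇓ tuple-bits (tuples≼ S S≤ j≤ (row ∷ rows))) ∷⇓ var⇓ ∷⇓ []⇓) chop-unary⇓)
        (case-∙⇓ var⇓ (call⇓ (var⇓ ∷⇓ var⇓ ∷⇓ var⇓ ∷⇓ var⇓ ∷⇓ []⇓)
          (sample-spine⇓ S S≤ (≤-trans (n≤1+n _) j≤) rows (chop (findT N leaf (tuples S (row ∷ rows))) acc)))))

    samples-spine⇓ : ∀ S → length S ≤ N → ∀ {R} (pool : Vec Block R) acc →
      samplesᶠ ⟨ encᵛ (encᵛ encBits) pool ∷ unary N ∷ shared S ∷ acc ∷ [] ⟩⇓ samplesT S pool acc ∣ suc R ×P 100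
    samples-spine⇓ S S≤ []           acc = last⇓ (case-leaf⇓ var⇓ var⇓)
    samples-spine⇓ S S≤ (blk ∷ pool) acc =
      tail⇓ (case-∙⇓ var⇓ (call⇓ (var⇓ ∷⇓ var⇓ ∷⇓ var⇓ ∷⇓
        call⇓ (var⇓ ∷⇓ var⇓ ∷⇓ var⇓ ∷⇓ var⇓ ∷⇓ []⇓) (flat⇓ s< (sample-spine⇓ S S≤ ≤-refl blk acc)) ∷⇓ []⇓)
        (samples-spine⇓ S S≤ pool (sampleT S blk acc))))

    rounds-spine⇓ : ∀ f S pool → length S + f ≡ suc N →
      roundsᶠ ⟨ unary f ∷ encᴸ S ∷ encᵛ (encᵛ encBits) pool ∷ unary N ∷ F̂ ∷ unary n ∷ unary m ∷ unary K ∷ [] ⟩⇓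
        result F (rounds f S pool) ∣ suc f ×P 180
    rounds-spine⇓ zero    S pool l = last⇓ (case-leaf⇓ var⇓ leaf⇓)
    rounds-spine⇓ (suc f) S pool l =
      tail⇓ (case-∙⇓ var⇓
        (bind⇓ (call⇓ (var⇓ ∷⇓ var⇓ ∷⇓ ((var⇓ ∙⇓ var⇓) ∙⇓ var⇓ ∙⇓ var⇓) ∷⇓ leaf⇓ ∷⇓ []⇓)
                 (flat⇓ pool< (samples-spine⇓ S S≤ pool leaf)))
        (bind⇓ (const⇓ tt ∙⇓ var⇓ ∙⇓ var⇓ ∙⇓ var⇓)
        (bind⇓ (call⇓ (call⇓ (var⇓ ∷⇓ var⇓ ∷⇓ []⇓) (add⇓ {n} {m} n<) ∷⇓ leaf⇓ ∷⇓ var⇓ ∷⇓ []⇓)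
                 (find⇓ {ν} input-bits (uncovered≼ S pool)))
          (if⇓ (ask⇓ (P-node {1} {3} (1≤P 1) (P-node {1} {1} w≼ (size≤ (uncovered≼ S pool)))) (leaf⇓ ∙⇓ var⇓ ∙⇓ var⇓))
            (λ e → value⇓ (cong branch (sym e))
              (upD⇓ z≤n (leaf⇓ ∙⇓ call⇓ (var⇓ ∷⇓ leaf⇓ ∷⇓ var⇓ ∷⇓ var⇓ ∷⇓ []⇓)
                (circuits⇓ F H F≼ m≼ H-short (choose≼ S pool) (gates≤ S pool)))))
            (λ e → value⇓ (cong branch (sym e))
              (call⇓ (var⇓ ∷⇓ value⇓ (cong (_∙ encᴸ S) (counterexample-bits H)) (var⇓ ∙⇓ var⇓) ∷⇓ var⇓ ∷⇓ var⇓ ∷⇓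
                      var⇓ ∷⇓ var⇓ ∷⇓ var⇓ ∷⇓ var⇓ ∷⇓ []⇓)
                (rounds-spine⇓ f (x ∷ S) pool (trans (sym (+-suc (length S) f)) l)))))))))
      where
      H = hypothesis S pool
      x = dec ν (counterexample H)
      branch : Bool → Tree
      branch b = result F (if b then rounds f (x ∷ S) pool else just H)
      S≤ : length S ≤ N
      S≤ = ≤-trans (m≤m+n (length S) f) (≤-reflexive (suc-injective (trans (sym (+-suc (length S) f)) l)))
      w≼ : size (counterexample H) ≤ P 1
      w≼ = ≤-trans (≤-trans (≤-reflexive (cong size (counterexample-bits H))) (size-▹ x leaf)) input-bits
      H-short : Short H
      H-short = ≼-short (≼-snd (≼-snd (≼-snd (uncovered≼ S pool))))

    rounds⇓ : ∀ pool →
      roundsᶠ ⟨ unary (suc N) ∷ leaf ∷ encᵛ (encᵛ encBits) pool ∷ unary N ∷ F̂ ∷ unary n ∷ unary m ∷ unary K ∷ [] ⟩⇓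
        result F (rounds (suc N) [] pool) # 182
    rounds⇓ pool = flat⇓ s< (rounds-spine⇓ (suc N) [] pool refl)

  Loops : ℕ → List Bool → Tree → List Bool → ℕ → Set
  Loops K r t r′ i =
    Runs (unary K ∷ unary n ∷ unary m ∷ encFormula F ∷ []) (body randᴼ loopᶠ) r t r′ 0 (suc i ×P 260)

  module _ {K : ℕ} (fits : Fits K) where

    open Algorithm F K
    open Fits fits

    2+ν< : suc (2 + ν) ≤ P 1
    2+ν< = ≤-trans (s≤s (m≤m*n (2 + ν) (2 + N))) volume<

    2+N< : suc (2 + N) ≤ P 1
    2+N< = ≤-trans (s≤s (m≤n*m (2 + N) (2 + ν))) volume<

    17≤P : 17 ≤ P 1
    17≤P = ≤-trans (s≤s (*-monoʳ-≤ 16 {1} {(2 + ν) * (2 + N)} (s≤s z≤n))) pool<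

    halt⇓ : ∀ i pool r {H} → rounds (suc N) [] pool ≡ just H → Loops K (feed₃ pool r) (encCircuits (circuits F H)) r i
    halt⇓ i pool r e =
      iterate⇓ z≤n
        (bind⇓ (call⇓ (var⇓ ∷⇓ var⇓ ∷⇓ []⇓) (mul⇓ {K} {m} (K< fits) (m< fits)))
        (bind⇓ (call⇓ (call⇓ (const⇓ (unary 16) ∷⇓
                  call⇓ ((leaf⇓ ∙⇓ leaf⇓ ∙⇓ call⇓ (var⇓ ∷⇓ var⇓ ∷⇓ []⇓) (add⇓ {n} {m} n<)) ∷⇓
                         (leaf⇓ ∙⇓ leaf⇓ ∙⇓ var⇓) ∷⇓ []⇓) (mul⇓ {2 + ν} {2 + N} 2+ν< 2+N<) ∷⇓ []⇓)
                  (mul⇓ {16} {(2 + ν) * (2 + N)} 17≤P volume<) ∷⇓ (leaf⇓ ∙⇓ var⇓) ∷⇓ []⇓)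
                (flat⇓ pool< (pool-spine⇓ pool r s<)))
        (case-∙⇓ (value⇓ (cong (result F) e)
            (call⇓ ((leaf⇓ ∙⇓ var⇓) ∷⇓ leaf⇓ ∷⇓ var⇓ ∷⇓ var⇓ ∷⇓ var⇓ ∷⇓ var⇓ ∷⇓ var⇓ ∷⇓ var⇓ ∷⇓ []⇓) (rounds⇓ fits pool)))
          var⇓)))

  continue⇓ : ∀ {K} (fits : Fits K) i pool {r t r′} →
    Algorithm.rounds F K (suc (K * m)) [] pool ≡ nothing →
    Loops (suc K) r t r′ i → Loops K (feed₃ pool r) t r′ (suc i)
  continue⇓ {K} fits i pool {r} e next =
    tail⇓
      (bind⇓ (call⇓ (var⇓ ∷⇓ var⇓ ∷⇓ []⇓) (mul⇓ {K} {m} (K< fits) (m< fits)))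
      (bind⇓ (call⇓ (call⇓ (const⇓ (unary 16) ∷⇓
                call⇓ ((leaf⇓ ∙⇓ leaf⇓ ∙⇓ call⇓ (var⇓ ∷⇓ var⇓ ∷⇓ []⇓) (add⇓ {n} {m} n<)) ∷⇓
                       (leaf⇓ ∙⇓ leaf⇓ ∙⇓ var⇓) ∷⇓ []⇓) (mul⇓ {2 + ν} {2 + N} (2+ν< fits) (2+N< fits)) ∷⇓ []⇓)
                (mul⇓ {16} {(2 + ν) * (2 + N)} (17≤P fits) volume<) ∷⇓ (leaf⇓ ∙⇓ var⇓) ∷⇓ []⇓)
              (flat⇓ pool< (pool-spine⇓ pool r s<)))
      (case-leaf⇓ (value⇓ (cong (result F) e)
          (call⇓ ((leaf⇓ ∙⇓ var⇓) ∷⇓ leaf⇓ ∷⇓ var⇓ ∷⇓ var⇓ ∷⇓ var⇓ ∷⇓ var⇓ ∷⇓ var⇓ ∷⇓ var⇓ ∷⇓ []⇓) (rounds⇓ fits pool)))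
        (call⇓ ((leaf⇓ ∙⇓ var⇓) ∷⇓ var⇓ ∷⇓ var⇓ ∷⇓ var⇓ ∷⇓ []⇓) next))))
    where
    open Algorithm F K using (N; ν)
    open Fits fits

  Synthesized : ℕ → List Bool → ℕ → Set
  Synthesized K r i = ∃[ H ] ∃[ r′ ] (Covering H × size (encCircuits (circuits F H)) ≤ P 1
                                      × Loops K r (encCircuits (circuits F H)) r′ i)

  stop : ∀ {K} → Fits K → ∀ i pool r {H} →
         Algorithm.rounds F K (suc (K * m)) [] pool ≡ just H → Synthesized K (feed₃ pool r) i
  stop {K} fits i pool r {H} e =
    let S , e′ = rounds-hypothesis (suc N) [] pool H e
    in H , r , rounds-sound (suc N) [] pool H e ,
       subst (λ H → size (encCircuits (circuits F H)) ≤ P 1) e′ (Fits.output≼ fits S pool) ,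
       halt⇓ fits i pool r e
    where open Algorithm F K

  loop⇓ : ∀ i K → (∀ j → j ≤ K + i → Fits j) → ∀ pools r → Succeeds K i pools → Synthesized K (coins K i pools r) i
  loop⇓ zero    K fits pool r (H , e) = stop (fits K (m≤m+n K 0)) 0 pool r e
  loop⇓ (suc i) K fits (pool , pools) r s with Algorithm.rounds F K (suc (K * m)) [] pool in e
  ... | just H  = stop (fits K (m≤m+n K (suc i))) (suc i) pool _ e
  ... | nothing =
    let H , r′ , covering , out≤ , runs⇓ = loop⇓ i (suc K) (λ j j≤ → fits j (≤-trans j≤ (≤-reflexive (sym (+-suc K i))))) pools r s
    in H , r′ , covering , out≤ , continue⇓ (fits K (m≤m+n K (suc i))) i pool e runs⇓

-- Uniform sampling from coin tosses

∑-++ : ∀ a b (f : Vec Bool (a + b) → ℕ) → ∑ⁿ (a + b) f ≡ ∑ⁿ a (λ u → ∑ⁿ b (λ w → f (u Vec.++ w)))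
∑-++ zero    b f = refl
∑-++ (suc a) b f = cong₂ _+_ (∑-++ a b (f ∘ (false ∷_))) (∑-++ a b (f ∘ (true ∷_)))

take-++ : ∀ {a b} (u : Vec Bool a) (w : Vec Bool b) → Vec.take a (u Vec.++ w) ≡ u
take-++ []      w = refl
take-++ (b ∷ u) w = cong (b ∷_) (take-++ u w)

drop-++ : ∀ {a b} (u : Vec Bool a) (w : Vec Bool b) → Vec.drop a (u Vec.++ w) ≡ w
drop-++ []      w = refl
drop-++ (b ∷ u) w = drop-++ u w

feed-split : ∀ a {b} (u : Vec Bool (a + b)) r → feed₁ u r ≡ feed₁ (Vec.take a u) (feed₁ (Vec.drop a u) r)
feed-split zero    u       r = refl
feed-split (suc a) (b ∷ u) r = cong (b ∷_) (feed-split a u r)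

-- A uniformly distributed A, read off width coin tosses.

record Sampler (A : Set) : Set where
  field
    width       : ℕ
    sum         : Sum A
    isSum       : IsSum sum
    decode      : Vec Bool width → A
    feed        : A → List Bool → List Bool
    sum-decode  : ∀ f → ∑ⁿ width (f ∘ decode) ≡ sum f
    feed-decode : ∀ u r → feed₁ u r ≡ feed (decode u) r

open Sampler public

bitsˢ : ∀ n → Sampler (Vec Bool n)
bitsˢ n = record
  { width = n ; sum = ∑ⁿ n ; isSum = ∑ⁿ-isSum n ; decode = λ u → u ; feed = feed₁
  ; sum-decode = λ f → refl ; feed-decode = λ u r → refl }

sum-pair : ∀ {A B C : Set} (SA : Sampler A) (SB : Sampler B) (k : A → B → C) (f : C → ℕ) →
  ∑ⁿ (width SA + width SB) (λ u → f (k (decode SA (Vec.take (width SA) u)) (decode SB (Vec.drop (width SA) u)))) ≡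
  sum SA (λ a → sum SB (λ b → f (k a b)))
sum-pair SA SB k f =
  trans (∑-++ (width SA) (width SB) _)
  (trans (ext (∑ⁿ-isSum (width SA)) (λ u →
      trans (ext (∑ⁿ-isSum (width SB)) (λ w → cong₂ (λ a b → f (k (decode SA a) (decode SB b))) (take-++ u w) (drop-++ u w)))
            (sum-decode SB (λ b → f (k (decode SA u) b)))))
    (sum-decode SA (λ a → sum SB (λ b → f (k a b)))))

feed-pair : ∀ {A B : Set} (SA : Sampler A) (SB : Sampler B) u r → feed₁ u r ≡
  feed SA (decode SA (Vec.take (width SA) u)) (feed SB (decode SB (Vec.drop (width SA) u)) r)
feed-pair SA SB u r =
  trans (feed-split (width SA) u r)
  (trans (feed-decode SA _ _) (cong (feed SA _) (feed-decode SB (Vec.drop (width SA) u) r)))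

vecˢ : ∀ {A} → Sampler A → ∀ n → Sampler (Vec A n)
vecˢ {A} SA n = record
  { width = n * width SA ; sum = ∑ᵛ (sum SA) n ; isSum = ∑ᵛ-isSum (isSum SA) n
  ; decode = decodeᵛ n ; feed = feedᵛ (feed SA) ; sum-decode = sum-decodeᵛ n ; feed-decode = feed-decodeᵛ n }
  where
  decodeᵛ : ∀ n → Vec Bool (n * width SA) → Vec A n
  decodeᵛ zero    u = []
  decodeᵛ (suc n) u = decode SA (Vec.take (width SA) u) ∷ decodeᵛ n (Vec.drop (width SA) u)

  sum-decodeᵛ : ∀ n f → ∑ⁿ (n * width SA) (f ∘ decodeᵛ n) ≡ ∑ᵛ (sum SA) n f
  sum-decodeᵛ zero    f = refl
  sum-decodeᵛ (suc n) f =
    trans (∑-++ (width SA) (n * width SA) _)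
    (trans (ext (∑ⁿ-isSum (width SA)) (λ u →
        trans (ext (∑ⁿ-isSum (n * width SA))
                 (λ w → cong₂ (λ a b → f (decode SA a ∷ decodeᵛ n b)) (take-++ u w) (drop-++ u w)))
              (sum-decodeᵛ n (λ b → f (decode SA u ∷ b)))))
      (sum-decode SA (λ a → ∑ᵛ (sum SA) n (λ b → f (a ∷ b)))))

  feed-decodeᵛ : ∀ n u r → feed₁ u r ≡ feedᵛ (feed SA) (decodeᵛ n u) r
  feed-decodeᵛ zero    [] r = refl
  feed-decodeᵛ (suc n) u  r =
    trans (feed-split (width SA) u r)
    (trans (feed-decode SA _ _) (cong (feed SA _) (feed-decodeᵛ n (Vec.drop (width SA) u) r)))

pairˢ : ∀ {A B} → Sampler A → Sampler B → Sampler (A × B)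
pairˢ SA SB = record
  { width = width SA + width SB
  ; sum = λ f → sum SA (λ a → sum SB (λ b → f (a , b)))
  ; isSum = record
    { mono  = λ f≤g → mono (isSum SA) (λ a → mono (isSum SB) (λ b → f≤g (a , b)))
    ; plus  = λ f g → trans (ext (isSum SA) (λ a → plus (isSum SB) _ _)) (plus (isSum SA) _ _)
    ; scale = λ c f → trans (ext (isSum SA) (λ a → scale (isSum SB) c _)) (scale (isSum SA) c _)
    }
  ; decode = λ u → decode SA (Vec.take (width SA) u) , decode SB (Vec.drop (width SA) u)
  ; feed = λ (a , b) r → feed SA a (feed SB b r)
  ; sum-decode = sum-pair SA SB _,_
  ; feed-decode = feed-pair SA SB
  }

favourable : ∀ T → (Vec Bool T → Bool) → List (Vec Bool T)
favourable zero    g = if g [] then [] ∷ [] else []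
favourable (suc T) g = List.map (false ∷_) (favourable T (g ∘ (false ∷_)))
                       List.++ List.map (true ∷_) (favourable T (g ∘ (true ∷_)))

favourable-length : ∀ T g → length (favourable T g) ≡ count g
favourable-length zero g with g []
... | false = refl
... | true  = refl
favourable-length (suc T) g =
  trans (length-++ (List.map (false ∷_) (favourable T (g ∘ (false ∷_)))))
        (cong₂ _+_ (trans (length-map _ (favourable T _)) (favourable-length T _))
                   (trans (length-map _ (favourable T _)) (favourable-length T _)))

favourable-all : ∀ T g → All (λ u → g u ≡ true) (favourable T g)
favourable-all zero g with g [] in e
... | false = []
... | true  = e ∷ []
favourable-all (suc T) g =
  All.++⁺ (All.map⁺ (favourable-all T (g ∘ (false ∷_)))) (All.map⁺ (favourable-all T (g ∘ (true ∷_))))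

favourable-unique : ∀ T g → Unique (favourable T g)
favourable-unique zero g with g []
... | false = []
... | true  = [] ∷ []
favourable-unique (suc T) g =
  Unique.++⁺ (Unique.map⁺ (λ { refl → refl }) (favourable-unique T (g ∘ (false ∷_))))
             (Unique.map⁺ (λ { refl → refl }) (favourable-unique T (g ∘ (true ∷_)))) disjoint
  where
  disjoint : ∀ {u} → u ∈ List.map (false ∷_) (favourable T (g ∘ (false ∷_))) ×
                     u ∈ List.map (true ∷_) (favourable T (g ∘ (true ∷_))) → ⊥
  disjoint (p , q) with ∈-map⁻ (false ∷_) p | ∈-map⁻ (true ∷_) q
  ... | _ , _ , refl | _ , _ , ()

-- The surplus coins multiply both sides by `2 ^ rest`, and `C` has been established whatever coins
-- follow the sample.
probably : ∀ {A : Set} (SA : Sampler A) {T} → width SA ≤ T → (g : A → Bool) → 2 * sum SA (λ _ → 1) ≤ 3 * sum SA (ind ∘ g) →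
           {C : List Bool → Set} → (∀ a r → g a ≡ true → C (feed SA a r)) → Probably {T} (λ r → C (toList r))
probably SA {T} w≤T g likely {C} good⇒C with T ∸ width SA | m+[n∸m]≡n w≤T
... | rest | refl =
  favourable T h , favourable-unique T h ,
  All.map (λ {u} e → subst C (sym (flat u)) (good⇒C (decode SA (Vec.take w u)) (toList (Vec.drop w u)) e)) (favourable-all T h) ,
  (begin
    2 * 2 ^ (w + rest)                 ≡⟨ cong (2 *_) (^-distribˡ-+-* 2 w rest) ⟩
    2 * (2 ^ w * 2 ^ rest)             ≡⟨ sym (*-assoc 2 (2 ^ w) (2 ^ rest)) ⟩
    2 * 2 ^ w * 2 ^ rest               ≡⟨ cong (λ z → 2 * z * 2 ^ rest) (trans (sym (2^-mass w)) (sum-decode SA (λ _ → 1))) ⟩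
    2 * sum SA (λ _ → 1) * 2 ^ rest    ≤⟨ *-monoˡ-≤ (2 ^ rest) likely ⟩
    3 * sum SA (ind ∘ g) * 2 ^ rest    ≡⟨ *-assoc 3 (sum SA (ind ∘ g)) (2 ^ rest) ⟩
    3 * (sum SA (ind ∘ g) * 2 ^ rest)  ≡⟨ cong (3 *_) (sym counted) ⟩
    3 * length (favourable T h)        ∎)
  where
  open ≤-Reasoning
  w = width SA
  h : Vec Bool (w + rest) → Bool
  h u = g (decode SA (Vec.take w u))
  flat : ∀ u → toList u ≡ feed SA (decode SA (Vec.take w u)) (toList (Vec.drop w u))
  flat u = trans (sym (++-identityʳ (toList u))) (trans (feed-split w u [])
             (trans (cong (feed₁ (Vec.take w u)) (++-identityʳ _)) (feed-decode SA _ _)))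
  counted : length (favourable T h) ≡ sum SA (ind ∘ g) * 2 ^ rest
  counted = trans (favourable-length T h)
    (trans (sum-pair SA (bitsˢ rest) (λ a _ → a) (ind ∘ g))
    (trans (ext (isSum SA) (λ a → trans (constant (∑ⁿ-isSum rest) (ind (g a)))
              (trans (cong (_* ind (g a)) (2^-mass rest)) (*-comm (2 ^ rest) (ind (g a))))))
           (scaleʳ (isSum SA) (2 ^ rest) (ind ∘ g))))

-- Probability that the attempts succeed

module Attempting {n m : ℕ} (F : Formula n m) where

  open Attempts F public

  poolˢ : ∀ K → Sampler (Algorithm.Pool F K)
  poolˢ K = vecˢ (vecˢ (bitsˢ (suc (K * m))) (suc (K * m))) (poolSize (K * m) (n + m))

  poolsˢ : ∀ K i → Sampler (Pools K i)
  poolsˢ K zero    = poolˢ K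
  poolsˢ K (suc i) = pairˢ (poolˢ K) (poolsˢ (suc K) i)

  feed≡ : ∀ K i pools r → feed (poolsˢ K i) pools r ≡ coins K i pools r
  feed≡ K zero    pool           r = refl
  feed≡ K (suc i) (pool , pools) r = cong (feed₃ pool) (feed≡ (suc K) i pools r)

  width≤ : ∀ K i {W} → (∀ j → j ≤ K + i → width (poolˢ j) ≤ W) → width (poolsˢ K i) ≤ suc i * W
  width≤ K zero    w≤ = ≤-trans (w≤ K (m≤m+n K 0)) (m≤m+n _ 0)
  width≤ K (suc i) w≤ =
    +-mono-≤ (w≤ K (m≤m+n K (suc i))) (width≤ (suc K) i (λ j j≤ → w≤ j (≤-trans j≤ (≤-reflexive (sym (+-suc K i))))))

  lastGood : ∀ K i → Pools K i → Bool
  lastGood K zero    pool        = Algorithm.good F K pool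
  lastGood K (suc i) (_ , pools) = lastGood (suc K) i pools

  -- The pools of earlier attempts are independent of the last one and multiply both sides by the
  -- same number.
  lastGood-likely : ∀ K i → 2 * sum (poolsˢ K i) (λ _ → 1) ≤ 3 * sum (poolsˢ K i) (ind ∘ lastGood K i)
  lastGood-likely K zero =
    ≤-trans (≤-reflexive (cong (2 *_) (Algorithm.mass-pool F K)))
            (Algorithm.good-likely F K (Algorithm.pick-ok F K))
  lastGood-likely K (suc i) =
    ≤-trans (≤-reflexive (sym (scale (isSum (poolˢ K)) 2 (λ _ → sum (poolsˢ (suc K) i) (λ _ → 1)))))
    (≤-trans (mono (isSum (poolˢ K)) (λ _ → lastGood-likely (suc K) i))
      (≤-reflexive (scale (isSum (poolˢ K)) 3 (λ _ → sum (poolsˢ (suc K) i) (ind ∘ lastGood (suc K) i)))))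

  lastGood-succeeds : ∀ k → (∀ pool → Algorithm.good F k pool ≡ true → Succeeds k 0 pool) →
                      ∀ K i → K + i ≡ k → ∀ pools → lastGood K i pools ≡ true → Succeeds K i pools
  lastGood-succeeds k win K zero    e pool        g with trans (sym (+-identityʳ K)) e
  ... | refl = win pool g
  lastGood-succeeds k win K (suc i) e (_ , pools) g =
    lastGood-succeeds k win (suc K) i (trans (sym (+-suc K i)) e) pools g

-- Bounds on sizes

-- The 13 comes from `or`, with 11 nodes for the tag and two that join the parts; `2 * (n + m)` pays
-- for the unary index of a variable.
size-formula : ∀ {n m} (F : Formula n m) → size (encFormula F) ≤ ∣ F ∣ * (13 + 2 * (n + m))
size-formula {n} {m} F = go F
  where
  B = 13 + 2 * (n + m)
  index : ∀ {i k} → i ≤ k → k ≤ n + m → i * 2 ≤ 2 * (n + m)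
  index {i} i≤k k≤ = ≤-trans (≤-reflexive (*-comm i 2)) (*-monoʳ-≤ 2 (≤-trans i≤k k≤))
  one : ∀ {a} → a ≤ B → a ≤ 1 * B
  one p = ≤-trans p (m≤m+n _ 0)
  two : ∀ c {a b x y} → c ≤ 11 → a ≤ x * B → b ≤ y * B → 2 + c + (a + b) ≤ suc (x + y) * B
  two c {x = x} {y} c≤ p q = +-mono-≤ (≤-trans (s≤s (s≤s c≤)) (m≤m+n 13 _))
    (≤-trans (+-mono-≤ p q) (≤-reflexive (sym (*-distribʳ-+ B x y))))
  go : ∀ F → size (encFormula F) ≤ ∣ F ∣ * B
  go (con b)   = one (≤-trans (s≤s (s≤s (size-bool b))) (m≤m+n 5 _))
  go (X i)     = one (≤-trans (≤-reflexive (cong (4 +_) (size-unary (toℕ i))))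
                   (+-mono-≤ {5} (m≤m+n 5 8) (index (<⇒≤ (toℕ<n i)) (m≤m+n n m))))
  go (Y j)     = one (≤-trans (≤-reflexive (cong (6 +_) (size-unary (toℕ j))))
                   (+-mono-≤ {7} (m≤m+n 7 6) (index (<⇒≤ (toℕ<n j)) (m≤n+m m n))))
  go (neg F)   = +-mono-≤ {8} (≤-trans (m≤m+n 8 5) (m≤m+n 13 _)) (go F)
  go (and F G) = ≤-trans (≤-reflexive (+-suc 10 _)) (two 9 {x = ∣ F ∣} (m≤m+n 9 2) (go F) (go G))
  go (or F G)  = ≤-trans (≤-reflexive (+-suc 12 _)) (two 11 {x = ∣ F ∣} ≤-refl (go F) (go G))

substitute-size : ∀ {n m} (F : Formula n m) h → ∣ substitute F h ∣ ≡ ∣ F ∣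
substitute-size (con b)   h = refl
substitute-size (X i)     h = refl
substitute-size (Y j)     h = refl
substitute-size (neg F)   h = cong suc (substitute-size F h)
substitute-size (and F G) h = cong suc (cong₂ _+_ (substitute-size F h) (substitute-size G h))
substitute-size (or F G)  h = cong suc (cong₂ _+_ (substitute-size F h) (substitute-size G h))

choose-size : ∀ {n m} (F : Formula n m) H j → ∣ choose F H j ∣ ≤ len H * (2 + ∣ F ∣) + 1
choose-size F leaf    j = ≤-refl
choose-size F (h ∙ H) j =
  ≤-trans (prefer-size (lookupT (unary (toℕ j)) h))
    (≤-trans (+-monoʳ-≤ 2 (+-mono-≤ (≤-reflexive (substitute-size F h)) (choose-size F H j)))
      (≤-reflexive (sym (+-assoc (2 + ∣ F ∣) (len H * (2 + ∣ F ∣)) 1))))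
  where
  prefer-size : ∀ b {G φ : Formula _ 0} → ∣ prefer b G φ ∣ ≤ 2 + (∣ G ∣ + ∣ φ ∣)
  prefer-size false = ≤-refl
  prefer-size true  = n≤1+n _

size-encᵛ : ∀ {A : Set} {n B} (f : A → Tree) (u : Vec A n) → (∀ a → size (f a) ≤ B) → size (encᵛ f u) ≤ n * suc B + 1
size-encᵛ         f []      h = ≤-refl
size-encᵛ {B = B} f (a ∷ u) h = s≤s (≤-trans (+-mono-≤ (h a) (size-encᵛ f u h)) (≤-reflexive (sym (+-assoc B _ 1))))

size-encᴸ : ∀ {ν} (S : List (Vec Bool ν)) → size (encᴸ S) ≤ length S * suc (ν * 4 + 1) + 1
size-encᴸ         []      = ≤-refl
size-encᴸ {ν = ν} (x ∷ S) =
  s≤s (≤-trans (+-mono-≤ (size-▹ x leaf) (size-encᴸ S)) (≤-reflexive (sym (+-assoc (ν * 4 + 1) _ 1))))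

size-drop : ∀ l t → size (dropT l t) ≤ size t
size-drop leaf    t = ≤-refl
size-drop (_ ∙ l) t = ≤-trans (size-drop l (snd t)) (size-snd t)

size-chop : ∀ K l t acc {B} → size t ≤ B → size (chopT (unary K) l t acc) ≤ K * suc B + size acc
size-chop zero    l t acc t≤ = ≤-refl
size-chop (suc K) l t acc {B} t≤ =
  s≤s (≤-trans (+-mono-≤ t≤ (size-chop K l (dropT l t) acc (≤-trans (size-drop l t) t≤)))
               (≤-reflexive (sym (+-assoc B _ (size acc)))))

size-find : ∀ l stuff → size (findT l leaf stuff) ≤ l * 4 + 1
size-find l stuff = let u , e = find-bits l leaf stuff in ≤-trans (≤-reflexive (cong size e)) (size-▹ u leaf)

size-circuits : ∀ {n l B} (f : Fin l → Circuit n) → (∀ j → size (encCircuit (f j)) ≤ B) →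
                size (encCircuits (tabulate f)) ≤ l * suc B + 1
size-circuits {l = zero}  f h = ≤-refl
size-circuits {l = suc l} {B} f h =
  s≤s (≤-trans (+-mono-≤ (h zero) (size-circuits (f ∘ suc) (h ∘ suc))) (≤-reflexive (sym (+-assoc B _ 1))))

-- The dearest gate is `or`: 14 nodes for tags and joints, and `1 + 2 * D` for each of its two
-- wires, as `D` bounds all wire indices.
size-compile : ∀ {n w} (F : Formula n 0) (σ : Fin n → Fin w) d D c → (∀ i → toℕ (σ i) ≡ d + toℕ i) →
               gates F d + n ≤ D → size (encCircuit (compile F σ c)) ≤ ∣ F ∣ * (16 + 4 * D) + size (encCircuit c)
size-compile {n} F σ d D c = go F σ d c
  where
  G = 16 + 4 * D
  const-gate : ∀ {a c} → a ≤ 16 → a + c ≤ 1 * G + c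
  const-gate {c = c} a≤ = +-monoˡ-≤ c (≤-trans a≤ (≤-trans (m≤m+n 16 (4 * D)) (m≤m+n G 0)))
  index : ∀ {i} → i ≤ D → size (unary i) ≤ 1 + 2 * D
  index {i} i≤ = ≤-trans (≤-reflexive (size-unary i)) (s≤s (≤-trans (≤-reflexive (*-comm i 2)) (*-monoʳ-≤ 2 i≤)))
  pair-gate : ∀ {x a b c y} → x ≤ 14 → a ≤ 1 + 2 * D → b ≤ 1 + 2 * D → c ≤ y → (x + (a + b)) + c ≤ G + y
  pair-gate x≤ p q r = +-mono-≤ (≤-trans (+-mono-≤ x≤ (+-mono-≤ p q)) (≤-reflexive (lemma D))) r
    where
    lemma : ∀ D → 14 + ((1 + 2 * D) + (1 + 2 * D)) ≡ 16 + 4 * D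
    lemma = solve-∀
  split : ∀ a b c → a * G + (b * G + (G + c)) ≡ suc (a + b) * G + c
  split a b c = lemma a b c G
    where
    lemma : ∀ a b c G → a * G + (b * G + (G + c)) ≡ suc (a + b) * G + c
    lemma = solve-∀
  zero-index : ∀ (F F′ : Formula n 0) d → suc (gates F′ (gates F d)) + n ≤ D →
               ∀ {w} → size (unary (toℕ (shift F′ {suc w} zero))) ≤ 1 + 2 * D
  zero-index F F′ d D≤ = index (≤-trans (≤-reflexive (trans (shift-gates F′ zero) (gates-+ F′ 0)))
    (≤-trans (+-monoʳ-≤ ∣ F′ ∣ z≤n) (≤-trans (≤-reflexive (sym (gates-+ F′ (gates F d)))) (≤-trans (m≤m+n _ n) (≤-trans (n≤1+n _) D≤)))))
  go : ∀ {w} (F : Formula n 0) (σ : Fin n → Fin w) d c → (∀ i → toℕ (σ i) ≡ d + toℕ i) → gates F d + n ≤ D →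
       size (encCircuit (compile F σ c)) ≤ ∣ F ∣ * G + size (encCircuit c)
  go (con b) σ d c σ≡ D≤ = const-gate {7 + size (bool b)} (+-monoʳ-≤ 7 (≤-trans (size-bool b) (m≤m+n 3 6)))
  go (X i) σ d c σ≡ D≤ = ≤-trans (pair-gate {12} (m≤m+n 12 2) i≤ i≤ ≤-refl) (+-monoˡ-≤ (size (encCircuit c)) (m≤m+n G 0))
    where
    i≤ = index (≤-trans (≤-trans (≤-reflexive (σ≡ i)) (+-mono-≤ (n≤1+n d) (<⇒≤ (toℕ<n i)))) D≤)
  go (neg F) σ d c σ≡ D≤ = ≤-trans (go F σ d (gate (neg zero) c) σ≡ (≤-trans (n≤1+n _) D≤))
    (≤-trans (+-monoʳ-≤ (∣ F ∣ * G) (+-monoˡ-≤ (size (encCircuit c)) (≤-trans (m≤m+n 10 6) (m≤m+n 16 (4 * D)))))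
      (≤-reflexive (lemma ∣ F ∣ G (size (encCircuit c)))))
    where
    lemma : ∀ a G c → a * G + (G + c) ≡ suc a * G + c
    lemma = solve-∀
  go (and F F′) σ d c σ≡ D≤ = ≤-trans (go F σ d _ σ≡ (≤-trans (+-monoˡ-≤ n (m≤n⇒m≤1+n (≤-gates F′ (gates F d)))) D≤))
    (≤-trans (+-monoʳ-≤ (∣ F ∣ * G) (go F′ (shift F ∘ σ) (gates F d) (gate (and zero (shift F′ zero)) c)
                (λ i → gates-shift F d (σ i) (toℕ i) (σ≡ i)) (≤-trans (n≤1+n _) D≤)))
    (≤-trans (+-monoʳ-≤ (∣ F ∣ * G) (+-monoʳ-≤ (∣ F′ ∣ * G) (pair-gate {12} {1} (m≤m+n 12 2) (s≤s z≤n) (zero-index F F′ d D≤) ≤-refl)))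
             (≤-reflexive (split ∣ F ∣ ∣ F′ ∣ (size (encCircuit c))))))
  go (or F F′) σ d c σ≡ D≤ = ≤-trans (go F σ d _ σ≡ (≤-trans (+-monoˡ-≤ n (m≤n⇒m≤1+n (≤-gates F′ (gates F d)))) D≤))
    (≤-trans (+-monoʳ-≤ (∣ F ∣ * G) (go F′ (shift F ∘ σ) (gates F d) (gate (or zero (shift F′ zero)) c)
                (λ i → gates-shift F d (σ i) (toℕ i) (σ≡ i)) (≤-trans (n≤1+n _) D≤)))
    (≤-trans (+-monoʳ-≤ (∣ F ∣ * G) (+-monoʳ-≤ (∣ F′ ∣ * G) (pair-gate {14} {1} ≤-refl (s≤s z≤n) (zero-index F F′ d D≤) ≤-refl)))
             (≤-reflexive (split ∣ F ∣ ∣ F′ ∣ (size (encCircuit c))))))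

module Sizes {n m : ℕ} (F : Formula n m) (K : ℕ) where

  open Algorithm F K

  -- The `suc N` rows of a block have `suc (suc N)` suffixes, the empty one included. Each yields
  -- `K` entries, and an entry may be as large as a whole tuple because `chopT` cuts suffixes.
  blockBound hypothesisBound : ℕ
  blockBound      = suc (suc N) * (K * suc (N * 4 + 1))
  hypothesisBound = poolSize N ν * blockBound + 1

  size-sample : ∀ S {j} (rows : Vec (Vec Bool (suc N)) j) acc →
                size (sampleT S rows acc) ≤ suc j * (K * suc (N * 4 + 1)) + size acc
  size-sample S [] acc =
    ≤-trans (size-chop K (unary m) _ acc (size-find N (tuples S [])))
            (+-monoˡ-≤ (size acc) (m≤m+n _ 0))
  size-sample S {suc j} (row ∷ rows) acc =
    ≤-trans (size-sample S rows _)
    (≤-trans (+-monoʳ-≤ (suc j * b) (size-chop K (unary m) _ acc (size-find N (tuples S (row ∷ rows)))))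
      (≤-reflexive (lemma (suc j) b (size acc))))
    where
    b = K * suc (N * 4 + 1)
    lemma : ∀ j b a → j * b + (b + a) ≡ suc j * b + a
    lemma = solve-∀

  size-samples : ∀ S {R} (pool : Vec Block R) acc → size (samplesT S pool acc) ≤ R * blockBound + size acc
  size-samples S []           acc = ≤-refl
  size-samples S {suc R} (blk ∷ pool) acc =
    ≤-trans (size-samples S pool _)
    (≤-trans (+-monoʳ-≤ (R * blockBound) (size-sample S blk acc)) (≤-reflexive (lemma R blockBound (size acc))))
    where
    lemma : ∀ R b a → R * b + (b + a) ≡ suc R * b + a
    lemma = solve-∀

  size-hypothesis : ∀ S pool → size (hypothesis S pool) ≤ hypothesisBound
  size-hypothesis S pool = size-samples S pool leaf

  chooseBound : ℕ
  chooseBound = hypothesisBound * (2 + ∣ F ∣) + 1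

  choose≤ : ∀ S pool j → ∣ choose F (hypothesis S pool) j ∣ ≤ chooseBound
  choose≤ S pool j = ≤-trans (choose-size F (hypothesis S pool) j)
    (+-monoˡ-≤ 1 (*-monoˡ-≤ (2 + ∣ F ∣)
      (≤-trans (n≤1+n _) (≤-trans (len<size (hypothesis S pool)) (size-hypothesis S pool)))))

  gates≡ : ∀ (φ : Formula n 0) → gates φ 0 ≡ ∣ φ ∣
  gates≡ φ = trans (gates-+ φ 0) (+-identityʳ ∣ φ ∣)

  circuit≤ : ∀ S pool j → size (encCircuit (circuit F (hypothesis S pool) j)) ≤
                          chooseBound * (16 + 4 * (chooseBound + n)) + 3
  circuit≤ S pool j =
    ≤-trans (size-compile φ (λ i → i) 0 (chooseBound + n) (output zero) (λ i → refl)
              (+-monoˡ-≤ n (≤-trans (≤-reflexive (gates≡ φ)) (choose≤ S pool j))))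
            (+-monoˡ-≤ 3 (*-monoˡ-≤ _ (choose≤ S pool j)))
    where φ = choose F (hypothesis S pool) j

-- Assembling the polynomial

-- There are two scales: sizes are bounded by `base ^ degree`, and this number is the base `M` for
-- the running times. The final polynomial is therefore a power of a power.
degree : ℕ
degree = 250

module Scale {n m : ℕ} (F : Formula n m) (k : ℕ) where

  base : ℕ
  base = 2 + (n + (m + (∣ F ∣ + k)))

  2≤base : 2 ≤ base
  2≤base = m≤m+n 2 _

  open Growth base 2≤base

  M : ℕ
  M = P degree

  2≤M : 2 ≤ M
  2≤M = P-up (n≤P 2)

  open RoundTime M 2≤M F using (Fits; small) renaming (P to P′; M≤P1 to M≤P′1)

  lift : ∀ {x d} → {True (d ≤? degree)} → x ≤ P d → x ≤ P′ 1
  lift {_} {d} {d≤} p = ≤-trans (P-up {d} {degree} {_} {d≤} p) M≤P′1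

  n-d : n ≤ P 1
  n-d = ≤-trans (≤-trans (m≤m+n n _) (m≤n+m _ 2)) M≤P1

  m-d : m ≤ P 1
  m-d = ≤-trans (≤-trans (≤-trans (m≤m+n m _) (m≤n+m _ n)) (m≤n+m _ 2)) M≤P1

  F-d : ∣ F ∣ ≤ P 1
  F-d = ≤-trans (≤-trans (≤-trans (≤-trans (m≤m+n ∣ F ∣ k) (m≤n+m _ m)) (m≤n+m _ n)) (m≤n+m _ 2)) M≤P1

  k-d : k ≤ P 1
  k-d = ≤-trans (≤-trans (≤-trans (≤-trans (m≤n+m k ∣ F ∣) (m≤n+m _ m)) (m≤n+m _ n)) (m≤n+m _ 2)) M≤P1

  unary-d : ∀ {i d} → i ≤ P d → size (unary i) ≤ P (suc (d + 2))
  unary-d {i} i≤ = ≤-trans (≤-reflexive (size-unary i)) (P-suc (P-× i≤ (n≤P 2)))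

  F̂-d : size (encFormula F) ≤ P _
  F̂-d = ≤-trans (size-formula F) (P-× F-d (P-+ (n≤P 13) (P-× (n≤P 2) (P-+ n-d m-d))))

  module _ {K : ℕ} (K≤k : K ≤ k) where

    open Algorithm F K
    open Sizes F K

    K-d : K ≤ P 1
    K-d = ≤-trans K≤k k-d

    N-d : N ≤ P 2
    N-d = P-× K-d m-d

    ν-d : ν ≤ P 2
    ν-d = P-+ n-d m-d

    volume-d : (2 + ν) * (2 + N) ≤ P 6
    volume-d = P-× (P-+ (n≤P 2) ν-d) (P-+ (n≤P 2) N-d)

    pool-d : poolSize N ν ≤ P 22
    pool-d = P-× (n≤P 16) volume-d

    tuple-bits-d : N * 4 + 1 ≤ P 7
    tuple-bits-d = P-+ (P-× N-d (n≤P 4)) (n≤P 1)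

    input-bits-d : ν * 4 + 1 ≤ P 7
    input-bits-d = P-+ (P-× ν-d (n≤P 4)) (n≤P 1)

    tuples-d : ∀ S → length S ≤ N → ∀ {j} → j ≤ suc N → (rows : Vec (Vec Bool (suc N)) j) → size (tuples S rows) ≤ P _
    tuples-d S S≤ j≤ rows =
      P-node (1≤P 0) (P-node
        (≤-trans (size-encᵛ encBits rows (λ row → size-▹ row leaf))
          (P-+ (P-× (≤-trans j≤ (P-suc N-d)) (P-suc (P-+ (P-× (P-suc N-d) (n≤P 4)) (n≤P 1)))) (n≤P 1)))
        (P-node
          (P-node F̂-d (≤-trans (size-encᴸ S) (P-+ (P-× (≤-trans S≤ N-d) (P-suc input-bits-d)) (n≤P 1))))
          (P-node (unary-d K-d) (unary-d m-d))))

    hypothesis-d : hypothesisBound ≤ P _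
    hypothesis-d = P-+ (P-× pool-d (P-× (P-suc (P-suc N-d)) (P-× K-d (P-suc tuple-bits-d)))) (n≤P 1)

    choose-d : chooseBound ≤ P _
    choose-d = P-+ (P-× hypothesis-d (P-+ (n≤P 2) F-d)) (n≤P 1)

    uncovered-d : ∀ S pool → size (uncovered (hypothesis S pool)) ≤ P _
    uncovered-d S pool =
      P-node (n≤P 3) (P-node F̂-d (P-node (unary-d n-d) (≤-trans (size-hypothesis S pool) hypothesis-d)))

    width-d : width (Attempting.poolˢ F K) ≤ P _
    width-d = P-× pool-d (P-× (P-suc N-d) (P-suc N-d))

    fits : Fits K
    fits = record
      { F≼         = small (lift F̂-d)
      ; n<         = lift (P-suc n-d)
      ; m≼         = small (lift (unary-d m-d))
      ; K≼         = small (lift (unary-d K-d))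
      ; input-bits = lift input-bits-d
      ; tuple-bits = lift tuple-bits-d
      ; s<         = lift (P-suc (P-suc N-d))
      ; volume<    = lift (P-suc volume-d)
      ; pool<      = lift (P-suc pool-d)
      ; tuples≼    = λ S S≤ j≤ rows → small (lift (tuples-d S S≤ j≤ rows))
      ; uncovered≼ = λ S pool → small (lift (uncovered-d S pool))
      ; choose≼    = λ S pool j → lift (≤-trans (size-formula (choose F (hypothesis S pool) j))
                       (P-× (≤-trans (choose≤ S pool j) choose-d) (P-+ (n≤P 13) (P-× (n≤P 2) (P-+ n-d (z≤n {P 0}))))))
      ; gates≤     = λ S pool j → lift (P-suc (≤-trans (≤-trans (≤-reflexive (gates≡ (choose F (hypothesis S pool) j)))
                                                                 (choose≤ S pool j)) choose-d))
      ; output≼    = λ S pool → lift (≤-trans (size-circuits (circuit F (hypothesis S pool)) (circuit≤ S pool))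
                       (P-+ (P-× m-d (P-suc (P-+ (P-× choose-d (P-+ (n≤P 16) (P-× (n≤P 4) (P-+ choose-d n-d)))) (n≤P 3)))) (n≤P 1)))
      }

synthesizer : Program randᴼ 3
synthesizer = record
  { arity = arity
  ; body  = body randᴼ
  ; main  = call loopᶠ (leaf ∷ v 0 ∷ v 1 ∷ v 2 ∷ [])
  }

runningTime : Poly 4
runningTime = ((con 2 ⊕ (var (# 0) ⊕ (var (# 1) ⊕ (var (# 2) ⊕ var (# 3))))) ^ᵖ degree) ^ᵖ 270

module Synthesis {n m : ℕ} (F : Formula n m) (k : ℕ) where

  open Scale F k using (base; 2≤base; M; 2≤M; fits; lift; k-d; width-d)
  module G₀ = Growth base 2≤base
  open RoundTime M 2≤M F
  open Attempting F using (poolsˢ; feed≡; width≤)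

  budget : ℕ
  budget = eval runningTime (n ∷ m ∷ ∣ F ∣ ∷ k ∷ [])

  budget≡ : budget ≡ P 270
  budget≡ = eval-^ᵖ _ (n ∷ m ∷ ∣ F ∣ ∷ k ∷ []) (G₀.eval-^ᵖ _ (n ∷ m ∷ ∣ F ∣ ∷ k ∷ []) refl degree) 270

  k< : suc k ≤ P 1
  k< = lift (G₀.P-suc k-d)

  width≤budget : width (poolsˢ 0 k) ≤ budget
  width≤budget = ≤-trans (width≤ 0 k (λ j j≤ → lift (width-d j≤)))
    (≤-trans (P-× {1} {1} k< ≤-refl) (≤-trans (P-mono {2} {270} (s≤s (s≤s z≤n))) (≤-reflexive (sym budget≡))))

  synthesizes : ∀ pools r → Succeeds 0 k pools → Synthesizes oracle synthesizer F budget (feed (poolsˢ 0 k) pools r)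
  synthesizes pools r s with loop⇓ k 0 (λ j j≤ → fits j≤) pools r s
  ... | H , r′ , covering , out≤ , loops =
    circuits F H , Correctness.isSkolem F H covering , r′ , Runs.time main⇓ ,
    subst (λ r → _ ⊢ _ ∣ r ⇓ _ ∣ r′ # _) (sym (feed≡ 0 k pools r)) (Runs.eval⇓ main⇓) ,
    ≤-trans (+-mono-≤ (≤-trans (Runs.bound main⇓) (≤-reflexive (+-identityʳ _))) out≤)
      (≤-trans (P-+ {268} {1} ≤-refl ≤-refl) (≤-trans (P-up {269} {270} ≤-refl) (≤-reflexive (sym budget≡))))
    where
    open Semantics oracle (body randᴼ)
    main⇓ : Runs (unary n ∷ unary m ∷ encFormula F ∷ []) (Program.main synthesizer) (coins 0 k pools r)
                 (encCircuits (circuits F H)) r′ 268 0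
    main⇓ = up⇓ (call⇓ (leaf⇓ ∷⇓ var⇓ ∷⇓ var⇓ ∷⇓ var⇓ ∷⇓ []⇓) (flat⇓ k< loops))

theorem8 : Σ[ L ∈ (Tree → Bool) ] NP L ×
    (Σ[ P ∈ Program randᴼ 3 ] Σ[ p ∈ Poly 4 ]
    (∀ (n m : ℕ) (F : Formula n m) (k : ℕ) →
    (Σ[ Ψ* ∈ Vec (BoolFun n) m ] (IsSkolem F Ψ* × ImageSize F Ψ* k)) →
    SynthesizesWithin L P F (eval p (n ∷ m ∷ ∣ F ∣ ∷ k ∷ []))))
theorem8 = oracle , NP-oracle , synthesizer , runningTime , λ where
  n m F _ (Ψ* , skolem , ys , _ , refl , image) →
    let k = length ys
        open Attempting F
        open Synthesis F k using (width≤budget; synthesizes)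
    in probably (poolsˢ 0 k) width≤budget (lastGood 0 k) (lastGood-likely 0 k)
         {C = Synthesizes oracle synthesizer F (eval runningTime (n ∷ m ∷ ∣ F ∣ ∷ k ∷ []))}
         (λ pools r g → synthesizes pools r
           (lastGood-succeeds k
             -- In the attempt with `K = k` the image of `Ψ*`, written as one tuple, is the version
             -- that survives every round.
             (λ pool good → Algorithm.start F k pool good (Correctness.concat F ys)
                              (Correctness.concat-correct F skolem ys image))
             0 k refl pools g))
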